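{- Let $r\geq 2$ and $1\leq i\leq r$ be integers. For every nonnegative integer $n$, $$C_{r,i}(n)=T_{r,i}(n)=E_{r,i}(n).$$
   Context: A partition $\lambda=(\lambda_1,\dots,\lambda_s)$ of $n$ is a non-increasing sequence of positive integers (parts) with sum $n$; $s$ is its length. $T_{r,i}(n)$ is the number of partitions $\lambda=(\lambda_1,\dots,\lambda_s)$ of $n$ such that $\lambda_j-\lambda_{j+r-1}\geq 2$ for all $j$ with $1\le j$ and $j+r-1\leq s$, and at most $i-1$ parts are equal to $1$. $E_{r,i}(n)$ is the number of partitions of $n$ none of whose parts is congruent to $0$, $i$ or $-i$ modulo $2r+1$. For a partition $\lambda=(\lambda_1,\dots,\lambda_s)$, set $\lambda_j:=0$ for $j\leq 0$ and define for $1\le \ell\le r-1$ the numbers $p_{i,\ell}(\lambda)$ by $p_{i,1}(\lambda)=\lambda_s$; $p_{i,\ell}(\lambda)=\lambda_{s-\sum_{j=1}^{\ell-1}p_{i,j}(\lambda)}$ if $2\leq \ell\leq i$; $p_{i,\ell}(\lambda)=\lambda_{s+\ell-i-\sum_{j=1}^{\ell-1}p_{i,j}(\lambda)}$ if $i<\ell\leq r-1$; with the rule that if $p_{i,\ell}(\lambda)=0$ then $p_{i,j}(\lambda)=0$ for all $j>\ell$. Let $N_{r,i}(\lambda)$ be the number of $\ell\in\{1,\dots,r-1\}$ with $p_{i,\ell}(\lambda)\neq 0$. $\mathcal{C}_{r,i}$ is the set of partitions $\lambda=(\lambda_1,\dots,\lambda_s)$ with at most $i-1$ parts equal to $1$ and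 such that either $N_{r,i}(\lambda)<r-1$, or $N_{r,i}(\lambda)=r-1$ and $s\leq \sum_{j=1}^{r-1}p_{i,j}(\lambda)-(r-i)$. $C_{r,i}(n)$ is the number of partitions of $n$ in $\mathcal{C}_{r,i}$. -}

module Defs where

open import Data.Nat using (ℕ; zero; suc; _+_; _∸_; _≤_; _<_; _≤ᵇ_; _<ᵇ_; _≡ᵇ_; _%_)
open import Data.Bool using (Bool; true; false; _∧_; _∨_; not; if_then_else_)
open import Data.List using (List; []; _∷_; length; map; concatMap; filter; foldr)
open import Data.Nat.ListAction using (sum)
open import Relation.Nullary.Decidable using (yes; no)
open import Relation.Unary using (Decidable)
open import Relation.Binary.PropositionalEquality using (_≡_)
open import Data.Bool.Properties using (T?)
open import Data.Bool using (T)

range1 : ℕ → List ℕ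
range1 zero    = []
range1 (suc m) = range1 m Data.List.++ (suc m ∷ [])

range0 : ℕ → List ℕ
range0 m = 0 ∷ range1 m

listsOfLen : ℕ → ℕ → List (List ℕ)
listsOfLen m zero    = [] ∷ []
listsOfLen m (suc k) = concatMap (λ x → map (x ∷_) (listsOfLen m k)) (range1 m)

-- every partition of n has length ≤ n and all parts in [1 .. n];
-- so this list contains every partition of n exactly once
candidates : ℕ → List (List ℕ)
candidates n = concatMap (listsOfLen n) (range0 n)

nonIncreasing : List ℕ → Bool
nonIncreasing []            = true
nonIncreasing (x ∷ [])      = true
nonIncreasing (x ∷ y ∷ xs)  = (y ≤ᵇ x) ∧ nonIncreasing (y ∷ xs)

allPositive : List ℕ → Bool
allPositive []       = true
allPositive (x ∷ xs) = (1 ≤ᵇ x) ∧ allPositive xs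

isPartitionOf : ℕ → List ℕ → Bool
isPartitionOf n λs = nonIncreasing λs ∧ allPositive λs ∧ (sum λs ≡ᵇ n)

countPartitions : (List ℕ → Bool) → ℕ → ℕ
countPartitions P n =
  length (filter (λ λs → T? (isPartitionOf n λs ∧ P λs)) (candidates n))

-- λ_j (1-based), with λ_j = 0 for j ≤ 0 (j = 0 here) and for j > s
part : List ℕ → ℕ → ℕ
part []       _             = 0
part (x ∷ xs) zero          = 0
part (x ∷ xs) (suc zero)    = x
part (x ∷ xs) (suc (suc j)) = part xs (suc j)

-- λ_{a - b} as an integer index (0 when a - b ≤ 0)
partAt : List ℕ → ℕ → ℕ → ℕ
partAt λs a b = if a ≤ᵇ b then 0 else part λs (a ∸ b)

onesCount : List ℕ → ℕ
onesCount []       = 0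
onesCount (x ∷ xs) = (if x ≡ᵇ 1 then 1 else 0) + onesCount xs

atMostOnes : ℕ → List ℕ → Bool
atMostOnes i λs = onesCount λs <ᵇ i

gapCond : ℕ → List ℕ → Bool
gapCond r λs = go (range1 (length λs))
  where
  go : List ℕ → Bool
  go []       = true
  go (j ∷ js) =
    (if (j + r ∸ 1) ≤ᵇ length λs
       then (part λs (j + r ∸ 1) + 2 ≤ᵇ part λs j)
       else true) ∧ go js

T-cond : ℕ → ℕ → List ℕ → Bool
T-cond r i λs = gapCond r λs ∧ atMostOnes i λs

T-count : ℕ → ℕ → ℕ → ℕ
T-count r i = countPartitions (T-cond r i)

E-cond : ℕ → ℕ → List ℕ → Bool
E-cond r i λs = go λs
  where
  m = suc (r + r)
  bad : ℕ → Bool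
  bad x = (x % m ≡ᵇ 0) ∨ (x % m ≡ᵇ i % m) ∨ ((x + i) % m ≡ᵇ 0)
  go : List ℕ → Bool
  go []       = true
  go (x ∷ xs) = not (bad x) ∧ go xs

E-count : ℕ → ℕ → ℕ → ℕ
E-count r i = countPartitions (E-cond r i)

-- C_{r,i}: the numbers p_{i,ℓ}(λ), ℓ = 1 … r-1.
-- p_{i,ℓ} = λ_{s - Σ_{j<ℓ} p_{i,j}}          for ℓ ≤ i  (ℓ = 1 gives λ_s)
-- p_{i,ℓ} = λ_{s + ℓ - i - Σ_{j<ℓ} p_{i,j}}  for i < ℓ ≤ r-1
-- once some p_{i,ℓ} = 0 all later ones are 0.

-- pSeq λs i ℓ k σ stopped : the values p_{i,ℓ}, …, p_{i,ℓ+k-1},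
-- where σ = Σ_{j<ℓ} p_{i,j} and stopped says an earlier p was 0
pSeq : List ℕ → ℕ → ℕ → ℕ → ℕ → Bool → List ℕ
pSeq λs i ℓ zero    σ stopped = []
pSeq λs i ℓ (suc k) σ true    = 0 ∷ pSeq λs i (suc ℓ) k σ true
pSeq λs i ℓ (suc k) σ false   =
  let s = length λs
      p = if ℓ ≤ᵇ i then partAt λs s σ else partAt λs (s + ℓ) (i + σ)
  in p ∷ pSeq λs i (suc ℓ) k (σ + p) (p ≡ᵇ 0)

ps : ℕ → ℕ → List ℕ → List ℕ
ps r i λs = pSeq λs i 1 (r ∸ 1) 0 false

N : ℕ → ℕ → List ℕ → ℕ
N r i λs = length (filter (λ p → T? (not (p ≡ᵇ 0))) (ps r i λs))

C-cond : ℕ → ℕ → List ℕ → Bool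
C-cond r i λs =
  atMostOnes i λs ∧
  ( (N r i λs <ᵇ r ∸ 1)
  ∨ ((N r i λs ≡ᵇ r ∸ 1) ∧ (length λs + (r ∸ i) ≤ᵇ sum (ps r i λs))) )

C-count : ℕ → ℕ → ℕ → ℕ
C-count r i = countPartitions (C-cond r i)

{-# OPTIONS --safe #-}

-- Modulo q ^ (M + 1), where M is the number being partitioned, each of the three generating
-- functions is 1 / (q)_M times  Σ_n (-1)^n q^((2r+1)n(n+1)/2 - in) (1 - q^(i(2n+1))),  n ≥ 0.
--
-- T: let T_i(N) count the partitions with parts > N subject to the gap condition and with fewer
-- than i parts N + 1.  Removing the parts N + 1 when there are exactly i - 1 of them gives
-- T_i(N) = T_{i-1}(N) + q^((N+1)(i-1)) T_{r-i+1}(N + 1), and T_i(N) ≡ 1 for N = M.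
-- An explicit alternating sum (Selberg, Andrews) satisfies the same recurrence.
--
-- C: the numbers p_{i,ℓ} cut a partition, greedily from its smallest part on, into intervals
-- on which the number of parts is at most the smallest part (the first i - 1 intervals) or less
-- than it (the other r - i).  A cover by such intervals exists if and only if the greedy
-- algorithm starting from the largest part finds one, and the latter is a Durfee dissection.
-- The resulting multisum is evaluated by iterating Bailey's lemma at a = 1 and then at a = q.
--
-- E: a finite form of the Jacobi triple product.
module Submission where

open import Defs
open import Data.Nat using (ℕ; _≤_)
open import Data.Product using (_×_)
open import Relation.Binary.PropositionalEquality using (_≡_)
open import Algebra.Bundles using (CommutativeRing)
open import Algebra.Solver.Ring.AlmostCommutativeRing using (fromCommutativeRing; _-Raw-AlmostCommutative⟶_; Induced-equivalence)
open import Algebra.Structures using (IsCommutativeRing)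
open import Data.Bool using (Bool; true; false; _∧_; _∨_; not; T; if_then_else_)
open import Data.Bool.Properties using (T?; T-∧; T-∨; T-≡; ∨-zeroʳ)
open import Data.Empty using (⊥; ⊥-elim)
open import Data.Integer as ℤ using (ℤ; +_; 0ℤ; 1ℤ)
import Data.Integer.Properties as ℤₚ
open import Data.Integer.Tactic.RingSolver using () renaming (solve-∀ to ℤ-solve)
open import Data.List using (List; []; _∷_; _++_; length; map; filter; take; drop; replicate; initLast; _∷ʳ′_)
import Data.List.Properties as Listₚ
open import Data.List.Membership.Propositional using (_∈_; find; lose)
open import Data.List.Membership.Propositional.Properties
open import Data.List.Relation.Unary.All as All using (All; []; _∷_)
import Data.List.Relation.Unary.All.Properties as Allₚ
open import Data.List.Relation.Unary.AllPairs as AllPairs using ([]; _∷_)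
import Data.List.Relation.Unary.AllPairs.Properties as AllPairsₚ
open import Data.List.Relation.Unary.Any using (here; there)
open import Data.List.Relation.Unary.Unique.Propositional using (Unique)
import Data.List.Relation.Unary.Unique.Propositional.Properties as Uniqueₚ
open import Data.Maybe.Base using (just; nothing)
open import Data.Nat as ℕ using (zero; suc; z≤n; s≤s; _∸_; _<_; _≤ᵇ_; _≡ᵇ_; _<ᵇ_; _%_)
open import Data.Nat.DivMod using ([m+kn]%n≡m%n; m<n⇒m%n≡m; m*n%n≡0)
open import Data.Nat.ListAction using (sum)
open import Data.Nat.ListAction.Properties using (sum-++)
import Data.Nat.Properties as ℕₚ
open import Data.Nat.Tactic.RingSolver using () renaming (solve-∀ to ℕ-solve)
open import Data.Product using (_,_; ∃; ∃₂; proj₁; proj₂)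
open import Data.Sum as Sum using (_⊎_; inj₁; inj₂)
open import Function using (_∘_; Equivalence)
open import Level using (0ℓ)
open import Relation.Binary using (Tri; tri<; tri≈; tri>)
open import Relation.Binary.Definitions using (WeaklyDecidable)
open import Relation.Binary.PropositionalEquality as ≡ using (_≢_; refl; cong; cong₂; subst)
open import Relation.Nullary using (¬_; yes; no)

-- Truncated power series

-- The coefficient of q^M involves only degrees up to M, so truncation at M replaces every infinite
-- product by a q-factorial of large enough index, and all limits by stability beyond M.
--
-- The parameter p = r - i is used instead of r. It keeps the exponents free of subtraction and
-- shows the symmetry of the recurrence for T, which leads from (i, p) to (i - 1, p + 1) and to (p +
-- 1, i - 1).
--
-- The multisum for C has i - 1 exponents N^2 and r - i exponents N (N + 1); this mixture is why two
-- values of a occur. The unit Bailey pair at a = 1 has coefficients with two monomials each. After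
-- i steps (one for each square and one that produces the constant 1) monomials of neighbouring
-- coefficients are merged, which changes a to q and creates the factor 1 - q^(i(2n+1)). The
-- remaining r - i steps only multiply the n-th term by q^((r-i)n(n+1)).

Series : Set
Series = ℕ → ℤ

infixl 6 _⊕_
infixl 7 _⊛_

-- Abstract, so that the ring operations are rigid for unification.
abstract
  _⊕_ : Series → Series → Series
  (f ⊕ g) n = f n ℤ.+ g n

  ⊝_ : Series → Series
  (⊝ f) n = ℤ.- f n

  _⊛_ : Series → Series → Series
  (f ⊛ g) zero    = f 0 ℤ.* g 0
  (f ⊛ g) (suc n) = f 0 ℤ.* g (suc n) ℤ.+ ((f ∘ suc) ⊛ g) n

  const : ℤ → Series
  const c zero    = c
  const c (suc _) = 0ℤ

  X : Series
  X 1 = 1ℤ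
  X _ = 0ℤ

  ⊕-coeff : ∀ f g n → (f ⊕ g) n ≡ f n ℤ.+ g n
  ⊕-coeff f g n = refl

  const-zero : ∀ n → const 0ℤ n ≡ 0ℤ
  const-zero zero    = refl
  const-zero (suc n) = refl

  const-suc : ∀ c n → const c (suc n) ≡ 0ℤ
  const-suc c n = refl

  const-0 : ∀ c → const c 0 ≡ c
  const-0 c = refl

  -- Only coefficients up to n enter. Hence series that agree up to degree M have products that do,
  -- and truncated equality is a congruence.
  ⊛-cong : ∀ n {f f′ g g′ : Series} →
           (∀ k → k ℕ.≤ n → f k ≡ f′ k) → (∀ k → k ℕ.≤ n → g k ≡ g′ k) →
           (f ⊛ g) n ≡ (f′ ⊛ g′) n
  ⊛-cong zero    p r = cong₂ ℤ._*_ (p 0 z≤n) (r 0 z≤n)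
  ⊛-cong (suc n) p r = cong₂ ℤ._+_
    (cong₂ ℤ._*_ (p 0 z≤n) (r (suc n) ℕₚ.≤-refl))
    (⊛-cong n (λ k k≤n → p (suc k) (s≤s k≤n)) (λ k k≤n → r k (ℕₚ.m≤n⇒m≤1+n k≤n)))

  ⊛-cong′ : ∀ n {f f′ g g′ : Series} → (∀ k → f k ≡ f′ k) → (∀ k → g k ≡ g′ k) →
            (f ⊛ g) n ≡ (f′ ⊛ g′) n
  ⊛-cong′ n p r = ⊛-cong n (λ k _ → p k) (λ k _ → r k)

  -- Peels the convolution at the end opposite to its definition; commutativity follows by matching
  -- the two recursions.
  ⊛-suc : ∀ f g n → (f ⊛ g) (suc n) ≡ f (suc n) ℤ.* g 0 ℤ.+ (f ⊛ (g ∘ suc)) n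
  ⊛-suc f g zero    = ℤₚ.+-comm (f 0 ℤ.* g 1) (f 1 ℤ.* g 0)
  ⊛-suc f g (suc n) rewrite ⊛-suc (f ∘ suc) g n =
    lem (f 0 ℤ.* g (suc (suc n))) (f (suc (suc n)) ℤ.* g 0) (((f ∘ suc) ⊛ (g ∘ suc)) n)
    where
    lem : ∀ a b c → a ℤ.+ (b ℤ.+ c) ≡ b ℤ.+ (a ℤ.+ c)
    lem = ℤ-solve

  ⊛-comm : ∀ f g n → (f ⊛ g) n ≡ (g ⊛ f) n
  ⊛-comm f g zero    = ℤₚ.*-comm (f 0) (g 0)
  ⊛-comm f g (suc n) = ≡.trans
    (cong₂ ℤ._+_ (ℤₚ.*-comm (f 0) (g (suc n))) (⊛-comm (f ∘ suc) g n))
    (≡.sym (⊛-suc g f n))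

  ⊛-distribʳ : ∀ f g h n → ((g ⊕ h) ⊛ f) n ≡ (g ⊛ f ⊕ h ⊛ f) n
  ⊛-distribʳ f g h zero    = ℤₚ.*-distribʳ-+ (f 0) (g 0) (h 0)
  ⊛-distribʳ f g h (suc n) rewrite ⊛-distribʳ f (g ∘ suc) (h ∘ suc) n =
    lem (g 0) (h 0) (f (suc n)) (((g ∘ suc) ⊛ f) n) (((h ∘ suc) ⊛ f) n)
    where
    lem : ∀ a b c d e → (a ℤ.+ b) ℤ.* c ℤ.+ (d ℤ.+ e) ≡ (a ℤ.* c ℤ.+ d) ℤ.+ (b ℤ.* c ℤ.+ e)
    lem = ℤ-solve

  ⊛-scale : ∀ c f g n → ((λ k → c ℤ.* f k) ⊛ g) n ≡ c ℤ.* (f ⊛ g) n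
  ⊛-scale c f g zero    = ℤₚ.*-assoc c (f 0) (g 0)
  ⊛-scale c f g (suc n) rewrite ⊛-scale c (f ∘ suc) g n =
    lem c (f 0) (g (suc n)) (((f ∘ suc) ⊛ g) n)
    where
    lem : ∀ c a b d → (c ℤ.* a) ℤ.* b ℤ.+ c ℤ.* d ≡ c ℤ.* (a ℤ.* b ℤ.+ d)
    lem = ℤ-solve

  ⊛-assoc : ∀ f g h n → ((f ⊛ g) ⊛ h) n ≡ (f ⊛ (g ⊛ h)) n
  ⊛-assoc f g h zero    = ℤₚ.*-assoc (f 0) (g 0) (h 0)
  ⊛-assoc f g h (suc n)
    rewrite ⊛-distribʳ h (λ k → f 0 ℤ.* g (suc k)) ((f ∘ suc) ⊛ g) n
          | ⊛-scale (f 0) (g ∘ suc) h n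
          | ⊛-assoc (f ∘ suc) g h n
    = lem (f 0) (g 0) (h (suc n)) (((g ∘ suc) ⊛ h) n) (((f ∘ suc) ⊛ (g ⊛ h)) n)
    where
    lem : ∀ a b c d e → a ℤ.* b ℤ.* c ℤ.+ (a ℤ.* d ℤ.+ e) ≡ a ℤ.* (b ℤ.* c ℤ.+ d) ℤ.+ e
    lem = ℤ-solve

  const-⊛ : ∀ c f n → (const c ⊛ f) n ≡ c ℤ.* f n
  const-⊛ c f zero    = refl
  const-⊛ c f (suc n) = ≡.trans (cong (ℤ._+_ (c ℤ.* f (suc n))) (0-⊛ f n)) (ℤₚ.+-identityʳ _)
    where
    0-⊛ : ∀ f n → ((const c ∘ suc) ⊛ f) n ≡ 0ℤ
    0-⊛ f zero    = refl
    0-⊛ f (suc n) = ≡.trans (ℤₚ.+-identityˡ _) (0-⊛ f n)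

  X-⊛-zero : ∀ f → (X ⊛ f) 0 ≡ 0ℤ
  X-⊛-zero f = refl

  X-⊛-suc : ∀ f n → (X ⊛ f) (suc n) ≡ f n
  X-⊛-suc f n = ≡.trans (ℤₚ.+-identityˡ _)
    (≡.trans (⊛-cong′ n {X ∘ suc} {const 1ℤ} {f} {f} (λ { zero → refl ; (suc k) → refl }) (λ _ → refl))
             (≡.trans (const-⊛ 1ℤ f n) (ℤₚ.*-identityˡ _)))

  const-+ : ∀ a b n → const (a ℤ.+ b) n ≡ (const a ⊕ const b) n
  const-+ a b zero    = refl
  const-+ a b (suc n) = refl

  const-* : ∀ a b n → const (a ℤ.* b) n ≡ (const a ⊛ const b) n
  const-* a b zero    = refl
  const-* a b (suc n) = ≡.sym (≡.trans (const-⊛ a (const b) (suc n)) (ℤₚ.*-zeroʳ a))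

  const-neg : ∀ a n → const (ℤ.- a) n ≡ (⊝ const a) n
  const-neg a zero    = refl
  const-neg a (suc n) = refl

module Truncated (M : ℕ) where

  infix 4 _≋_
  -- Equality in the quotient of Z[[X]] by X^(M+1).
  record _≋_ (f g : Series) : Set where
    constructor agree
    field at : ∀ n → n ℕ.≤ M → f n ≡ g n
  open _≋_ public

  private
    everywhere : ∀ {f g} → (∀ n → f n ≡ g n) → f ≋ g
    everywhere p = agree (λ n _ → p n)

  abstract
    isCommutativeRing : IsCommutativeRing _≋_ _⊕_ _⊛_ ⊝_ (const 0ℤ) (const 1ℤ)
    isCommutativeRing = record
        { isRing = record
          { +-isAbelianGroup = record
            { isGroup = record
              { isMonoid = record
                { isSemigroup = record
                  { isMagma = record
                    { isEquivalence = record
                      { refl  = everywhere (λ _ → refl)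
                      ; sym   = λ p → agree (λ n n≤M → ≡.sym (at p n n≤M))
                      ; trans = λ p r → agree (λ n n≤M → ≡.trans (at p n n≤M) (at r n n≤M))
                      }
                    ; ∙-cong = λ p r → agree (λ n n≤M → cong₂ ℤ._+_ (at p n n≤M) (at r n n≤M))
                    }
                  ; assoc = λ f g h → everywhere (λ n → ℤₚ.+-assoc (f n) (g n) (h n))
                  }
                ; identity = (λ f → everywhere (λ n → ≡.trans (cong (ℤ._+ f n) (const-zero n)) (ℤₚ.+-identityˡ _)))
                           , (λ f → everywhere (λ n → ≡.trans (cong (ℤ._+_ (f n)) (const-zero n)) (ℤₚ.+-identityʳ _)))
                }
              ; inverse = (λ f → everywhere (λ n → ≡.trans (ℤₚ.+-inverseˡ (f n)) (≡.sym (const-zero n))))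
                        , (λ f → everywhere (λ n → ≡.trans (ℤₚ.+-inverseʳ (f n)) (≡.sym (const-zero n))))
              ; ⁻¹-cong = λ p → agree (λ n n≤M → cong ℤ.-_ (at p n n≤M))
              }
            ; comm = λ f g → everywhere (λ n → ℤₚ.+-comm (f n) (g n))
            }
          ; *-cong = λ p r → agree (λ n n≤M → ⊛-cong n
                       (λ k k≤n → at p k (ℕₚ.≤-trans k≤n n≤M)) (λ k k≤n → at r k (ℕₚ.≤-trans k≤n n≤M)))
          ; *-assoc = λ f g h → everywhere (⊛-assoc f g h)
          ; *-identity = (λ f → everywhere (λ n → ≡.trans (const-⊛ 1ℤ f n) (ℤₚ.*-identityˡ (f n))))
                       , (λ f → everywhere (λ n → ≡.trans (⊛-comm f (const 1ℤ) n)
                                 (≡.trans (const-⊛ 1ℤ f n) (ℤₚ.*-identityˡ (f n)))))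
          ; distrib = (λ f g h → everywhere (λ n → ≡.trans (⊛-comm f (g ⊕ h) n)
                         (≡.trans (⊛-distribʳ f g h n) (cong₂ ℤ._+_ (⊛-comm g f n) (⊛-comm h f n)))))
                    , (λ f g h → everywhere (⊛-distribʳ f g h))
          }
        ; *-comm = λ f g → everywhere (⊛-comm f g)
        }

  seriesRing : CommutativeRing 0ℓ 0ℓ
  seriesRing = record { isCommutativeRing = isCommutativeRing }

  open CommutativeRing seriesRing public
    hiding (isCommutativeRing; refl; sym; trans; zero; _≈_; Carrier; setoid)
  open CommutativeRing seriesRing public
    using (_≈_; setoid) renaming (refl to ≈-refl; sym to ≈-sym; trans to ≈-trans)

  private
    coefficients : ℤ.+-*-rawRing -Raw-AlmostCommutative⟶ fromCommutativeRing seriesRing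
    coefficients = record
      { ⟦_⟧    = const
      ; +-homo = λ a b → everywhere (const-+ a b)
      ; *-homo = λ a b → everywhere (const-* a b)
      ; -‿homo = λ a → everywhere (const-neg a)
      ; 0-homo = ≈-refl
      ; 1-homo = ≈-refl
      }

    _coeff≟_ : WeaklyDecidable (Induced-equivalence coefficients)
    a coeff≟ b with a ℤ.≟ b
    ... | yes refl = just ≈-refl
    ... | no _     = nothing

  open import Algebra.Solver.Ring ℤ.+-*-rawRing (fromCommutativeRing seriesRing) coefficients _coeff≟_ public
    using (solve; _:=_; _:+_; _:*_; _:-_; :-_; con)
  open import Algebra.Properties.Semiring.Exp semiring public
    using (_^_; ^-homo-*; ^-assocʳ; ^-congˡ; ^-congʳ)

  -- Stands in for convergence. It is applied to X, to y = X^(2r+1-i), and to z * y, which is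
  -- X^(2r+1) only up to truncated equality.
  Nilpotent : Series → Set
  Nilpotent q = ∀ {n} → M < n → q ^ n ≈ 0#

-- q-factorials and the summation behind Bailey's lemma

tri : ℕ → ℕ
tri zero    = 0
tri (suc n) = suc n ℕ.+ tri n

n≤tri : ∀ n → n ℕ.≤ tri n
n≤tri zero    = z≤n
n≤tri (suc n) = ℕₚ.m≤m+n (suc n) (tri n)

tri₋ : ℕ → ℕ
tri₋ zero    = 0
tri₋ (suc n) = tri n

tri-tri₋ : ∀ n → tri n ≡ n ℕ.+ tri₋ n
tri-tri₋ zero    = refl
tri-tri₋ (suc n) = refl

double-tri : ∀ n → tri n ℕ.+ tri n ≡ n ℕ.* (n ℕ.+ 1)
double-tri zero    = refl
double-tri (suc n) = ≡.trans (l₁ n (tri n)) (≡.trans (cong (λ k → suc n ℕ.+ suc n ℕ.+ k) (double-tri n)) (l₂ n))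
  where
  l₁ : ∀ n t → suc n ℕ.+ t ℕ.+ (suc n ℕ.+ t) ≡ suc n ℕ.+ suc n ℕ.+ (t ℕ.+ t)
  l₁ = ℕ-solve
  l₂ : ∀ n → suc n ℕ.+ suc n ℕ.+ n ℕ.* (n ℕ.+ 1) ≡ suc n ℕ.* (suc n ℕ.+ 1)
  l₂ = ℕ-solve

module Sums (M : ℕ) where
  open Truncated M public
  open import Relation.Binary.Reasoning.Setoid setoid

  ∑ : ℕ → (ℕ → Series) → Series
  ∑ zero    f = 0#
  ∑ (suc K) f = ∑ K f + f K

  ∑-cong< : ∀ K {f g} → (∀ n → n ℕ.< K → f n ≈ g n) → ∑ K f ≈ ∑ K g
  ∑-cong< zero    p = ≈-refl
  ∑-cong< (suc K) p = +-cong (∑-cong< K (λ n n<K → p n (ℕₚ.m≤n⇒m≤1+n n<K))) (p K ℕₚ.≤-refl)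

  ∑-cong : ∀ K {f g} → (∀ n → f n ≈ g n) → ∑ K f ≈ ∑ K g
  ∑-cong K p = ∑-cong< K (λ n _ → p n)

  ∑-zero : ∀ K {f} → (∀ n → n ℕ.< K → f n ≈ 0#) → ∑ K f ≈ 0#
  ∑-zero zero    p = ≈-refl
  ∑-zero (suc K) p = ≈-trans (+-cong (∑-zero K (λ n n<K → p n (ℕₚ.m≤n⇒m≤1+n n<K))) (p K ℕₚ.≤-refl)) (+-identityˡ 0#)

  ∑-+ : ∀ K f g → ∑ K (λ n → f n + g n) ≈ ∑ K f + ∑ K g
  ∑-+ zero    f g = ≈-sym (+-identityˡ 0#)
  ∑-+ (suc K) f g = ≈-trans (+-congʳ (∑-+ K f g))
    (solve 4 (λ a b c d → (a :+ b) :+ (c :+ d) := (a :+ c) :+ (b :+ d)) ≈-refl (∑ K f) (∑ K g) (f K) (g K))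

  ∑-*ˡ : ∀ K a f → ∑ K (λ n → a * f n) ≈ a * ∑ K f
  ∑-*ˡ zero    a f = ≈-sym (zeroʳ a)
  ∑-*ˡ (suc K) a f = ≈-trans (+-congʳ (∑-*ˡ K a f)) (≈-sym (distribˡ a (∑ K f) (f K)))

  ∑-swap : ∀ K L (f : ℕ → ℕ → Series) → ∑ K (λ n → ∑ L (f n)) ≈ ∑ L (λ m → ∑ K (λ n → f n m))
  ∑-swap zero    L f = ≈-sym (∑-zero L (λ _ _ → ≈-refl))
  ∑-swap (suc K) L f = ≈-trans (+-congʳ (∑-swap K L f)) (≈-sym (∑-+ L (λ m → ∑ K (λ n → f n m)) (f K)))

  ∑-head : ∀ K f → ∑ (suc K) f ≈ f 0 + ∑ K (f ∘ suc)
  ∑-head zero    f = +-comm 0# (f 0)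
  ∑-head (suc K) f = ≈-trans (+-congʳ (∑-head K f)) (+-assoc (f 0) (∑ K (f ∘ suc)) (f (suc K)))

  ∑-extend : ∀ {K L} f → K ℕ.≤ L → (∀ n → K ℕ.≤ n → f n ≈ 0#) → ∑ L f ≈ ∑ K f
  ∑-extend {K} f K≤L p with ℕₚ.m≤n⇒∃[o]m+o≡n K≤L
  ... | (d , refl) = go d
    where
    go : ∀ d → ∑ (K ℕ.+ d) f ≈ ∑ K f
    go zero    rewrite ℕₚ.+-identityʳ K = ≈-refl
    go (suc d) rewrite ℕₚ.+-suc K d =
      ≈-trans (+-cong (go d) (p (K ℕ.+ d) (ℕₚ.m≤m+n K d))) (+-identityʳ (∑ K f))

  sgn : ℕ → Series
  sgn zero    = 1#
  sgn (suc n) = - sgn n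

  zero-* : ∀ {a} b → a ≈ 0# → a * b ≈ 0#
  zero-* b p = ≈-trans (*-congʳ p) (zeroˡ b)

  *-zero : ∀ a {b} → b ≈ 0# → a * b ≈ 0#
  *-zero a p = ≈-trans (*-congˡ p) (zeroʳ a)

  1-0 : ∀ {a} → a ≈ 0# → 1# - a ≈ 1#
  1-0 p = ≈-trans (+-congˡ (-‿cong p)) (solve 0 (con 1ℤ :- con 0ℤ := con 1ℤ) ≈-refl)

  module Base (q : Series) (q-nil : Nilpotent q) where

    q^+ : ∀ m n → q ^ (m ℕ.+ n) ≈ q ^ m * q ^ n
    q^+ = ^-homo-* q

    q^≡ : ∀ {m n} → m ≡ n → q ^ m ≈ q ^ n
    q^≡ p = ^-congʳ q p

    -- For positive k this is 1 / (1 - q^k): the terms of the geometric series with j > M vanish.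
    geo : ℕ → Series
    geo k = ∑ (suc M) (λ j → q ^ (k ℕ.* j))

    geo-inverse : ∀ k → (1# - q ^ suc k) * geo (suc k) ≈ 1#
    geo-inverse k = ≈-trans (partial (suc M)) (1-0 (q-nil (ℕₚ.m≤m+n (suc M) _)))
      where
      partial : ∀ J → (1# - q ^ suc k) * ∑ J (λ j → q ^ (suc k ℕ.* j)) ≈ 1# - q ^ (suc k ℕ.* J)
      partial zero = ≈-trans (zeroʳ _) (≈-trans (solve 0 (con 0ℤ := con 1ℤ :- con 1ℤ) ≈-refl)
                       (+-congˡ (-‿cong (q^≡ (≡.sym (ℕₚ.*-zeroʳ (suc k)))))))
      partial (suc J) = begin
        (1# - q ^ suc k) * (∑ J (λ j → q ^ (suc k ℕ.* j)) + q ^ (suc k ℕ.* J))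
          ≈⟨ distribˡ _ _ _ ⟩
        (1# - q ^ suc k) * ∑ J (λ j → q ^ (suc k ℕ.* j)) + (1# - q ^ suc k) * q ^ (suc k ℕ.* J)
          ≈⟨ +-congʳ (partial J) ⟩
        (1# - q ^ (suc k ℕ.* J)) + (1# - q ^ suc k) * q ^ (suc k ℕ.* J)
          ≈⟨ solve 2 (λ x y → (con 1ℤ :- y) :+ (con 1ℤ :- x) :* y := con 1ℤ :- x :* y) ≈-refl (q ^ suc k) (q ^ (suc k ℕ.* J)) ⟩
        1# - q ^ suc k * q ^ (suc k ℕ.* J)
          ≈⟨ +-congˡ (-‿cong (≈-trans (≈-sym (q^+ (suc k) (suc k ℕ.* J))) (q^≡ (≡.sym (ℕₚ.*-suc (suc k) J))))) ⟩
        1# - q ^ (suc k ℕ.* suc J) ∎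

    -- `Q n` is (q)_n, and `P n` below is its inverse.
    Q : ℕ → Series
    Q zero    = 1#
    Q (suc n) = (1# - q ^ suc n) * Q n

    P : ℕ → Series
    P zero    = 1#
    P (suc n) = geo (suc n) * P n

    P-suc : ∀ n → (1# - q ^ suc n) * P (suc n) ≈ P n
    P-suc n = ≈-trans (≈-sym (*-assoc _ _ _)) (≈-trans (*-congʳ (geo-inverse n)) (*-identityˡ (P n)))

    Q*P : ∀ n → Q n * P n ≈ 1#
    Q*P zero    = *-identityˡ 1#
    Q*P (suc n) = begin
      (1# - q ^ suc n) * Q n * P (suc n)   ≈⟨ solve 3 (λ a b c → a :* b :* c := b :* (a :* c)) ≈-refl (1# - q ^ suc n) (Q n) (P (suc n)) ⟩
      Q n * ((1# - q ^ suc n) * P (suc n)) ≈⟨ *-congˡ (P-suc n) ⟩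
      Q n * P n                            ≈⟨ Q*P n ⟩
      1#                                   ∎

    -- Factors of index above M are 1, so `P M` and `Q M` serve as the infinite products.
    P-stable : ∀ {n} → M ℕ.≤ n → P n ≈ P M
    P-stable M≤n with ℕₚ.m≤n⇒∃[o]m+o≡n M≤n
    ... | (d , refl) = go d
      where
      go : ∀ d → P (M ℕ.+ d) ≈ P M
      go zero    rewrite ℕₚ.+-identityʳ M = ≈-refl
      go (suc d) rewrite ℕₚ.+-suc M d = begin
        P (suc (M ℕ.+ d))
          ≈⟨ ≈-sym (≈-trans (*-congʳ (1-0 (q-nil (s≤s (ℕₚ.m≤m+n M d))))) (*-identityˡ _)) ⟩
        (1# - q ^ suc (M ℕ.+ d)) * P (suc (M ℕ.+ d))
          ≈⟨ P-suc (M ℕ.+ d) ⟩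
        P (M ℕ.+ d)
          ≈⟨ go d ⟩
        P M ∎

    Q-stable : ∀ {n} → M ℕ.≤ n → Q n ≈ Q M
    Q-stable {n} M≤n = begin
      Q n             ≈⟨ ≈-sym (*-identityʳ (Q n)) ⟩
      Q n * 1#        ≈⟨ *-congˡ (≈-sym (Q*P M)) ⟩
      Q n * (Q M * P M) ≈⟨ *-congˡ (*-congˡ (≈-sym (P-stable M≤n))) ⟩
      Q n * (Q M * P n) ≈⟨ solve 3 (λ a b c → a :* (b :* c) := b :* (a :* c)) ≈-refl (Q n) (Q M) (P n) ⟩
      Q M * (Q n * P n) ≈⟨ *-congˡ (Q*P n) ⟩
      Q M * 1#          ≈⟨ *-identityʳ (Q M) ⟩
      Q M ∎

    -- P∸ L n is 1 / (q)_{L - n}, read as 0 when n > L.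
    P∸ : ℕ → ℕ → Series
    P∸ L       zero    = P L
    P∸ zero    (suc n) = 0#
    P∸ (suc L) (suc n) = P∸ L n

    P∸-< : ∀ {L n} → L ℕ.< n → P∸ L n ≈ 0#
    P∸-< {zero}  {suc n} _       = ≈-refl
    P∸-< {suc L} {suc n} (s≤s p) = P∸-< p

    P∸-≤ : ∀ L n → P∸ (L ℕ.+ n) n ≈ P L
    P∸-≤ L zero    rewrite ℕₚ.+-identityʳ L = ≈-refl
    P∸-≤ L (suc n) rewrite ℕₚ.+-suc L n = P∸-≤ L n

    -- For n ≥ L the truncated difference gives the factor 1 - q^0 = 0, in agreement with
    -- `P∸ L (suc n)`.
    P∸-suc : ∀ L n → (1# - q ^ (L ∸ n)) * P∸ L n ≈ P∸ L (suc n)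
    P∸-suc zero    zero    = solve 0 ((con 1ℤ :- con 1ℤ) :* con 1ℤ := con 0ℤ) ≈-refl
    P∸-suc (suc L) zero    = P-suc L
    P∸-suc zero    (suc n) = zeroʳ _
    P∸-suc (suc L) (suc n) = P∸-suc L n

    -- For n > L the exponents do not add up, but there `P∸ L n` is 0.
    q^∸ : ∀ L n → q ^ (L ∸ n) * (q ^ n * P∸ L n) ≈ q ^ L * P∸ L n
    q^∸ L n with ℕₚ.≤-<-connex n L
    ... | inj₁ n≤L = ≈-trans (≈-sym (*-assoc _ _ _))
                       (*-congʳ (≈-trans (≈-sym (q^+ (L ∸ n) n)) (q^≡ (ℕₚ.m∸n+n≡m n≤L))))
    ... | inj₂ L<n = ≈-trans (*-zero _ (*-zero _ (P∸-< L<n))) (≈-sym (*-zero _ (P∸-< L<n)))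

    -- The Gaussian binomial coefficient, 0 for k > n.
    bin : ℕ → ℕ → Series
    bin n k = Q n * (P k * P∸ n k)

    bin-zero : ∀ n → bin n 0 ≈ 1#
    bin-zero n = ≈-trans (*-congˡ (*-identityˡ (P n))) (Q*P n)

    bin-< : ∀ {n k} → n ℕ.< k → bin n k ≈ 0#
    bin-< n<k = *-zero _ (*-zero _ (P∸-< n<k))

    bin-self : ∀ n → bin n n ≈ 1#
    bin-self n = ≈-trans (*-congˡ (≈-trans (*-congˡ (P∸-≤ 0 n)) (*-identityʳ (P n)))) (Q*P n)

    -- Rests on 1 - q^(n+1) = (1 - q^(n-k)) + q^(n-k) (1 - q^(k+1)): each summand cancels one factor
    -- of a denominator.
    pascal : ∀ n k → bin (suc n) (suc k) ≈ bin n (suc k) + q ^ (n ∸ k) * bin n k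
    pascal n k = begin
      (1# - q ^ suc n) * Q n * (P (suc k) * P∸ n k)
        ≈⟨ solve 5 (λ x a b c z → (con 1ℤ :- x :* z) :* a :* (b :* c) := a :* (b :* c) :- a :* b :* (x :* (z :* c))) ≈-refl
             q (Q n) (P (suc k)) (P∸ n k) (q ^ n) ⟩
      Q n * (P (suc k) * P∸ n k) - Q n * P (suc k) * (q * (q ^ n * P∸ n k))
        ≈⟨ +-congˡ (-‿cong (*-congˡ (*-congˡ (≈-sym (q^∸ n k))))) ⟩
      Q n * (P (suc k) * P∸ n k) - Q n * P (suc k) * (q * (q ^ (n ∸ k) * (q ^ k * P∸ n k)))
        ≈⟨ solve 6 (λ x y a b c z → a :* (b :* c) :- a :* b :* (x :* (y :* (z :* c)))
                      := a :* (b :* ((con 1ℤ :- y) :* c)) :+ y :* (a :* (((con 1ℤ :- x :* z) :* b) :* c))) ≈-refl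
             q (q ^ (n ∸ k)) (Q n) (P (suc k)) (P∸ n k) (q ^ k) ⟩
      Q n * (P (suc k) * ((1# - q ^ (n ∸ k)) * P∸ n k)) + q ^ (n ∸ k) * (Q n * (((1# - q ^ suc k) * P (suc k)) * P∸ n k))
        ≈⟨ +-cong (*-congˡ (*-congˡ (P∸-suc n k))) (*-congˡ (*-congˡ (*-congʳ (P-suc k)))) ⟩
      Q n * (P (suc k) * P∸ n (suc k)) + q ^ (n ∸ k) * (Q n * (P k * P∸ n k)) ∎

    bin*Q : ∀ n k → bin n k * Q k ≈ Q n * P∸ n k
    bin*Q n k = ≈-trans (solve 4 (λ a b c d → (a :* (b :* c)) :* d := a :* ((d :* b) :* c)) ≈-refl (Q n) (P k) (P∸ n k) (Q k))
      (*-congˡ (≈-trans (*-congʳ (Q*P k)) (*-identityˡ _)))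

    P*bin : ∀ n k → P n * bin n k ≈ P k * P∸ n k
    P*bin n k = ≈-trans (solve 4 (λ a b c d → d :* (a :* (b :* c)) := (a :* d) :* (b :* c)) ≈-refl (Q n) (P k) (P∸ n k) (P n))
      (≈-trans (*-congʳ (Q*P n)) (*-identityˡ _))

    -- Durfee rectangle dissection of the partitions into at most L + c parts.
    durfee : ∀ L c → ∑ (suc L) (λ N → q ^ (N ℕ.* (N ℕ.+ c)) * (bin L N * P (N ℕ.+ c))) ≈ P (L ℕ.+ c)
    durfee zero    c = solve 1 (λ p → con 0ℤ :+ con 1ℤ :* (con 1ℤ :* (con 1ℤ :* con 1ℤ) :* p) := p) ≈-refl (P c)
    -- Pascal's rule splits the sum into the one for (L, c) and q^(L+c+1) times the one for (L, c +
    -- 1); hence the induction on L for all c at once.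
    durfee (suc L) c = begin
      ∑ (suc (suc L)) f
        ≈⟨ ∑-head (suc L) f ⟩
      f 0 + ∑ (suc L) (f ∘ suc)
        ≈⟨ +-cong (*-congˡ (*-congʳ (≈-trans (bin-zero (suc L)) (≈-sym (bin-zero L))))) (≈-trans (∑-cong (suc L) split) (∑-+ (suc L) (g ∘ suc) h)) ⟩
      g 0 + (∑ (suc L) (g ∘ suc) + ∑ (suc L) h)
        ≈⟨ ≈-sym (+-assoc _ _ _) ⟩
      (g 0 + ∑ (suc L) (g ∘ suc)) + ∑ (suc L) h
        ≈⟨ +-cong (≈-sym (∑-head (suc L) g)) (∑-*ˡ (suc L) _ _) ⟩
      (∑ (suc L) g + g (suc L)) + q ^ suc (L ℕ.+ c) * ∑ (suc L) (λ N → q ^ (N ℕ.* (N ℕ.+ suc c)) * (bin L N * P (N ℕ.+ suc c)))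
        ≈⟨ +-cong (+-cong (durfee L c) (*-zero _ (zero-* _ (bin-< {L} {suc L} ℕₚ.≤-refl)))) (*-congˡ (durfee L (suc c))) ⟩
      (P (L ℕ.+ c) + 0#) + q ^ suc (L ℕ.+ c) * P (L ℕ.+ suc c)
        ≈⟨ +-cong (+-congʳ (≈-sym (P-suc (L ℕ.+ c)))) (*-congˡ (reflexive (cong P (ℕₚ.+-suc L c)))) ⟩
      ((1# - q ^ suc (L ℕ.+ c)) * P (suc (L ℕ.+ c)) + 0#) + q ^ suc (L ℕ.+ c) * P (suc (L ℕ.+ c))
        ≈⟨ solve 2 (λ x p → ((con 1ℤ :- x) :* p :+ con 0ℤ) :+ x :* p := p) ≈-refl (q ^ suc (L ℕ.+ c)) (P (suc (L ℕ.+ c))) ⟩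
      P (suc (L ℕ.+ c)) ∎
      where
      f g h : ℕ → Series
      f N = q ^ (N ℕ.* (N ℕ.+ c)) * (bin (suc L) N * P (N ℕ.+ c))
      g N = q ^ (N ℕ.* (N ℕ.+ c)) * (bin L N * P (N ℕ.+ c))
      h N = q ^ suc (L ℕ.+ c) * (q ^ (N ℕ.* (N ℕ.+ suc c)) * (bin L N * P (N ℕ.+ suc c)))
      expo : ∀ N c → suc N ℕ.* (suc N ℕ.+ c) ≡ N ℕ.* (N ℕ.+ suc c) ℕ.+ (suc c ℕ.+ N)
      expo = ℕ-solve
      second : ∀ N → q ^ (suc N ℕ.* (suc N ℕ.+ c)) * ((q ^ (L ∸ N) * bin L N) * P (suc N ℕ.+ c)) ≈ h N
      second N = begin
        q ^ (suc N ℕ.* (suc N ℕ.+ c)) * ((q ^ (L ∸ N) * bin L N) * P (suc N ℕ.+ c))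
          ≈⟨ *-cong (≈-trans (q^≡ (expo N c)) (≈-trans (q^+ (N ℕ.* (N ℕ.+ suc c)) (suc c ℕ.+ N)) (*-congˡ (q^+ (suc c) N)))) (*-congˡ (reflexive (cong P (≡.sym (ℕₚ.+-suc N c))))) ⟩
        (E * (q ^ suc c * q ^ N)) * ((q ^ (L ∸ N) * bin L N) * P′)
          ≈⟨ solve 8 (λ e x y z a b d p → (e :* (x :* y)) :* ((z :* (a :* (b :* d))) :* p) := e :* (x :* (a :* (b :* (z :* (y :* d))) :* p)))
               ≈-refl E (q ^ suc c) (q ^ N) (q ^ (L ∸ N)) (Q L) (P N) (P∸ L N) P′ ⟩
        E * (q ^ suc c * (Q L * (P N * (q ^ (L ∸ N) * (q ^ N * P∸ L N))) * P′))
          ≈⟨ *-congˡ (*-congˡ (*-congʳ (*-congˡ (*-congˡ (q^∸ L N))))) ⟩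
        E * (q ^ suc c * (Q L * (P N * (q ^ L * P∸ L N)) * P′))
          ≈⟨ solve 7 (λ e x y a b d p → e :* (x :* (a :* (b :* (y :* d)) :* p)) := (y :* x) :* (e :* ((a :* (b :* d)) :* p)))
               ≈-refl E (q ^ suc c) (q ^ L) (Q L) (P N) (P∸ L N) P′ ⟩
        (q ^ L * q ^ suc c) * (E * (bin L N * P′))
          ≈⟨ *-congʳ (≈-trans (≈-sym (q^+ L (suc c))) (q^≡ (ℕₚ.+-suc L c))) ⟩
        h N ∎
        where
        E P′ : Series
        E  = q ^ (N ℕ.* (N ℕ.+ suc c))
        P′ = P (N ℕ.+ suc c)
      split : ∀ N → f (suc N) ≈ g (suc N) + h N
      split N = begin
        q ^ (suc N ℕ.* (suc N ℕ.+ c)) * (bin (suc L) (suc N) * P (suc N ℕ.+ c))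
          ≈⟨ *-congˡ (*-congʳ (pascal L N)) ⟩
        q ^ (suc N ℕ.* (suc N ℕ.+ c)) * ((bin L (suc N) + q ^ (L ∸ N) * bin L N) * P (suc N ℕ.+ c))
          ≈⟨ solve 4 (λ e a b p → e :* ((a :+ b) :* p) := e :* (a :* p) :+ e :* (b :* p)) ≈-refl
               (q ^ (suc N ℕ.* (suc N ℕ.+ c))) (bin L (suc N)) (q ^ (L ∸ N) * bin L N) (P (suc N ℕ.+ c)) ⟩
        g (suc N) + q ^ (suc N ℕ.* (suc N ℕ.+ c)) * ((q ^ (L ∸ N) * bin L N) * P (suc N ℕ.+ c))
          ≈⟨ +-congˡ (second N) ⟩
        g (suc N) + h N ∎

    -- The kernel 1 / ((q)_{L-m} (aq)_{L+m}) of a Bailey pair relative to a = q^c, up to the factor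
    -- (q)_c.
    v : ℕ → ℕ → ℕ → Series
    v c m L = P∸ L m * P (L ℕ.+ (m ℕ.+ c))

    v-< : ∀ c {m L} → L ℕ.< m → v c m L ≈ 0#
    v-< c L<m = zero-* _ (P∸-< L<m)

    -- The summation step of Bailey's lemma for a = q ^ c.
    bailey-step : ∀ m L c → ∑ (suc L) (λ N → q ^ (N ℕ.* (N ℕ.+ c)) * (P∸ L N * v c m N)) ≈ q ^ (m ℕ.* (m ℕ.+ c)) * v c m L
    bailey-step zero L c = begin
      ∑ (suc L) (λ N → q ^ (N ℕ.* (N ℕ.+ c)) * (P∸ L N * (P N * P (N ℕ.+ c))))
        ≈⟨ ∑-cong (suc L) (λ N → ≈-trans
             (solve 4 (λ e a b p → e :* (a :* (b :* p)) := (b :* a) :* (e :* p)) ≈-refl (q ^ (N ℕ.* (N ℕ.+ c))) (P∸ L N) (P N) (P (N ℕ.+ c)))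
             (≈-trans (*-congʳ (≈-sym (P*bin L N)))
             (solve 4 (λ e a b p → (a :* b) :* (e :* p) := a :* (e :* (b :* p))) ≈-refl (q ^ (N ℕ.* (N ℕ.+ c))) (P L) (bin L N) (P (N ℕ.+ c))))) ⟩
      ∑ (suc L) (λ N → P L * (q ^ (N ℕ.* (N ℕ.+ c)) * (bin L N * P (N ℕ.+ c))))
        ≈⟨ ∑-*ˡ (suc L) (P L) _ ⟩
      P L * ∑ (suc L) (λ N → q ^ (N ℕ.* (N ℕ.+ c)) * (bin L N * P (N ℕ.+ c)))
        ≈⟨ *-congˡ (durfee L c) ⟩
      P L * P (L ℕ.+ c)
        ≈⟨ ≈-sym (*-identityˡ _) ⟩
      1# * (P L * P (L ℕ.+ c)) ∎
    bailey-step (suc m) zero c =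
      solve 4 (λ a b x y → con 0ℤ :+ x :* (a :* (con 0ℤ :* b)) := y :* (con 0ℤ :* b)) ≈-refl _ _ _ _
    -- The summand N = 0 vanishes, and the shift of N by 1 turns (m + 1, L + 1, c) into (m, L, c +
    -- 2). The descent ends at m = 0 with `durfee`.
    bailey-step (suc m) (suc L) c = begin
      ∑ (suc (suc L)) f
        ≈⟨ ∑-head (suc L) f ⟩
      f 0 + ∑ (suc L) (f ∘ suc)
        ≈⟨ +-cong (*-zero _ (*-zero _ (zeroˡ _))) (∑-cong (suc L) shift) ⟩
      0# + ∑ (suc L) (λ N → q ^ suc c * (q ^ (N ℕ.* (N ℕ.+ suc (suc c))) * (P∸ L N * v (suc (suc c)) m N)))
        ≈⟨ ≈-trans (+-identityˡ _) (∑-*ˡ (suc L) _ _) ⟩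
      q ^ suc c * ∑ (suc L) (λ N → q ^ (N ℕ.* (N ℕ.+ suc (suc c))) * (P∸ L N * v (suc (suc c)) m N))
        ≈⟨ *-congˡ (bailey-step m L (suc (suc c))) ⟩
      q ^ suc c * (q ^ (m ℕ.* (m ℕ.+ suc (suc c))) * v (suc (suc c)) m L)
        ≈⟨ ≈-trans (≈-sym (*-assoc _ _ _)) (*-cong (≈-trans (≈-sym (q^+ (suc c) (m ℕ.* (m ℕ.+ suc (suc c))))) (q^≡ (≡.sym (expo m c)))) (≈-sym (v-shift L))) ⟩
      q ^ (suc m ℕ.* (suc m ℕ.+ c)) * v c (suc m) (suc L) ∎
      where
      f : ℕ → Series
      f N = q ^ (N ℕ.* (N ℕ.+ c)) * (P∸ (suc L) N * v c (suc m) N)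
      expo : ∀ N c → suc N ℕ.* (suc N ℕ.+ c) ≡ suc c ℕ.+ N ℕ.* (N ℕ.+ suc (suc c))
      expo = ℕ-solve
      idx : ∀ N m c → suc N ℕ.+ (suc m ℕ.+ c) ≡ N ℕ.+ (m ℕ.+ suc (suc c))
      idx = ℕ-solve
      v-shift : ∀ N → v c (suc m) (suc N) ≈ v (suc (suc c)) m N
      v-shift N = *-congˡ (reflexive (cong P (idx N m c)))
      shift : ∀ N → f (suc N) ≈ q ^ suc c * (q ^ (N ℕ.* (N ℕ.+ suc (suc c))) * (P∸ L N * v (suc (suc c)) m N))
      shift N = ≈-trans (*-cong (≈-trans (q^≡ (expo N c)) (q^+ (suc c) (N ℕ.* (N ℕ.+ suc (suc c))))) (*-congˡ (v-shift N))) (*-assoc _ _ _)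

    -- For n ≤ M the index M + M - n is still at least M, so both factors are stable. This is why M
    -- + M serves as the limiting length, here and in the triple product.
    v-limit : ∀ c n → n ℕ.≤ M → v c n (M ℕ.+ M) ≈ P M * P M
    v-limit c n n≤M = *-cong
      (≈-trans (reflexive (cong (λ k → P∸ k n) split)) (≈-trans (P∸-≤ (M ℕ.+ (M ∸ n)) n) (P-stable (ℕₚ.m≤m+n M _))))
      (P-stable (ℕₚ.≤-trans (ℕₚ.m≤m+n M M) (ℕₚ.m≤m+n (M ℕ.+ M) _)))
      where
      split : M ℕ.+ M ≡ M ℕ.+ (M ∸ n) ℕ.+ n
      split = ≡.trans (cong (M ℕ.+_) (≡.sym (ℕₚ.m∸n+n≡m n≤M))) (≡.sym (ℕₚ.+-assoc M (M ∸ n) n))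

-- Evaluation of the Durfee multisums

module Bailey (M : ℕ) (q : Series) (q-nil : Truncated.Nilpotent M q) where
  open Sums M
  open Base q q-nil
  open import Relation.Binary.Reasoning.Setoid setoid

  -- The n-th summand of the common alternating sum with r = i + p. The power q^(p n(n+1)) stands
  -- apart because p Bailey steps at a = q produce it.
  Θ : ℕ → ℕ → ℕ → Series
  Θ i p n = q ^ (p ℕ.* (n ℕ.* (n ℕ.+ 1))) * (sgn n * (q ^ (tri n ℕ.+ i ℕ.* (n ℕ.* n)) * (1# - q ^ (i ℕ.* suc (n ℕ.+ n)))))

  Θ-vanishes : ∀ i p {n} → M ℕ.< n → Θ i p n ≈ 0#
  Θ-vanishes i p {n} M<n = *-zero _ (*-zero _ (zero-* _ (q-nil
    (ℕₚ.≤-trans M<n (ℕₚ.≤-trans (n≤tri n) (ℕₚ.m≤m+n (tri n) _))))))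

  -- The unit Bailey pair at a = 1: the β-sequence that belongs to it is 1, 0, 0, ...
  α : ℕ → Series
  α zero    = 1#
  α (suc n) = sgn (suc n) * (q ^ tri n * (1# + q ^ suc n))

  -- A closed form for all partial sums, which permits induction on j. For j = L the right side
  -- contains `P∸ L (suc L)` = 0, so the full sum vanishes when L > 0; for L = 0 the factor 1 - q^L
  -- is itself 0.
  δ-partial : ∀ L j → (1# - q ^ L) * ∑ (suc j) (λ m → α m * v 0 m L) ≈ sgn j * (q ^ tri j * (P∸ L (suc j) * P (L ℕ.+ j)))
  δ-partial L zero = begin
    (1# - q ^ L) * (0# + 1# * (P L * P (L ℕ.+ 0)))
      ≈⟨ solve 3 (λ x a b → (con 1ℤ :- x) :* (con 0ℤ :+ con 1ℤ :* (a :* b)) := con 1ℤ :* (con 1ℤ :* (((con 1ℤ :- x) :* a) :* b))) ≈-refl (q ^ L) (P L) (P (L ℕ.+ 0)) ⟩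
    1# * (1# * (((1# - q ^ L) * P L) * P (L ℕ.+ 0)))
      ≈⟨ *-congˡ (*-congˡ (*-congʳ (P∸-suc L 0))) ⟩
    1# * (1# * (P∸ L 1 * P (L ℕ.+ 0))) ∎
  δ-partial L (suc j) = begin
    (1# - y) * (S + (- s) * (t * (1# + x)) * (A * P (L ℕ.+ (suc j ℕ.+ 0))))
      ≈⟨ distribˡ _ _ _ ⟩
    (1# - y) * S + (1# - y) * ((- s) * (t * (1# + x)) * (A * P (L ℕ.+ (suc j ℕ.+ 0))))
      ≈⟨ +-cong (δ-partial L j) (*-congˡ (*-congˡ (*-congˡ (reflexive (cong (λ k → P (L ℕ.+ k)) (ℕₚ.+-identityʳ (suc j))))))) ⟩
    s * (t * (A * P (L ℕ.+ j))) + (1# - y) * ((- s) * (t * (1# + x)) * (A * Z))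
      ≈⟨ +-congʳ (*-congˡ (*-congˡ (*-congˡ P-step))) ⟩
    s * (t * (A * ((1# - y * x) * Z))) + (1# - y) * ((- s) * (t * (1# + x)) * (A * Z))
      ≈⟨ solve 6 (λ s t y x A Z → s :* (t :* (A :* ((con 1ℤ :- y :* x) :* Z))) :+ (con 1ℤ :- y) :* ((:- s) :* (t :* (con 1ℤ :+ x)) :* (A :* Z))
            := (:- s) :* (t :* ((x :* A :- y :* A) :* Z))) ≈-refl s t y x A Z ⟩
    (- s) * (t * ((x * A - y * A) * Z))
      ≈⟨ *-congˡ (*-congˡ (*-congʳ (+-congˡ (-‿cong (≈-sym (q^∸ L (suc j))))))) ⟩
    (- s) * (t * ((x * A - q ^ (L ∸ suc j) * (x * A)) * Z))
      ≈⟨ solve 6 (λ s t d x A Z → (:- s) :* (t :* ((x :* A :- d :* (x :* A)) :* Z)) := (:- s) :* ((x :* t) :* (((con 1ℤ :- d) :* A) :* Z))) ≈-refl s t (q ^ (L ∸ suc j)) x A Z ⟩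
    (- s) * ((x * t) * (((1# - q ^ (L ∸ suc j)) * A) * Z))
      ≈⟨ *-congˡ (*-cong (≈-sym (q^+ (suc j) (tri j))) (*-congʳ (P∸-suc L (suc j)))) ⟩
    (- s) * (q ^ tri (suc j) * (P∸ L (suc (suc j)) * Z)) ∎
    where
    S s t x y A Z : Series
    S = ∑ (suc j) (λ m → α m * v 0 m L)
    s = sgn j
    t = q ^ tri j
    x = q ^ suc j
    y = q ^ L
    A = P∸ L (suc j)
    Z = P (L ℕ.+ suc j)
    P-step : P (L ℕ.+ j) ≈ (1# - y * x) * Z
    P-step = ≈-sym (begin
      (1# - y * x) * P (L ℕ.+ suc j)
        ≈⟨ *-cong (+-congˡ (-‿cong (≈-trans (≈-sym (q^+ L (suc j))) (q^≡ (ℕₚ.+-suc L j))))) (reflexive (cong P (ℕₚ.+-suc L j))) ⟩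
      (1# - q ^ suc (L ℕ.+ j)) * P (suc (L ℕ.+ j))
        ≈⟨ P-suc (L ℕ.+ j) ⟩
      P (L ℕ.+ j) ∎)

  -- The change from a = 1 to a = q. The monomial q^(tri j) occurs in `α j` with weight q^(i j^2)
  -- and in `α (suc j)` with weight q^(i (j+1)^2) and the opposite sign; the two combine to
  -- `Θ i 0 j`. The last term is the unpaired one and vanishes for j > b.
  transition : ∀ i b j →
    (1# - q ^ suc b) * ∑ (suc j) (λ m → (q ^ (i ℕ.* (m ℕ.* (m ℕ.+ 0))) * α m) * v 0 m (suc b)) ≈
    ∑ j (λ n → Θ i 0 n * v 1 n b) + sgn j * (q ^ (tri j ℕ.+ i ℕ.* (j ℕ.* j)) * v 1 j b)
  transition i b zero = begin
    (1# - q ^ suc b) * (0# + (q ^ (i ℕ.* 0) * 1#) * (P (suc b) * P (suc b ℕ.+ 0)))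
      ≈⟨ *-congˡ (+-congˡ (*-congˡ (*-congˡ (reflexive (cong P (≡.trans (ℕₚ.+-comm (suc b) 0) (≡.sym (ℕₚ.+-comm b 1)))))))) ⟩
    (1# - q ^ suc b) * (0# + (q ^ (i ℕ.* 0) * 1#) * (P (suc b) * P (b ℕ.+ 1)))
      ≈⟨ solve 4 (λ x w a b → (con 1ℤ :- x) :* (con 0ℤ :+ (w :* con 1ℤ) :* (a :* b)) := con 0ℤ :+ con 1ℤ :* (w :* (((con 1ℤ :- x) :* a) :* b))) ≈-refl
           (q ^ suc b) (q ^ (i ℕ.* 0)) (P (suc b)) (P (b ℕ.+ 1)) ⟩
    0# + 1# * (q ^ (i ℕ.* 0) * (((1# - q ^ suc b) * P (suc b)) * P (b ℕ.+ 1)))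
      ≈⟨ +-congˡ (*-congˡ (*-congˡ (*-congʳ (P-suc b)))) ⟩
    0# + 1# * (q ^ (i ℕ.* 0) * (P b * P (b ℕ.+ 1))) ∎
  transition i b (suc j) = begin
    (1# - q * y) * (S + (q ^ (i ℕ.* (suc j ℕ.* (suc j ℕ.+ 0))) * ((- s) * (t * (1# + q * x)))) * (A * P (suc b ℕ.+ (suc j ℕ.+ 0))))
      ≈⟨ distribˡ _ _ _ ⟩
    (1# - q * y) * S + (1# - q * y) * ((q ^ (i ℕ.* (suc j ℕ.* (suc j ℕ.+ 0))) * ((- s) * (t * (1# + q * x)))) * (A * P (suc b ℕ.+ (suc j ℕ.+ 0))))
      ≈⟨ +-cong (≈-trans (transition i b j) (+-congˡ (*-congˡ (*-cong (q^+ (tri j) _) (*-congˡ P-step)))))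
                (*-congˡ (*-cong (*-congʳ (≈-trans (q^≡ (expo i j)) (q^+ (i ℕ.* (j ℕ.* j)) (i ℕ.* suc (j ℕ.+ j)))))
                                 (*-congˡ (reflexive (cong P (idx b j)))))) ⟩
    (B + s * ((t * w) * (A * ((1# - q * (y * (q * x))) * Z)))) + (1# - q * y) * (((w * u) * ((- s) * (t * (1# + q * x)))) * (A * Z))
      -- The old boundary term is split by 1 = (1 - u) + u. The part with 1 - u is the summand n =
      -- j; the part with u and the new term of the sum form the next boundary term.
      ≈⟨ solve 10 (λ B s t w u q y x A Z →
            (B :+ s :* ((t :* w) :* (A :* ((con 1ℤ :- q :* (y :* (q :* x))) :* Z)))) :+ (con 1ℤ :- q :* y) :* (((w :* u) :* ((:- s) :* (t :* (con 1ℤ :+ q :* x)))) :* (A :* Z))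
         := (B :+ (con 1ℤ :* (s :* ((t :* w) :* (con 1ℤ :- u)))) :* (A :* ((con 1ℤ :- q :* (y :* (q :* x))) :* Z))) :+ (:- s) :* ((t :* w :* u :* q) :* ((x :* A :- y :* A) :* Z)))
           ≈-refl B s t w u q y x A Z ⟩
    (B + (1# * (s * ((t * w) * (1# - u)))) * (A * ((1# - q * (y * (q * x))) * Z))) + (- s) * ((t * w * u * q) * ((x * A - y * A) * Z))
      ≈⟨ +-cong (+-congˡ (*-cong (*-congˡ (*-congˡ (*-congʳ (≈-sym (q^+ (tri j) (i ℕ.* (j ℕ.* j))))))) (*-congˡ (≈-sym P-step)))) (*-congˡ (*-congˡ (*-congʳ (+-congˡ (-‿cong (≈-sym (q^∸ b j))))))) ⟩
    (B + Θ i 0 j * v 1 j b) + (- s) * ((t * w * u * q) * ((x * A - q ^ (b ∸ j) * (x * A)) * Z))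
      ≈⟨ +-congˡ (*-congˡ (solve 8 (λ t w u q x A d Z → (t :* w :* u :* q) :* ((x :* A :- d :* (x :* A)) :* Z) := (((q :* x) :* t) :* (w :* u)) :* (((con 1ℤ :- d) :* A) :* Z))
            ≈-refl t w u q x A (q ^ (b ∸ j)) Z)) ⟩
    (B + Θ i 0 j * v 1 j b) + (- s) * ((((q * x) * t) * (w * u)) * (((1# - q ^ (b ∸ j)) * A) * Z))
      ≈⟨ +-congˡ (*-congˡ (*-cong (≈-sym expo′) (*-cong (P∸-suc b j) (reflexive (cong P (idx′ b j)))))) ⟩
    (B + Θ i 0 j * v 1 j b) + (- s) * (q ^ (tri (suc j) ℕ.+ i ℕ.* (suc j ℕ.* suc j)) * (P∸ b (suc j) * P (b ℕ.+ (suc j ℕ.+ 1)))) ∎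
    where
    S B s t w u x y A Z : Series
    S = ∑ (suc j) (λ m → (q ^ (i ℕ.* (m ℕ.* (m ℕ.+ 0))) * α m) * v 0 m (suc b))
    B = ∑ j (λ n → Θ i 0 n * v 1 n b)
    s = sgn j
    t = q ^ tri j
    w = q ^ (i ℕ.* (j ℕ.* j))
    u = q ^ (i ℕ.* suc (j ℕ.+ j))
    x = q ^ j
    y = q ^ b
    A = P∸ b j
    Z = P (suc (b ℕ.+ suc j))
    expo : ∀ i j → i ℕ.* (suc j ℕ.* (suc j ℕ.+ 0)) ≡ i ℕ.* (j ℕ.* j) ℕ.+ i ℕ.* suc (j ℕ.+ j)
    expo = ℕ-solve
    idx : ∀ b j → suc b ℕ.+ (suc j ℕ.+ 0) ≡ suc (b ℕ.+ suc j)
    idx = ℕ-solve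
    idx′ : ∀ b j → suc (b ℕ.+ suc j) ≡ b ℕ.+ (suc j ℕ.+ 1)
    idx′ = ℕ-solve
    expo′ : q ^ (tri (suc j) ℕ.+ i ℕ.* (suc j ℕ.* suc j)) ≈ ((q * x) * t) * (w * u)
    expo′ = ≈-trans (q^+ (tri (suc j)) (i ℕ.* (suc j ℕ.* suc j)))
      (*-cong (q^+ (suc j) (tri j))
              (≈-trans (q^≡ (≡.trans (cong (λ k → i ℕ.* (suc j ℕ.* k)) (≡.sym (ℕₚ.+-identityʳ (suc j)))) (expo i j))) (q^+ (i ℕ.* (j ℕ.* j)) (i ℕ.* suc (j ℕ.+ j)))))
    P-step : P (b ℕ.+ (j ℕ.+ 1)) ≈ (1# - q * (y * (q * x))) * Z
    P-step = begin
      P (b ℕ.+ (j ℕ.+ 1))            ≈⟨ reflexive (cong (λ k → P (b ℕ.+ k)) (ℕₚ.+-comm j 1)) ⟩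
      P (b ℕ.+ suc j)                ≈⟨ ≈-sym (P-suc (b ℕ.+ suc j)) ⟩
      (1# - q * q ^ (b ℕ.+ suc j)) * Z ≈⟨ *-congʳ (+-congˡ (-‿cong (*-congˡ (q^+ b (suc j))))) ⟩
      (1# - q * (y * (q * x))) * Z   ∎

  -- One block of N parts between N + c and B + c, with g N counting what lies below it.
  D : ℕ → (ℕ → Series) → ℕ → Series
  D c g B = ∑ (suc B) (λ N → q ^ (N ℕ.* (N ℕ.+ c)) * (bin B N * g N))

  squares : ℕ → ℕ → Series
  squares zero    B = 1#
  squares (suc k) B = D 0 (squares k) B

  -- Below N parts of a square the remaining parts are at most N, below N parts of a rectangle at
  -- most N + 1. Hence `suc b` in the first clause, which is also the shift of length in
  -- `transition`.
  rectangles : ℕ → ℕ → ℕ → Series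
  rectangles k zero    b = squares k (suc b)
  rectangles k (suc p) b = D 1 (rectangles k p) b

  module _ (K : ℕ) where

    -- The β-sequence of the α-sequence `a`, up to the factor (q)_c. One fixed K beyond all lengths
    -- in use, in place of the natural bound B, lets sums be interchanged freely; the added terms
    -- vanish.
    expand : ℕ → (ℕ → Series) → ℕ → Series
    expand c a B = ∑ K (λ m → a m * v c m B)

    scale : ℕ → ℕ → (ℕ → Series) → ℕ → Series
    scale c k a m = q ^ (k ℕ.* (m ℕ.* (m ℕ.+ c))) * a m

    bailey : ∀ c a B → ∑ (suc B) (λ N → q ^ (N ℕ.* (N ℕ.+ c)) * (P∸ B N * expand c a N)) ≈ ∑ K (λ m → a m * (q ^ (m ℕ.* (m ℕ.+ c)) * v c m B))
    bailey c a B = begin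
      ∑ (suc B) (λ N → q ^ (N ℕ.* (N ℕ.+ c)) * (P∸ B N * expand c a N))
        ≈⟨ ∑-cong (suc B) (λ N → ≈-sym (≈-trans (∑-cong K (λ m → solve 4 (λ a e p v → a :* (e :* (p :* v)) := (e :* p) :* (a :* v)) ≈-refl
              (a m) (q ^ (N ℕ.* (N ℕ.+ c))) (P∸ B N) (v c m N))) (≈-trans (∑-*ˡ K (q ^ (N ℕ.* (N ℕ.+ c)) * P∸ B N) _) (*-assoc _ _ _)))) ⟩
      ∑ (suc B) (λ N → ∑ K (λ m → a m * (q ^ (N ℕ.* (N ℕ.+ c)) * (P∸ B N * v c m N))))
        ≈⟨ ∑-swap (suc B) K _ ⟩
      ∑ K (λ m → ∑ (suc B) (λ N → a m * (q ^ (N ℕ.* (N ℕ.+ c)) * (P∸ B N * v c m N))))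
        ≈⟨ ∑-cong K (λ m → ≈-trans (∑-*ˡ (suc B) (a m) _) (*-congˡ (bailey-step m B c))) ⟩
      ∑ K (λ m → a m * (q ^ (m ℕ.* (m ℕ.+ c)) * v c m B)) ∎

    -- Inserting a block is one Bailey step: `bin B N * Q N` equals `Q B * P∸ B N`, so the binomials
    -- of the multisum turn into the weights of Bailey's lemma.
    D-expand : ∀ c k a g B → (∀ N → N ℕ.≤ B → g N ≈ Q N * expand c (scale c k a) N) → D c g B ≈ Q B * expand c (scale c (suc k) a) B
    D-expand c k a g B hyp = begin
      ∑ (suc B) (λ N → q ^ (N ℕ.* (N ℕ.+ c)) * (bin B N * g N))
        ≈⟨ ∑-cong< (suc B) (λ N N<sB → ≈-trans (*-congˡ (≈-trans (*-congˡ (hyp N (ℕ.s≤s⁻¹ N<sB))) (≈-trans (≈-sym (*-assoc _ _ _)) (*-congʳ (bin*Q B N)))))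
             (solve 4 (λ e a b c → e :* ((a :* b) :* c) := a :* (e :* (b :* c))) ≈-refl (q ^ (N ℕ.* (N ℕ.+ c))) (Q B) (P∸ B N) (expand c (scale c k a) N))) ⟩
      ∑ (suc B) (λ N → Q B * (q ^ (N ℕ.* (N ℕ.+ c)) * (P∸ B N * expand c (scale c k a) N)))
        ≈⟨ ≈-trans (∑-*ˡ (suc B) (Q B) _) (*-congˡ (bailey c (scale c k a) B)) ⟩
      Q B * ∑ K (λ m → scale c k a m * (q ^ (m ℕ.* (m ℕ.+ c)) * v c m B))
        ≈⟨ *-congˡ (∑-cong K (λ m → ≈-trans (solve 4 (λ e a b c → (e :* a) :* (b :* c) := ((b :* e) :* a) :* c) ≈-refl (q ^ (k ℕ.* (m ℕ.* (m ℕ.+ c)))) (a m) (q ^ (m ℕ.* (m ℕ.+ c))) (v c m B))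
             (*-congʳ (*-congʳ (≈-sym (q^+ (m ℕ.* (m ℕ.+ c)) (k ℕ.* (m ℕ.* (m ℕ.+ c))))))))) ⟩
      Q B * expand c (scale c (suc k) a) B ∎

    δ-zero : 0 ℕ.< K → expand 0 α 0 ≈ 1#
    δ-zero 0<K = ≈-trans (∑-extend _ 0<K (λ n 0<n → *-zero _ (v-< 0 0<n)))
      (solve 0 (con 0ℤ :+ con 1ℤ :* (con 1ℤ :* con 1ℤ) := con 1ℤ) ≈-refl)

    δ-suc : ∀ N → suc N ℕ.< K → expand 0 α (suc N) ≈ 0#
    δ-suc N N<K = begin
      expand 0 α (suc N)
        ≈⟨ ∑-extend _ N<K (λ n N<n → *-zero _ (v-< 0 N<n)) ⟩
      S
        ≈⟨ ≈-sym (≈-trans (*-congʳ (geo-inverse N)) (*-identityˡ S)) ⟩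
      ((1# - q ^ suc N) * geo (suc N)) * S
        ≈⟨ solve 3 (λ a b c → (a :* b) :* c := b :* (a :* c)) ≈-refl (1# - q ^ suc N) (geo (suc N)) S ⟩
      geo (suc N) * ((1# - q ^ suc N) * S)
        ≈⟨ *-zero _ (≈-trans (δ-partial (suc N) (suc N)) (*-zero _ (*-zero _ (zero-* _ (P∸-< {suc N} ℕₚ.≤-refl))))) ⟩
      0# ∎
      where
      S : Series
      S = ∑ (suc (suc N)) (λ m → α m * v 0 m (suc N))

    squares-expand : ∀ k B → B ℕ.< K → squares k B ≈ Q B * expand 0 (scale 0 (suc k) α) B
    squares-expand zero B B<K = begin
      1#
        ≈⟨ ≈-sym (Q*P B) ⟩
      Q B * P B
        -- One Bailey step applied to the unit pair: only N = 0 contributes. The constant 1 thus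
        -- already costs one step, so k squares cost k + 1 = i of them.
        ≈⟨ *-congˡ (≈-sym (begin
             ∑ (suc B) (λ N → q ^ (N ℕ.* (N ℕ.+ 0)) * (P∸ B N * expand 0 α N))
               ≈⟨ ∑-head B _ ⟩
             1# * (P B * expand 0 α 0) + ∑ B (λ N → q ^ (suc N ℕ.* (suc N ℕ.+ 0)) * (P∸ B (suc N) * expand 0 α (suc N)))
               ≈⟨ +-cong (*-congˡ (*-congˡ (δ-zero (ℕₚ.≤-trans (s≤s z≤n) B<K))))
                         (∑-zero B (λ N N<B → *-zero _ (*-zero _ (δ-suc N (ℕₚ.≤-trans (s≤s N<B) B<K))))) ⟩
             1# * (P B * 1#) + 0#
               ≈⟨ solve 1 (λ p → con 1ℤ :* (p :* con 1ℤ) :+ con 0ℤ := p) ≈-refl (P B) ⟩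
             P B ∎)) ⟩
      Q B * ∑ (suc B) (λ N → q ^ (N ℕ.* (N ℕ.+ 0)) * (P∸ B N * expand 0 α N))
        ≈⟨ *-congˡ (≈-trans (bailey 0 α B) (∑-cong K (λ m → ≈-trans
             (solve 3 (λ a e v → a :* (e :* v) := (e :* a) :* v) ≈-refl (α m) (q ^ (m ℕ.* (m ℕ.+ 0))) (v 0 m B))
             (*-congʳ (*-congʳ (q^≡ (≡.sym (ℕₚ.*-identityˡ (m ℕ.* (m ℕ.+ 0)))))))))) ⟩
      Q B * expand 0 (scale 0 1 α) B ∎
    squares-expand (suc k) B B<K = D-expand 0 (suc k) α (squares k) B (λ N N≤B → squares-expand k N (ℕₚ.≤-trans (s≤s N≤B) B<K))

    rectangles-expand : ∀ k p b → suc b ℕ.< K → rectangles k p b ≈ Q b * expand 1 (scale 1 p (Θ (suc k) 0)) b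
    rectangles-expand k zero b b<K = begin
      squares k (suc b)
        ≈⟨ squares-expand k (suc b) b<K ⟩
      ((1# - q ^ suc b) * Q b) * expand 0 (scale 0 (suc k) α) (suc b)
        ≈⟨ solve 3 (λ a b c → (a :* b) :* c := b :* (a :* c)) ≈-refl (1# - q ^ suc b) (Q b) _ ⟩
      Q b * ((1# - q ^ suc b) * expand 0 (scale 0 (suc k) α) (suc b))
        ≈⟨ *-congˡ (begin
             (1# - q ^ suc b) * expand 0 (scale 0 (suc k) α) (suc b)
               ≈⟨ *-congˡ (≈-sym (≈-trans (+-congˡ (*-zero _ (v-< 0 b<K))) (+-identityʳ _))) ⟩
             (1# - q ^ suc b) * ∑ (suc K) (λ m → (q ^ (suc k ℕ.* (m ℕ.* (m ℕ.+ 0))) * α m) * v 0 m (suc b))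
               ≈⟨ transition (suc k) b K ⟩
             ∑ K (λ n → Θ (suc k) 0 n * v 1 n b) + sgn K * (q ^ (tri K ℕ.+ suc k ℕ.* (K ℕ.* K)) * v 1 K b)
               ≈⟨ ≈-trans (+-congˡ (*-zero _ (*-zero _ (v-< 1 (ℕₚ.≤-trans (ℕₚ.n≤1+n (suc b)) b<K))))) (+-identityʳ _) ⟩
             ∑ K (λ n → Θ (suc k) 0 n * v 1 n b)
               ≈⟨ ∑-cong K (λ n → *-congʳ (≈-sym (*-identityˡ _))) ⟩
             expand 1 (scale 1 0 (Θ (suc k) 0)) b ∎) ⟩
      Q b * expand 1 (scale 1 0 (Θ (suc k) 0)) b ∎
    rectangles-expand k (suc p) b b<K = D-expand 1 p (Θ (suc k) 0) (rectangles k p) b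
      (λ N N≤b → rectangles-expand k p N (ℕₚ.≤-trans (s≤s (s≤s N≤b)) b<K))

  rectangles-limit : ∀ k p → rectangles k p (M ℕ.+ M) ≈ P M * ∑ (suc M) (Θ (suc k) p)
  rectangles-limit k p = begin
    rectangles k p b
      ≈⟨ rectangles-expand (suc (suc b)) k p b ℕₚ.≤-refl ⟩
    Q b * ∑ (suc (suc b)) (λ n → scale (suc (suc b)) 1 p (Θ (suc k) 0) n * v 1 n b)
      ≈⟨ *-cong (Q-stable (ℕₚ.m≤m+n M M)) (∑-extend _ (s≤s (ℕₚ.≤-trans (ℕₚ.m≤m+n M M) (ℕₚ.n≤1+n b))) (λ n M<n → zero-* _ (*-zero _ (Θ-vanishes (suc k) 0 M<n)))) ⟩
    Q M * ∑ (suc M) (λ n → scale (suc (suc b)) 1 p (Θ (suc k) 0) n * v 1 n b)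
      ≈⟨ *-congˡ (≈-trans (∑-cong< (suc M) term) (∑-*ˡ (suc M) (P M * P M) (Θ (suc k) p))) ⟩
    Q M * ((P M * P M) * ∑ (suc M) (Θ (suc k) p))
      ≈⟨ solve 3 (λ q p s → q :* ((p :* p) :* s) := (q :* p) :* (p :* s)) ≈-refl (Q M) (P M) _ ⟩
    (Q M * P M) * (P M * ∑ (suc M) (Θ (suc k) p))
      ≈⟨ ≈-trans (*-congʳ (Q*P M)) (*-identityˡ _) ⟩
    P M * ∑ (suc M) (Θ (suc k) p) ∎
    where
    b : ℕ
    b = M ℕ.+ M
    term : ∀ n → n ℕ.< suc M → scale (suc (suc b)) 1 p (Θ (suc k) 0) n * v 1 n b ≈ (P M * P M) * Θ (suc k) p n
    term n (s≤s n≤M) = ≈-trans (*-cong (*-congˡ (*-identityˡ _)) (v-limit 1 n n≤M)) (*-comm _ _)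

-- The alternating sum of Selberg and Andrews

module Gordon (M : ℕ) (q : Series) (q-nil : Truncated.Nilpotent M q) where
  open Sums M
  open Base q q-nil
  open Bailey M q q-nil
  open import Relation.Binary.Reasoning.Setoid setoid

  -- The summands of Andrews' series J_{r,i}(x) at x = q^N with r = i + p, multiplied by (q)_∞: the
  -- denominator, the product of all 1 - q^j with j > N + n, then becomes the numerator (q)_{N+n}.
  σ : ℕ → ℕ → ℕ → ℕ → Series
  σ i p N n = sgn n * (q ^ ((i ℕ.+ p) ℕ.* (n ℕ.* (N ℕ.+ n)) ℕ.+ (p ℕ.* n ℕ.+ tri n)) * ((1# - q ^ (i ℕ.* (N ℕ.+ suc (n ℕ.+ n)))) * (Q (N ℕ.+ n) * P n)))

  S : ℕ → ℕ → ℕ → Series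
  S i p N = ∑ (suc M) (σ i p N)

  S-zero : ∀ p N → S 0 p N ≈ 0#
  S-zero p N = ∑-zero (suc M) (λ n _ → *-zero _ (*-zero _ (zero-* _ (solve 0 (con 1ℤ :- con 1ℤ := con 0ℤ) ≈-refl))))

  module _ (i p N : ℕ) where
    private
      r : ℕ
      r = suc i ℕ.+ p

      x₁ x₂ : ℕ → Series
      x₁ n = sgn n * (q ^ (r ℕ.* (n ℕ.* (N ℕ.+ n)) ℕ.+ (p ℕ.* n ℕ.+ tri n)) * ((1# - q ^ n) * (Q (N ℕ.+ n) * P n)))
      x₂ n = sgn n * (q ^ (suc N ℕ.* i ℕ.+ ((suc p ℕ.+ i) ℕ.* (n ℕ.* (suc N ℕ.+ n)) ℕ.+ (i ℕ.* n ℕ.+ tri n))) * (Q (suc N ℕ.+ n) * P n))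

      split : ∀ n → σ (suc i) p N n ≈ σ i (suc p) N n + (x₁ n + x₂ n)
      split n = begin
        s * (q ^ (r ℕ.* (n ℕ.* (N ℕ.+ n)) ℕ.+ (p ℕ.* n ℕ.+ tri n)) * ((1# - q ^ (suc i ℕ.* (N ℕ.+ suc (n ℕ.+ n)))) * (A * P n)))
          ≈⟨ *-congˡ (*-congˡ (*-congʳ (+-congˡ (-‿cong (≈-trans (q^+ (N ℕ.+ suc (n ℕ.+ n)) _) (*-congʳ (≈-trans (q^≡ (expo₁ N n)) (q^+ (suc (N ℕ.+ n)) n)))))))) ⟩
        s * (e * ((1# - (h * x) * g) * (A * P n)))
          -- The identity 1 - hxg = x (1 - g) + (1 - x) + xg (1 - h). The first factor x = q^n
          -- raises p by 1, the second term loses its summand at n = 0, and 1 - h extends (q)_{N+n}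
          -- to (q)_{N+n+1}.
          ≈⟨ solve 7 (λ s e h x g A P → s :* (e :* ((con 1ℤ :- (h :* x) :* g) :* (A :* P)))
               := s :* ((e :* x) :* ((con 1ℤ :- g) :* (A :* P))) :+ (s :* (e :* ((con 1ℤ :- x) :* (A :* P))) :+ s :* ((e :* (x :* g)) :* (((con 1ℤ :- h) :* A) :* P))))
               ≈-refl s e h x g A (P n) ⟩
        s * ((e * x) * ((1# - g) * (A * P n))) + (x₁ n + s * ((e * (x * g)) * (Q (suc N ℕ.+ n) * P n)))
          ≈⟨ +-cong (*-congˡ (*-congʳ (≈-trans (≈-sym (q^+ e₀ n)) (q^≡ (expo₂ i p n (N ℕ.+ n) (tri n))))))
                    (+-congˡ (*-congˡ (*-congʳ (≈-trans (*-congˡ (≈-sym (q^+ n _))) (≈-trans (≈-sym (q^+ e₀ (n ℕ.+ i ℕ.* (N ℕ.+ suc (n ℕ.+ n))))) (q^≡ (expo₃ i p n N (tri n)))))))) ⟩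
        σ i (suc p) N n + (x₁ n + x₂ n) ∎
        where
        e₀ : ℕ
        e₀ = r ℕ.* (n ℕ.* (N ℕ.+ n)) ℕ.+ (p ℕ.* n ℕ.+ tri n)
        s A e g h x : Series
        s = sgn n
        A = Q (N ℕ.+ n)
        e = q ^ e₀
        g = q ^ (i ℕ.* (N ℕ.+ suc (n ℕ.+ n)))
        h = q ^ suc (N ℕ.+ n)
        x = q ^ n
        expo₁ : ∀ N n → N ℕ.+ suc (n ℕ.+ n) ≡ suc (N ℕ.+ n) ℕ.+ n
        expo₁ = ℕ-solve
        expo₂ : ∀ i p n N t → (suc i ℕ.+ p) ℕ.* (n ℕ.* N) ℕ.+ (p ℕ.* n ℕ.+ t) ℕ.+ n ≡ (i ℕ.+ suc p) ℕ.* (n ℕ.* N) ℕ.+ (suc p ℕ.* n ℕ.+ t)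
        expo₂ = ℕ-solve
        expo₃ : ∀ i p n N t → (suc i ℕ.+ p) ℕ.* (n ℕ.* (N ℕ.+ n)) ℕ.+ (p ℕ.* n ℕ.+ t) ℕ.+ (n ℕ.+ i ℕ.* (N ℕ.+ suc (n ℕ.+ n)))
              ≡ suc N ℕ.* i ℕ.+ ((suc p ℕ.+ i) ℕ.* (n ℕ.* (suc N ℕ.+ n)) ℕ.+ (i ℕ.* n ℕ.+ t))
        expo₃ = ℕ-solve

      -- After 1 - q^(n+1) cancels against 1 / (q)_{n+1}, both terms contain (q)_{N+n+1} / (q)_n.
      -- They have opposite signs, and the quotient of their powers is the q^b of the factor 1 -
      -- q^b.
      merge : ∀ n → x₁ (suc n) + x₂ n ≈ q ^ (suc N ℕ.* i) * σ (suc p) i (suc N) n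
      merge n = begin
        (- s) * (q ^ (r ℕ.* (suc n ℕ.* (N ℕ.+ suc n)) ℕ.+ (p ℕ.* suc n ℕ.+ tri (suc n))) * ((1# - q ^ suc n) * (Q (N ℕ.+ suc n) * P (suc n)))) + x₂ n
          ≈⟨ +-cong (*-congˡ (*-cong (≈-trans (q^≡ (expo i p n N (tri n))) (≈-trans (q^+ (suc N ℕ.* i) _) (*-congˡ (q^+ a b))))
                (≈-trans (solve 3 (λ x y z → x :* (y :* z) := y :* (x :* z)) ≈-refl (1# - q ^ suc n) (Q (N ℕ.+ suc n)) (P (suc n)))
                   (*-cong (reflexive (cong Q (ℕₚ.+-suc N n))) (P-suc n)))))
                (*-congˡ (*-congʳ (q^+ (suc N ℕ.* i) a))) ⟩
        (- s) * ((E * (q ^ a * q ^ b)) * A) + s * ((E * q ^ a) * A)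
          ≈⟨ solve 5 (λ s E x y A → (:- s) :* ((E :* (x :* y)) :* A) :+ s :* ((E :* x) :* A) := E :* (s :* (x :* ((con 1ℤ :- y) :* A)))) ≈-refl s E (q ^ a) (q ^ b) A ⟩
        E * (s * (q ^ a * ((1# - q ^ b) * A))) ∎
        where
        a b : ℕ
        a = (suc p ℕ.+ i) ℕ.* (n ℕ.* (suc N ℕ.+ n)) ℕ.+ (i ℕ.* n ℕ.+ tri n)
        b = suc p ℕ.* (suc N ℕ.+ suc (n ℕ.+ n))
        s A E : Series
        s = sgn n
        A = Q (suc N ℕ.+ n) * P n
        E = q ^ (suc N ℕ.* i)
        expo : ∀ i p n N t → (suc i ℕ.+ p) ℕ.* (suc n ℕ.* (N ℕ.+ suc n)) ℕ.+ (p ℕ.* suc n ℕ.+ (suc n ℕ.+ t))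
             ≡ suc N ℕ.* i ℕ.+ (((suc p ℕ.+ i) ℕ.* (n ℕ.* (suc N ℕ.+ n)) ℕ.+ (i ℕ.* n ℕ.+ t)) ℕ.+ suc p ℕ.* (suc N ℕ.+ suc (n ℕ.+ n)))
        expo = ℕ-solve

      -- The summand at 0 has the factor 1 - q^0, and the one at M + 1 lies beyond degree M.
      x₁-shift : ∑ (suc M) x₁ ≈ ∑ (suc M) (x₁ ∘ suc)
      x₁-shift = begin
        ∑ (suc M) x₁                  ≈⟨ ≈-sym (≈-trans (+-congˡ (*-zero _ (zero-* _ (q-nil large)))) (+-identityʳ _)) ⟩
        ∑ (suc (suc M)) x₁            ≈⟨ ∑-head (suc M) x₁ ⟩
        x₁ 0 + ∑ (suc M) (x₁ ∘ suc)   ≈⟨ +-congʳ (*-zero _ (*-zero _ (zero-* _ (solve 0 (con 1ℤ :- con 1ℤ := con 0ℤ) ≈-refl)))) ⟩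
        0# + ∑ (suc M) (x₁ ∘ suc)     ≈⟨ +-identityˡ _ ⟩
        ∑ (suc M) (x₁ ∘ suc)          ∎
        where
        large : M ℕ.< r ℕ.* (suc M ℕ.* (N ℕ.+ suc M)) ℕ.+ (p ℕ.* suc M ℕ.+ tri (suc M))
        large = ℕₚ.≤-trans (n≤tri (suc M)) (ℕₚ.≤-trans (ℕₚ.m≤n+m _ (p ℕ.* suc M)) (ℕₚ.m≤n+m _ (r ℕ.* (suc M ℕ.* (N ℕ.+ suc M)))))

    S-step : S (suc i) p N ≈ S i (suc p) N + q ^ (suc N ℕ.* i) * S (suc p) i (suc N)
    S-step = begin
      ∑ (suc M) (σ (suc i) p N)
        ≈⟨ ≈-trans (∑-cong (suc M) split) (≈-trans (∑-+ (suc M) (σ i (suc p) N) _) (+-congˡ (∑-+ (suc M) x₁ x₂))) ⟩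
      S i (suc p) N + (∑ (suc M) x₁ + ∑ (suc M) x₂)
        ≈⟨ +-congˡ (≈-trans (+-congʳ x₁-shift) (≈-sym (∑-+ (suc M) (x₁ ∘ suc) x₂))) ⟩
      S i (suc p) N + ∑ (suc M) (λ n → x₁ (suc n) + x₂ n)
        ≈⟨ +-congˡ (≈-trans (∑-cong (suc M) merge) (∑-*ˡ (suc M) _ _)) ⟩
      S i (suc p) N + q ^ (suc N ℕ.* i) * S (suc p) i (suc N) ∎

  -- For n > 0 every exponent exceeds M. Divided by (q)_M the value is 1, for the empty partition:
  -- no other one with parts > M has degree at most M.
  S-limit : ∀ i p → S (suc i) p M ≈ Q M
  S-limit i p = begin
    ∑ (suc M) (σ (suc i) p M)
      ≈⟨ ∑-extend (σ (suc i) p M) (s≤s z≤n) (λ n 0<n → *-zero _ (zero-* _ (q-nil (large n 0<n)))) ⟩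
    0# + σ (suc i) p M 0
      ≈⟨ +-congˡ (*-congˡ (*-cong (q^≡ (expo i p M)) (*-cong (1-0 (q-nil (ℕₚ.≤-trans (ℕₚ.≤-reflexive (ℕₚ.+-comm 1 M)) (ℕₚ.m≤m+n (M ℕ.+ 1) _)))) (*-congʳ (reflexive (cong Q (ℕₚ.+-identityʳ M))))))) ⟩
    0# + 1# * (1# * (1# * (Q M * 1#)))
      ≈⟨ solve 1 (λ x → con 0ℤ :+ con 1ℤ :* (con 1ℤ :* (con 1ℤ :* (x :* con 1ℤ))) := x) ≈-refl (Q M) ⟩
    Q M ∎
    where
    expo : ∀ i p M → (suc i ℕ.+ p) ℕ.* (0 ℕ.* (M ℕ.+ 0)) ℕ.+ (p ℕ.* 0 ℕ.+ 0) ≡ 0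
    expo = ℕ-solve
    large : ∀ n → 0 ℕ.< n → M ℕ.< (suc i ℕ.+ p) ℕ.* (n ℕ.* (M ℕ.+ n)) ℕ.+ (p ℕ.* n ℕ.+ tri n)
    large (suc n) _ = ℕₚ.≤-trans (ℕₚ.≤-trans (ℕₚ.≤-reflexive (ℕₚ.+-comm 1 M)) (ℕₚ.+-monoʳ-≤ M (s≤s z≤n)))
      (ℕₚ.≤-trans (ℕₚ.m≤m+n (M ℕ.+ suc n) (n ℕ.* (M ℕ.+ suc n))) (ℕₚ.≤-trans (ℕₚ.m≤m+n _ ((i ℕ.+ p) ℕ.* (suc n ℕ.* (M ℕ.+ suc n)))) (ℕₚ.m≤m+n _ _)))

  S-theta : ∀ i p → S i p 0 ≈ ∑ (suc M) (Θ i p)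
  S-theta i p = ∑-cong (suc M) (λ n → begin
    sgn n * (q ^ ((i ℕ.+ p) ℕ.* (n ℕ.* n) ℕ.+ (p ℕ.* n ℕ.+ tri n)) * ((1# - q ^ (i ℕ.* suc (n ℕ.+ n))) * (Q n * P n)))
      ≈⟨ *-congˡ (*-cong (≈-trans (q^≡ (expo i p n (tri n))) (q^+ (p ℕ.* (n ℕ.* (n ℕ.+ 1))) _)) (≈-trans (*-congˡ (Q*P n)) (*-identityʳ _))) ⟩
    sgn n * ((q ^ (p ℕ.* (n ℕ.* (n ℕ.+ 1))) * q ^ (tri n ℕ.+ i ℕ.* (n ℕ.* n))) * (1# - q ^ (i ℕ.* suc (n ℕ.+ n))))
      ≈⟨ solve 4 (λ a b c d → a :* ((b :* c) :* d) := b :* (a :* (c :* d))) ≈-refl (sgn n) (q ^ (p ℕ.* (n ℕ.* (n ℕ.+ 1)))) (q ^ (tri n ℕ.+ i ℕ.* (n ℕ.* n))) _ ⟩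
    Θ i p n ∎)
    where
    expo : ∀ i p n t → (i ℕ.+ p) ℕ.* (n ℕ.* n) ℕ.+ (p ℕ.* n ℕ.+ t) ≡ p ℕ.* (n ℕ.* (n ℕ.+ 1)) ℕ.+ (t ℕ.+ i ℕ.* (n ℕ.* n))
    expo = ℕ-solve

-- The Jacobi triple product

module TripleProduct (M : ℕ) (z y : Series)
  (w-nil : Truncated.Nilpotent M (z ⊛ y))
  (y-nil : Truncated.Nilpotent M y) where
  open Sums M
  open import Algebra.Properties.CommutativeSemiring.Exp commutativeSemiring using (^-distrib-*)
  open import Relation.Binary.Reasoning.Setoid setoid

  w : Series
  w = z * y

  open Base w w-nil

  -- The terms k = n and k = -n - 1 of the bilateral sum of (-1)^k y^(k(k+1)/2) z^(k(k-1)/2). Two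
  -- variables z and y, with w = z y as base, avoid negative exponents.
  θ : ℕ → Series
  θ n = sgn n * (y ^ tri n * (z ^ tri₋ n - z ^ tri (suc n)))

  θ-vanishes : ∀ {n} → M ℕ.< n → θ n ≈ 0#
  θ-vanishes {n} M<n = *-zero _ (zero-* _ (y-nil (ℕₚ.≤-trans M<n (n≤tri n))))

  θ-zero : θ 0 ≈ 1# - z
  θ-zero = solve 1 (λ z → con 1ℤ :* (con 1ℤ :* (con 1ℤ :- z :* con 1ℤ)) := con 1ℤ :- z) ≈-refl z

  -- The case k = -1 of `θ-rec`, where the reflection k to -k - 1 gives θ (-1) = θ 0.
  θ-rec₀ : (z * w + y) * θ 0 + (θ 1 + w * θ 0) ≈ 0#
  θ-rec₀ = solve 2 (λ z y → let w = z :* y ; a = con 1ℤ :* (con 1ℤ :* (con 1ℤ :- z :* con 1ℤ)) in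
      (z :* w :+ y) :* a :+ ((:- con 1ℤ) :* ((y :* con 1ℤ) :* (con 1ℤ :- z :* (z :* (z :* con 1ℤ)))) :+ w :* a) := con 0ℤ) ≈-refl z y

  -- Holds for each of the two monomials of θ separately. It is the relation that annihilates the
  -- remainder in `telescope`.
  θ-rec : ∀ k → w ^ suc k * ((z * w + y) * θ (suc k)) + (θ (suc (suc k)) + w ^ (suc k ℕ.+ suc (suc k)) * θ k) ≈ 0#
  θ-rec k = begin
    w ^ suc k * ((z * w + y) * θ (suc k)) + (θ (suc (suc k)) + w ^ (suc k ℕ.+ suc (suc k)) * θ k)
      ≈⟨ +-cong (*-cong w₁ (*-congˡ (*-congˡ (*-cong y₁ (+-cong z₀ (-‿cong z₂))))))
           (+-cong (*-congˡ (*-cong y₂ (+-cong z₁ (-‿cong z₃))))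
              (*-cong (≈-trans (q^+ (suc k) (suc (suc k))) (*-cong w₁ (*-congˡ w₁))) (*-congˡ (*-congˡ (+-congˡ (-‿cong z₁)))))) ⟩
    (w * (ζ * η)) * ((z * w + y) * ((- s) * (((y * η) * Y) * (ζ * Z - (z * (z * ζ)) * ((z * ζ) * (ζ * Z))))))
      + ((- (- s)) * (((y * (y * η)) * ((y * η) * Y)) * ((z * ζ) * (ζ * Z) - (z * (z * (z * ζ))) * ((z * (z * ζ)) * ((z * ζ) * (ζ * Z)))))
         + ((w * (ζ * η)) * (w * (w * (ζ * η)))) * (s * (Y * (Z - (z * ζ) * (ζ * Z)))))
      ≈⟨ solve 7 (λ z y ζ η s Y Z → let w = z :* y in
           (w :* (ζ :* η)) :* ((z :* w :+ y) :* ((:- s) :* (((y :* η) :* Y) :* (ζ :* Z :- (z :* (z :* ζ)) :* ((z :* ζ) :* (ζ :* Z))))))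
            :+ ((:- (:- s)) :* (((y :* (y :* η)) :* ((y :* η) :* Y)) :* ((z :* ζ) :* (ζ :* Z) :- (z :* (z :* (z :* ζ))) :* ((z :* (z :* ζ)) :* ((z :* ζ) :* (ζ :* Z)))))
            :+ ((w :* (ζ :* η)) :* (w :* (w :* (ζ :* η)))) :* (s :* (Y :* (Z :- (z :* ζ) :* (ζ :* Z))))) := con 0ℤ)
           ≈-refl z y ζ η s Y Z ⟩
    0# ∎
    where
    s Y Z ζ η : Series
    s = sgn k
    Y = y ^ tri k
    Z = z ^ tri₋ k
    ζ = z ^ k
    η = y ^ k
    w₁ : w ^ suc k ≈ w * (ζ * η)
    w₁ = *-congˡ (^-distrib-* z y k)
    z₀ : z ^ tri k ≈ ζ * Z
    z₀ = ≈-trans (^-congʳ z (tri-tri₋ k)) (^-homo-* z k (tri₋ k))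
    z₁ : z ^ tri (suc k) ≈ (z * ζ) * (ζ * Z)
    z₁ = ≈-trans (^-homo-* z (suc k) (tri k)) (*-congˡ z₀)
    z₂ : z ^ tri (suc (suc k)) ≈ (z * (z * ζ)) * ((z * ζ) * (ζ * Z))
    z₂ = ≈-trans (^-homo-* z (suc (suc k)) (tri (suc k))) (*-congˡ z₁)
    z₃ : z ^ tri (suc (suc (suc k))) ≈ (z * (z * (z * ζ))) * ((z * (z * ζ)) * ((z * ζ) * (ζ * Z)))
    z₃ = ≈-trans (^-homo-* z (suc (suc (suc k))) (tri (suc (suc k)))) (*-congˡ z₂)
    y₁ : y ^ tri (suc k) ≈ (y * η) * Y
    y₁ = ^-homo-* y (suc k) (tri k)
    y₂ : y ^ tri (suc (suc k)) ≈ (y * (y * η)) * ((y * η) * Y)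
    y₂ = ≈-trans (^-homo-* y (suc (suc k)) (tri (suc k))) (*-congˡ y₁)

  -- Times `Q (suc (L + L))`, `U n L` is the Gaussian binomial of 2L + 1 over L - n in base w.
  U : ℕ → ℕ → Series
  U = v 1

  w^-pred : ∀ L k → w * (w ^ (L ∸ suc k) * P∸ L (suc k)) ≈ w ^ (L ∸ k) * P∸ L (suc k)
  w^-pred L k with ℕₚ.≤-<-connex (suc k) L
  ... | inj₁ k<L = ≈-trans (≈-sym (*-assoc _ _ _)) (*-congʳ (q^≡ (≡.sym (ℕₚ.+-∸-assoc 1 k<L))))
  ... | inj₂ L≤k = ≈-trans (*-zero _ (*-zero _ (P∸-< L≤k))) (≈-sym (*-zero _ (P∸-< L≤k)))

  module _ (L : ℕ) where
    private
      ω W : Series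
      ω = w ^ L
      W = w ^ suc (suc (L ℕ.+ L))

      W-split : W ≈ w * (w * (ω * ω))
      W-split = *-congˡ (*-congˡ (q^+ L L))

    -- The case k = -1 of `U-rec`: by the symmetry of the binomials U (-1) is U 0.
    U-rec₀ : (1# - W) * ((1# - w * W) * U 0 (suc L)) ≈ (1# + W) * U 0 L + ((w * ω) * U 0 L + (w * (w * ω)) * U 1 L)
    U-rec₀ = begin
      (1# - W) * ((1# - w * W) * (B * P (suc L ℕ.+ 1)))
        ≈⟨ *-cong (+-congˡ (-‿cong W-split)) (*-cong (+-congˡ (-‿cong (*-congˡ W-split))) (*-congˡ (reflexive (cong (P ∘ suc) (ℕₚ.+-comm L 1))))) ⟩
      (1# - w * (w * (ω * ω))) * ((1# - w * (w * (w * (ω * ω)))) * (B * Z))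
        ≈⟨ solve 4 (λ w ω B Z → (con 1ℤ :- w :* (w :* (ω :* ω))) :* ((con 1ℤ :- w :* (w :* (w :* (ω :* ω)))) :* (B :* Z))
             := (con 1ℤ :+ w :* (w :* (ω :* ω))) :* (((con 1ℤ :- w :* ω) :* B) :* ((con 1ℤ :- w :* (w :* ω)) :* Z))
                :+ ((w :* ω) :* (((con 1ℤ :- w :* ω) :* B) :* ((con 1ℤ :- w :* (w :* ω)) :* Z)) :+ (w :* (w :* ω)) :* (((con 1ℤ :- ω) :* ((con 1ℤ :- w :* ω) :* B)) :* Z)))
             ≈-refl w ω B Z ⟩
      (1# + w * (w * (ω * ω))) * (((1# - w * ω) * B) * ((1# - w * (w * ω)) * Z))
        + ((w * ω) * (((1# - w * ω) * B) * ((1# - w * (w * ω)) * Z)) + (w * (w * ω)) * (((1# - ω) * ((1# - w * ω) * B)) * Z))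
        ≈⟨ +-cong (*-cong (+-congˡ (≈-sym W-split)) U₀) (+-cong (*-congˡ U₀) (*-congˡ U₁)) ⟩
      (1# + W) * U 0 L + ((w * ω) * U 0 L + (w * (w * ω)) * U 1 L) ∎
      where
      B Z : Series
      B = P (suc L)
      Z = P (suc (suc L))
      U₀ : ((1# - w * ω) * B) * ((1# - w * (w * ω)) * Z) ≈ U 0 L
      U₀ = *-cong (P-suc L) (≈-trans (P-suc (suc L)) (reflexive (cong P (ℕₚ.+-comm 1 L))))
      U₁ : ((1# - ω) * ((1# - w * ω) * B)) * Z ≈ U 1 L
      U₁ = *-cong (≈-trans (*-congˡ (P-suc L)) (P∸-suc L 0)) (reflexive (cong P (ℕₚ.+-comm 2 L)))

    -- Pascal's rule applied twice, from the binomials over 2L + 1 to those over 2L + 3; (1 - W)(1 -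
    -- w W) is the quotient of the two q-factorials.
    U-rec : ∀ k → (1# - W) * ((1# - w * W) * U (suc k) (suc L)) ≈
      (1# + W) * U (suc k) L + (w ^ (L ∸ k) * U k L + w ^ suc (suc (L ℕ.+ suc k)) * U (suc (suc k)) L)
    U-rec k with ℕₚ.≤-<-connex k L
    ... | inj₂ L<k = ≈-trans (*-zero _ (*-zero _ (v-< 1 (s≤s L<k)))) (≈-sym (≈-trans
            (+-cong (*-zero _ (v-< 1 (ℕₚ.m≤n⇒m≤1+n L<k))) (≈-trans (+-cong (*-zero _ (v-< 1 L<k)) (*-zero _ (v-< 1 (ℕₚ.m≤n⇒m≤1+n (ℕₚ.m≤n⇒m≤1+n L<k))))) (+-identityˡ 0#))) (+-identityˡ 0#)))
    ... | inj₁ k≤L = begin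
      (1# - W) * ((1# - w * W) * (A * P (suc L ℕ.+ (suc k ℕ.+ 1))))
        ≈⟨ *-cong (+-congˡ (-‿cong W′)) (*-cong (+-congˡ (-‿cong (*-congˡ W′))) (*-congˡ (reflexive (cong P (idx₃ L k))))) ⟩
      (1# - W″) * ((1# - w * W″) * (A * Z))
        ≈⟨ solve 5 (λ w d x A Z → let y = d :* x ; W = w :* (w :* (y :* y)) ; B = (con 1ℤ :- d) :* A ; h = w :* (w :* (y :* x)) in
             (con 1ℤ :- W) :* ((con 1ℤ :- w :* W) :* (A :* Z))
             := (con 1ℤ :+ W) :* (B :* ((con 1ℤ :- w :* h) :* Z))
                :+ (d :* (A :* ((con 1ℤ :- h) :* ((con 1ℤ :- w :* h) :* Z))) :+ h :* ((w :* B :- d :* B) :* Z))) ≈-refl w d x A Z ⟩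
      (1# + W″) * (((1# - d) * A) * ((1# - w * h) * Z)) + (d * (A * ((1# - h) * ((1# - w * h) * Z))) + h * ((w * ((1# - d) * A) - d * ((1# - d) * A)) * Z))
        ≈⟨ +-cong (*-cong (+-congˡ (≈-sym W′)) (*-cong B≈ (≈-trans P₂ (reflexive (cong P (≡.sym (idx₂ L k)))))))
             (+-cong (*-congˡ (*-congˡ (≈-trans (*-congˡ P₂) (≈-trans P₁ (reflexive (cong P (≡.sym (idx₁ L k))))))))
                     (*-congˡ (*-cong (+-cong (*-congˡ B≈) (-‿cong (≈-trans (*-congˡ B≈) (≈-sym (w^-pred L k))))) ≈-refl))) ⟩
      (1# + W) * U (suc k) L + (d * U k L + h * ((w * B - w * (f * B)) * Z))
        ≈⟨ +-congˡ (+-congˡ (≈-trans (solve 5 (λ h w B f Z → h :* ((w :* B :- w :* (f :* B)) :* Z) := (w :* h) :* (((con 1ℤ :- f) :* B) :* Z)) ≈-refl h w B f Z)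
             (*-cong wh (*-cong (P∸-suc L (suc k)) (reflexive (cong P (≡.sym (idx₃′ L k)))))))) ⟩
      (1# + W) * U (suc k) L + (d * U k L + w ^ suc (suc (L ℕ.+ suc k)) * U (suc (suc k)) L) ∎
      where
      A B Z d f h x W″ : Series
      A = P∸ L k
      B = P∸ L (suc k)
      Z = P (suc (suc (suc (L ℕ.+ k))))
      d = w ^ (L ∸ k)
      f = w ^ (L ∸ suc k)
      x = w ^ k
      h = w * (w * ((d * x) * x))
      W″ = w * (w * ((d * x) * (d * x)))
      ω≈ : ω ≈ d * x
      ω≈ = ≈-trans (q^≡ (≡.sym (ℕₚ.m∸n+n≡m k≤L))) (q^+ (L ∸ k) k)
      W′ : W ≈ W″
      W′ = ≈-trans W-split (*-congˡ (*-congˡ (*-cong ω≈ ω≈)))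
      h≈ : h ≈ w ^ suc (suc (L ℕ.+ k))
      h≈ = *-congˡ (*-congˡ (≈-trans (*-congʳ (≈-sym ω≈)) (≈-sym (q^+ L k))))
      wh : w * h ≈ w ^ suc (suc (L ℕ.+ suc k))
      wh = ≈-trans (*-congˡ h≈) (q^≡ (cong (suc ∘ suc) (≡.sym (ℕₚ.+-suc L k))))
      B≈ : (1# - d) * A ≈ B
      B≈ = P∸-suc L k
      P₂ : (1# - w * h) * Z ≈ P (suc (suc (L ℕ.+ k)))
      P₂ = ≈-trans (*-congʳ (+-congˡ (-‿cong (*-congˡ h≈)))) (P-suc (suc (suc (L ℕ.+ k))))
      P₁ : (1# - h) * P (suc (suc (L ℕ.+ k))) ≈ P (suc (L ℕ.+ k))
      P₁ = ≈-trans (*-congʳ (+-congˡ (-‿cong h≈))) (P-suc (suc (L ℕ.+ k)))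
      idx₁ : ∀ L k → L ℕ.+ (k ℕ.+ 1) ≡ suc (L ℕ.+ k)
      idx₁ = ℕ-solve
      idx₂ : ∀ L k → L ℕ.+ (suc k ℕ.+ 1) ≡ suc (suc (L ℕ.+ k))
      idx₂ = ℕ-solve
      idx₃ : ∀ L k → suc L ℕ.+ (suc k ℕ.+ 1) ≡ suc (suc (suc (L ℕ.+ k)))
      idx₃ = ℕ-solve
      idx₃′ : ∀ L k → L ℕ.+ (suc (suc k) ℕ.+ 1) ≡ suc (suc (suc (L ℕ.+ k)))
      idx₃′ = ℕ-solve

    factor : Series
    factor = (1# - z * w ^ suc L) * (1# - y * w ^ L)

    -- Summation by parts with `U-rec`. The subtracted boundary term contains U k L and U (k + 1) L,
    -- so it vanishes once k > L.
    telescope : ∀ k → (1# - W) * ((1# - w * W) * ∑ (suc k) (λ n → θ n * U n (suc L))) ≈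
      factor * ∑ (suc k) (λ n → θ n * U n L) - (w ^ (L ∸ k) * (θ (suc k) * U k L) - w ^ suc (suc (L ℕ.+ k)) * (θ k * U (suc k) L))
    telescope zero = begin
      (1# - W) * ((1# - w * W) * (0# + θ 0 * U 0 (suc L)))
        ≈⟨ solve 4 (λ W w t u → (con 1ℤ :- W) :* ((con 1ℤ :- w :* W) :* (con 0ℤ :+ t :* u)) := t :* ((con 1ℤ :- W) :* ((con 1ℤ :- w :* W) :* u))) ≈-refl W w (θ 0) (U 0 (suc L)) ⟩
      θ 0 * ((1# - W) * ((1# - w * W) * U 0 (suc L)))
        ≈⟨ *-congˡ (≈-trans U-rec₀ (+-congʳ (*-congʳ (+-congˡ W-split)))) ⟩
      θ 0 * ((1# + w * (w * (ω * ω))) * U 0 L + ((w * ω) * U 0 L + (w * (w * ω)) * U 1 L))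
        ≈⟨ solve 7 (λ t t₁ z y ω u u₁ → let w = z :* y in
             t :* ((con 1ℤ :+ w :* (w :* (ω :* ω))) :* u :+ ((w :* ω) :* u :+ (w :* (w :* ω)) :* u₁))
             := (((con 1ℤ :- z :* (w :* ω)) :* (con 1ℤ :- y :* ω)) :* (con 0ℤ :+ t :* u) :- (ω :* (t₁ :* u) :- (w :* (w :* ω)) :* (t :* u₁)))
                :+ (ω :* u) :* ((z :* w :+ y) :* t :+ (t₁ :+ w :* t))) ≈-refl (θ 0) (θ 1) z y ω (U 0 L) (U 1 L) ⟩
      (factor * (0# + θ 0 * U 0 L) - (ω * (θ 1 * U 0 L) - (w * (w * ω)) * (θ 0 * U 1 L))) + (ω * U 0 L) * ((z * w + y) * θ 0 + (θ 1 + w * θ 0))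
        ≈⟨ ≈-trans (+-congˡ (*-zero _ θ-rec₀)) (+-identityʳ _) ⟩
      factor * (0# + θ 0 * U 0 L) - (ω * (θ 1 * U 0 L) - (w * (w * ω)) * (θ 0 * U 1 L))
        ≈⟨ +-congˡ (-‿cong (+-congˡ (-‿cong (*-congʳ (q^≡ (cong (suc ∘ suc) (≡.sym (ℕₚ.+-identityʳ L)))))))) ⟩
      factor * (0# + θ 0 * U 0 L) - (ω * (θ 1 * U 0 L) - w ^ suc (suc (L ℕ.+ 0)) * (θ 0 * U 1 L)) ∎
    telescope (suc k) = begin
      (1# - W) * ((1# - w * W) * (S′ + t * U (suc k) (suc L)))
        ≈⟨ solve 5 (λ W w s t u → (con 1ℤ :- W) :* ((con 1ℤ :- w :* W) :* (s :+ t :* u)) := (con 1ℤ :- W) :* ((con 1ℤ :- w :* W) :* s) :+ t :* ((con 1ℤ :- W) :* ((con 1ℤ :- w :* W) :* u))) ≈-refl W w S′ t (U (suc k) (suc L)) ⟩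
      (1# - W) * ((1# - w * W) * S′) + t * ((1# - W) * ((1# - w * W) * U (suc k) (suc L)))
        ≈⟨ +-cong (≈-trans (telescope k) (+-congˡ (-‿cong (+-congˡ (-‿cong (*-congʳ (≈-trans (q^≡ (≡.trans (cong suc (≡.sym (ℕₚ.+-suc L k))) (≡.sym (ℕₚ.+-suc L (suc k))))) (q^+ L (suc (suc k))))))))))
             (*-congˡ (≈-trans (U-rec k) (+-congʳ (*-congʳ (+-congˡ W-split))))) ⟩
      (factor * S - (d * (t * u₀) - (ω * (w * x)) * (t₀ * u))) + t * ((1# + w * (w * (ω * ω))) * u + (d * u₀ + h * u₂))
        ≈⟨ solve 14 (λ z y ω S d t u₀ x t₀ u h u₂ f t₂ → let w = z :* y ; F = (con 1ℤ :- z :* (w :* ω)) :* (con 1ℤ :- y :* ω) in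
             (F :* S :- (d :* (t :* u₀) :- (ω :* (w :* x)) :* (t₀ :* u))) :+ t :* ((con 1ℤ :+ w :* (w :* (ω :* ω))) :* u :+ (d :* u₀ :+ h :* u₂))
             := (F :* (S :+ t :* u) :- (f :* (t₂ :* u) :- h :* (t :* u₂))) :+ (((z :* w :+ y) :* t) :* (ω :* u) :+ (t₂ :* (f :* u) :+ ((w :* x) :* t₀) :* (ω :* u))))
             ≈-refl z y ω S d t u₀ x t₀ u h u₂ f t₂ ⟩
      R + (((z * w + y) * t) * (ω * u) + (t₂ * (f * u) + ((w * x) * t₀) * (ω * u)))
        ≈⟨ +-congˡ (+-cong (*-congˡ ωu) (+-congˡ (*-congˡ ωu))) ⟩
      R + (((z * w + y) * t) * (f * (x * u)) + (t₂ * (f * u) + ((w * x) * t₀) * (f * (x * u))))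
        ≈⟨ +-congˡ (solve 8 (λ a t f x u t₂ w t₀ → (a :* t) :* (f :* (x :* u)) :+ (t₂ :* (f :* u) :+ ((w :* x) :* t₀) :* (f :* (x :* u)))
             := (f :* u) :* (x :* (a :* t) :+ (t₂ :+ (x :* (w :* x)) :* t₀))) ≈-refl (z * w + y) t f x u t₂ w t₀) ⟩
      R + (f * u) * (x * ((z * w + y) * t) + (t₂ + (x * (w * x)) * t₀))
        ≈⟨ ≈-trans (+-congˡ (*-zero _ (≈-trans (+-congˡ (+-congˡ (*-congʳ (≈-sym (q^+ (suc k) (suc (suc k))))))) (θ-rec k)))) (+-identityʳ R) ⟩
      R ∎
      where
      S S′ R t t₀ t₂ u u₀ u₂ d f h x : Series
      S = ∑ (suc k) (λ n → θ n * U n L)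
      S′ = ∑ (suc k) (λ n → θ n * U n (suc L))
      t = θ (suc k)
      t₀ = θ k
      t₂ = θ (suc (suc k))
      u = U (suc k) L
      u₀ = U k L
      u₂ = U (suc (suc k)) L
      d = w ^ (L ∸ k)
      f = w ^ (L ∸ suc k)
      h = w ^ suc (suc (L ℕ.+ suc k))
      x = w ^ suc k
      R = factor * (S + t * u) - (f * (t₂ * u) - h * (t * u₂))
      ωu : ω * u ≈ f * (x * u)
      ωu = ≈-trans (≈-sym (*-assoc _ _ _)) (≈-trans (*-congʳ (≈-sym (q^∸ L (suc k))))
             (solve 4 (λ f x a p → (f :* (x :* a)) :* p := f :* (x :* (a :* p))) ≈-refl f x (P∸ L (suc k)) (P (L ℕ.+ (suc k ℕ.+ 1)))))

  product : ℕ → Series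
  product zero    = 1# - z
  product (suc L) = factor L * product L

  -- The q-binomial theorem for the 2L + 1 factors of `product L`, with the terms n and -n - 1 taken
  -- together. Any K > L gives the same sum.
  finite-triple-product : ∀ K L → L ℕ.< K → Q (suc (L ℕ.+ L)) * ∑ (suc K) (λ n → θ n * U n L) ≈ product L
  finite-triple-product K zero _ = begin
    Q 1 * ∑ (suc K) (λ n → θ n * U n 0)
      ≈⟨ *-congˡ (≈-trans (∑-extend {1} {suc K} (λ n → θ n * U n 0) (s≤s z≤n) (λ n 0<n → *-zero _ (v-< 1 0<n))) (+-identityˡ _)) ⟩
    Q 1 * (θ 0 * (1# * P 1))
      ≈⟨ solve 3 (λ a b c → a :* (b :* (con 1ℤ :* c)) := (a :* c) :* b) ≈-refl (Q 1) (θ 0) (P 1) ⟩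
    (Q 1 * P 1) * θ 0
      ≈⟨ ≈-trans (*-congʳ (Q*P 1)) (≈-trans (*-identityˡ _) θ-zero) ⟩
    1# - z ∎
  finite-triple-product K (suc L) L<K = begin
    Q (suc (suc L ℕ.+ suc L)) * T′
      ≈⟨ *-congʳ (reflexive (cong (Q ∘ suc ∘ suc) (ℕₚ.+-suc L L))) ⟩
    ((1# - w * W) * ((1# - W) * Q (suc (L ℕ.+ L)))) * T′
      ≈⟨ solve 4 (λ a b c d → (a :* (b :* c)) :* d := c :* (b :* (a :* d))) ≈-refl (1# - w * W) (1# - W) (Q (suc (L ℕ.+ L))) T′ ⟩
    Q (suc (L ℕ.+ L)) * ((1# - W) * ((1# - w * W) * T′))
      ≈⟨ *-congˡ (≈-trans (telescope L K) (≈-trans (+-congˡ (≈-trans (-‿cong (+-cong (*-zero _ (*-zero _ (v-< 1 L<K′)))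
             (-‿cong (*-zero _ (*-zero _ (v-< 1 (ℕₚ.m≤n⇒m≤1+n L<K′))))))) (solve 0 (:- (con 0ℤ :- con 0ℤ) := con 0ℤ) ≈-refl))) (+-identityʳ _))) ⟩
    Q (suc (L ℕ.+ L)) * (factor L * ∑ (suc K) (λ n → θ n * U n L))
      ≈⟨ solve 3 (λ a b c → a :* (b :* c) := b :* (a :* c)) ≈-refl (Q (suc (L ℕ.+ L))) (factor L) _ ⟩
    factor L * (Q (suc (L ℕ.+ L)) * ∑ (suc K) (λ n → θ n * U n L))
      ≈⟨ *-congˡ (finite-triple-product K L L<K′) ⟩
    factor L * product L ∎
    where
    L<K′ : L ℕ.< K
    L<K′ = ℕₚ.<-trans ℕₚ.≤-refl L<K
    W T′ : Series
    W = w ^ suc (suc (L ℕ.+ L))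
    T′ = ∑ (suc K) (λ n → θ n * U n (suc L))

  triple-product : Q (M ℕ.+ M) * product (M ℕ.+ M) ≈ ∑ (suc M) θ
  triple-product = begin
    Q b * product b
      ≈⟨ *-congˡ (≈-sym (finite-triple-product (suc b) b ℕₚ.≤-refl)) ⟩
    Q b * (Q (suc (b ℕ.+ b)) * ∑ (suc (suc b)) (λ n → θ n * U n b))
      ≈⟨ *-cong (Q-stable M≤b) (*-cong (Q-stable (ℕₚ.≤-trans M≤b (ℕₚ.m≤n⇒m≤1+n (ℕₚ.m≤m+n b b))))
           (≈-trans (∑-extend (λ n → θ n * U n b) (s≤s (ℕₚ.m≤n⇒m≤1+n M≤b)) (λ n M<n → zero-* _ (θ-vanishes M<n)))
             (≈-trans (∑-cong< (suc M) (λ { n (s≤s n≤M) → ≈-trans (*-congˡ (v-limit 1 n n≤M)) (*-comm _ _) })) (∑-*ˡ (suc M) (P M * P M) θ)))) ⟩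
    Q M * (Q M * ((P M * P M) * ∑ (suc M) θ))
      ≈⟨ solve 3 (λ q p s → q :* (q :* ((p :* p) :* s)) := (q :* p) :* ((q :* p) :* s)) ≈-refl (Q M) (P M) _ ⟩
    (Q M * P M) * ((Q M * P M) * ∑ (suc M) θ)
      ≈⟨ ≈-trans (*-cong (Q*P M) (≈-trans (*-congʳ (Q*P M)) (*-identityˡ _))) (*-identityˡ _) ⟩
    ∑ (suc M) θ ∎
    where
    b : ℕ
    b = M ℕ.+ M
    M≤b : M ℕ.≤ b
    M≤b = ℕₚ.m≤m+n M M

-- Counting partitions by generating functions

-- The head of xs is removed from ys and the rest compared. Counting below always goes by mutual
-- inclusion of duplicate-free lists.
unique-length : ∀ {A : Set} {xs ys : List A} → Unique xs → (∀ {x} → x ∈ xs → x ∈ ys) → length xs ≤ length ys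
unique-length {xs = []}     _        _ = z≤n
unique-length {xs = x ∷ xs} (x≢ ∷ u) ⊆ys with ∈-∃++ (⊆ys (here refl))
... | as , bs , refl = ℕₚ.≤-trans (s≤s (unique-length u rest))
    (ℕₚ.≤-reflexive (≡.trans (cong suc (Listₚ.length-++ as)) (≡.trans (≡.sym (ℕₚ.+-suc (length as) (length bs))) (≡.sym (Listₚ.length-++ as)))))
  where
  rest : ∀ {y} → y ∈ xs → y ∈ as ++ bs
  rest {y} y∈xs with ∈-++⁻ as (⊆ys (there y∈xs))
  ... | inj₁ y∈as            = ∈-++⁺ˡ y∈as
  ... | inj₂ (here refl)     = ⊥-elim (All.lookup x≢ y∈xs refl)
  ... | inj₂ (there y∈bs)    = ∈-++⁺ʳ as y∈bs

unique-length-≡ : ∀ {A : Set} {xs ys : List A} → Unique xs → Unique ys →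
                  (∀ {x} → x ∈ xs → x ∈ ys) → (∀ {x} → x ∈ ys → x ∈ xs) → length xs ≡ length ys
unique-length-≡ u v p r = ℕₚ.≤-antisym (unique-length u p) (unique-length v r)

data Desc : ℕ → List ℕ → Set where
  []   : ∀ {B} → Desc B []
  cons : ∀ {B x l} → 1 ≤ x → x ≤ B → Desc x l → Desc B (x ∷ l)

Desc-mono : ∀ {A B l} → A ≤ B → Desc A l → Desc B l
Desc-mono A≤B []             = []
Desc-mono A≤B (cons p r d) = cons p (ℕₚ.≤-trans r A≤B) d

partition⇒Desc : ∀ n l → T (isPartitionOf n l) → Desc n l × sum l ≡ n
partition⇒Desc n l t = desc l (proj₁ t₁) (proj₁ t₂) (ℕₚ.≤-reflexive s) , s
  where
  t₁ : T (nonIncreasing l) × T (allPositive l ∧ (sum l ℕ.≡ᵇ n))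
  t₁ = Equivalence.to T-∧ t
  t₂ : T (allPositive l) × T (sum l ℕ.≡ᵇ n)
  t₂ = Equivalence.to T-∧ (proj₂ t₁)
  s : sum l ≡ n
  s = ℕₚ.≡ᵇ⇒≡ (sum l) n (proj₂ t₂)
  chain : ∀ x l → T (nonIncreasing (x ∷ l)) → T (allPositive l) → Desc x l
  chain x []      _ _ = []
  chain x (y ∷ l) a b with Equivalence.to T-∧ a | Equivalence.to T-∧ b
  ... | y≤x , a′ | 1≤y , b′ = cons (ℕₚ.≤ᵇ⇒≤ 1 y 1≤y) (ℕₚ.≤ᵇ⇒≤ y x y≤x) (chain y l a′ b′)
  desc : ∀ l → T (nonIncreasing l) → T (allPositive l) → sum l ≤ n → Desc n l
  desc []      _ _ _ = []
  desc (x ∷ l) a b s≤n with Equivalence.to T-∧ b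
  ... | 1≤x , b′ = cons (ℕₚ.≤ᵇ⇒≤ 1 x 1≤x) (ℕₚ.≤-trans (ℕₚ.m≤m+n x (sum l)) s≤n) (chain x l a b′)

Desc⇒partition : ∀ {B} l → Desc B l → T (isPartitionOf (sum l) l)
Desc⇒partition l d = Equivalence.from T-∧ (sorted d , Equivalence.from T-∧ (positive d , ℕₚ.≡⇒≡ᵇ (sum l) (sum l) refl))
  where
  sorted : ∀ {B l} → Desc B l → T (nonIncreasing l)
  sorted []                                 = _
  sorted (cons _ _ [])                      = _
  sorted (cons _ _ (cons p r d)) = Equivalence.from T-∧ (ℕₚ.≤⇒≤ᵇ r , sorted {_} (cons p ℕₚ.≤-refl d))
  positive : ∀ {B l} → Desc B l → T (allPositive l)
  positive []           = _
  positive (cons p _ d) = Equivalence.from T-∧ (ℕₚ.≤⇒≤ᵇ p , positive d)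

Desc-length : ∀ {B l} → Desc B l → length l ≤ sum l
Desc-length []           = z≤n
Desc-length (cons p _ d) = ℕₚ.+-mono-≤ p (Desc-length d)

range1-∈ : ∀ {m x} → 1 ≤ x → x ≤ m → x ∈ range1 m
range1-∈ {zero}  1≤x z≤n = ⊥-elim (ℕₚ.<-irrefl refl 1≤x)
range1-∈ {suc m} 1≤x x≤sm with ℕₚ.m≤n⇒m<n∨m≡n x≤sm
... | inj₁ (s≤s x≤m) = ∈-++⁺ˡ (range1-∈ 1≤x x≤m)
... | inj₂ refl      = ∈-++⁺ʳ (range1 m) (here refl)

range1-bounds : ∀ {m x} → x ∈ range1 m → 1 ≤ x × x ≤ m
range1-bounds {suc m} p with ∈-++⁻ (range1 m) p
... | inj₁ q with range1-bounds {m} q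
...   | a , b = a , ℕₚ.m≤n⇒m≤1+n b
range1-bounds {suc m} p | inj₂ (here refl) = s≤s z≤n , ℕₚ.≤-refl

range1-unique : ∀ m → Unique (range1 m)
range1-unique zero    = []
range1-unique (suc m) = Uniqueₚ.++⁺ (range1-unique m) ([] ∷ [])
  (λ { (p , here refl) → ℕₚ.<-irrefl refl (proj₂ (range1-bounds {m} p)) })

listsOfLen-length : ∀ m k {l} → l ∈ listsOfLen m k → length l ≡ k
listsOfLen-length m zero    (here refl) = refl
listsOfLen-length m (suc k) p with find (∈-concatMap⁻ (λ x → map (x ∷_) (listsOfLen m k)) {xs = range1 m} p)
... | x , _ , r with ∈-map⁻ (x ∷_) r
...   | l , l∈ , refl = cong suc (listsOfLen-length m k l∈)

listsOfLen-unique : ∀ m k → Unique (listsOfLen m k)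
listsOfLen-unique m zero    = [] ∷ []
listsOfLen-unique m (suc k) = Uniqueₚ.concat⁺
  (Allₚ.map⁺ (All.universal (λ x → Uniqueₚ.map⁺ Listₚ.∷-injectiveʳ (listsOfLen-unique m k)) (range1 m)))
  (AllPairsₚ.map⁺ (AllPairs.map disjoint (range1-unique m)))
  where
  disjoint : ∀ {x y} → x ≢ y → ∀ {l} → ¬ (l ∈ map (x ∷_) (listsOfLen m k) × l ∈ map (y ∷_) (listsOfLen m k))
  disjoint {x} {y} x≢y (p , r) with ∈-map⁻ (x ∷_) p | ∈-map⁻ (y ∷_) r
  ... | _ , _ , refl | _ , _ , refl = x≢y refl

candidates-unique : ∀ n → Unique (candidates n)
candidates-unique n = Uniqueₚ.concat⁺
  (Allₚ.map⁺ (All.universal (listsOfLen-unique n) (range0 n)))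
  (AllPairsₚ.map⁺ (AllPairs.map (λ k≢j {l} p → k≢j (≡.trans (≡.sym (listsOfLen-length n _ (proj₁ p))) (listsOfLen-length n _ (proj₂ p))))
    (All.tabulate (λ { p refl → ℕₚ.<-irrefl refl (proj₁ (range1-bounds {n} p)) }) ∷ range1-unique n)))

Desc-listsOfLen : ∀ {B n l} → B ≤ n → Desc B l → l ∈ listsOfLen n (length l)
Desc-listsOfLen B≤n [] = here refl
Desc-listsOfLen {n = n} {x ∷ l} B≤n (cons p r d) = ∈-concatMap⁺ (λ y → map (y ∷_) (listsOfLen n (length l)))
  (lose (range1-∈ p (ℕₚ.≤-trans r B≤n)) (∈-map⁺ (x ∷_) (Desc-listsOfLen (ℕₚ.≤-trans r B≤n) d)))

Desc-candidates : ∀ {n l} → Desc n l → sum l ≡ n → l ∈ candidates n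
Desc-candidates {n} {l} d s = ∈-concatMap⁺ (listsOfLen n) (lose (range0-∈ (length l) (subst (length l ≤_) s (Desc-length d))) (Desc-listsOfLen ℕₚ.≤-refl d))
  where
  range0-∈ : ∀ k → k ≤ n → k ∈ range0 n
  range0-∈ zero    _   = here refl
  range0-∈ (suc k) k≤n = there (range1-∈ (s≤s z≤n) k≤n)

module GeneratingFunctions (M : ℕ) where
  open Sums M
  open import Relation.Binary.Reasoning.Setoid setoid

  X^-small : ∀ k n → n < k → (X ^ k) n ≡ 0ℤ
  X^-small (suc k) zero    _       = X-⊛-zero (X ^ k)
  X^-small (suc k) (suc n) (s≤s p) = ≡.trans (X-⊛-suc (X ^ k) n) (X^-small k n p)

  X^-large : ∀ k n → k < n → (X ^ k) n ≡ 0ℤ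
  X^-large zero    (suc n) _       = const-suc 1ℤ n
  X^-large (suc k) (suc n) (s≤s p) = ≡.trans (X-⊛-suc (X ^ k) n) (X^-large k n p)

  X^-self : ∀ n → (X ^ n) n ≡ 1ℤ
  X^-self zero    = const-0 1ℤ
  X^-self (suc n) = ≡.trans (X-⊛-suc (X ^ n) n) (X^-self n)

  X-nil : Nilpotent X
  X-nil {n} M<n = agree (λ k k≤M → ≡.trans (X^-small n k (ℕₚ.≤-<-trans k≤M M<n)) (≡.sym (const-zero k)))

  open Base X X-nil public
  open Bailey M X X-nil using (Θ)

  gordonSeries : ℕ → ℕ → Series
  gordonSeries i p = P M * ∑ (suc M) (Θ i p)

  weigh : List (List ℕ) → Series
  weigh []       = 0#
  weigh (l ∷ ls) = X ^ sum l + weigh ls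

  weigh-++ : ∀ xs ys → weigh (xs ++ ys) ≈ weigh xs + weigh ys
  weigh-++ []       ys = ≈-sym (+-identityˡ (weigh ys))
  weigh-++ (x ∷ xs) ys = ≈-trans (+-congˡ (weigh-++ xs ys)) (≈-sym (+-assoc _ _ _))

  weigh-map : ∀ h k → (∀ l → sum (h l) ≡ k ℕ.+ sum l) → ∀ ls → weigh (map h ls) ≈ X ^ k * weigh ls
  weigh-map h k p []       = ≈-sym (zeroʳ _)
  weigh-map h k p (l ∷ ls) = ≈-trans (+-cong (≈-trans (q^≡ (p l)) (q^+ k (sum l))) (weigh-map h k p ls)) (≈-sym (distribˡ _ _ _))

  weigh-coeff : ∀ n ls → weigh ls n ≡ + length (filter (λ l → sum l ℕ.≟ n) ls)
  weigh-coeff n []       = const-zero n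
  weigh-coeff n (l ∷ ls) = ≡.trans (⊕-coeff (X ^ sum l) (weigh ls) n) (by-cases (ℕₚ.<-cmp (sum l) n))
    where
    by-cases : Tri (sum l < n) (sum l ≡ n) (n < sum l) →
               (X ^ sum l) n ℤ.+ weigh ls n ≡ + length (filter (λ l → sum l ℕ.≟ n) (l ∷ ls))
    by-cases (tri≈ _ s≡n _) = ≡.trans
      (cong₂ ℤ._+_ (≡.trans (cong (λ k → (X ^ k) n) s≡n) (X^-self n)) (weigh-coeff n ls))
      (cong (+_ ∘ length) (≡.sym (Listₚ.filter-accept (λ l → sum l ℕ.≟ n) {l} {ls} s≡n)))
    by-cases (tri< s<n s≢n _) = ≡.trans
      (≡.trans (cong₂ ℤ._+_ (X^-large (sum l) n s<n) (weigh-coeff n ls)) (ℤₚ.+-identityˡ _))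
      (cong (+_ ∘ length) (≡.sym (Listₚ.filter-reject (λ l → sum l ℕ.≟ n) {l} {ls} s≢n)))
    by-cases (tri> _ s≢n n<s) = ≡.trans
      (≡.trans (cong₂ ℤ._+_ (X^-small (sum l) n n<s) (weigh-coeff n ls)) (ℤₚ.+-identityˡ _))
      (cong (+_ ∘ length) (≡.sym (Listₚ.filter-reject (λ l → sum l ℕ.≟ n) {l} {ls} s≢n)))

  -- f is the generating function, up to degree M, of the elements of S by their sums;
  -- the list may or may not contain the elements of larger sum.
  record HasGF (S : List ℕ → Set) (f : Series) : Set where
    field
      elems    : List (List ℕ)
      unique   : Unique elems
      sound    : ∀ {l} → l ∈ elems → S l
      complete : ∀ {l} → S l → sum l ≤ M → l ∈ elems
      total    : weigh elems ≈ f
  open HasGF public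

  gf-≈ : ∀ {S f g} → f ≈ g → HasGF S f → HasGF S g
  gf-≈ f≈g G = record { elems = elems G ; unique = unique G ; sound = sound G ; complete = complete G ; total = ≈-trans (total G) f≈g }

  gf-⇔ : ∀ {S S′ f} → (∀ {l} → S l → S′ l) → (∀ {l} → S′ l → sum l ≤ M → S l) → HasGF S f → HasGF S′ f
  gf-⇔ to from G = record { elems = elems G ; unique = unique G ; sound = to ∘ sound G
    ; complete = λ s s≤M → complete G (from s s≤M) s≤M ; total = total G }

  gf-∅ : ∀ {S} → (∀ {l} → ¬ S l) → HasGF S 0#
  gf-∅ empty = record { elems = [] ; unique = [] ; sound = λ () ; complete = λ s _ → ⊥-elim (empty s) ; total = ≈-refl }

  gf-[] : HasGF (_≡ []) 1#
  gf-[] = record { elems = [] ∷ [] ; unique = [] ∷ [] ; sound = λ { (here p) → p } ; complete = λ { refl _ → here refl } ; total = +-identityʳ 1# }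

  gf-⊎ : ∀ {S S′ f g} → (∀ {l} → S l → S′ l → ⊥) → HasGF S f → HasGF S′ g → HasGF (λ l → S l ⊎ S′ l) (f + g)
  gf-⊎ disjoint F G = record
    { elems    = elems F ++ elems G
    ; unique   = Uniqueₚ.++⁺ (unique F) (unique G) (λ { (p , r) → disjoint (sound F p) (sound G r) })
    ; sound    = λ p → Sum.map (sound F) (sound G) (∈-++⁻ (elems F) p)
    ; complete = λ { (inj₁ s) b → ∈-++⁺ˡ (complete F s b) ; (inj₂ s) b → ∈-++⁺ʳ (elems F) (complete G s b) }
    ; total    = ≈-trans (weigh-++ (elems F) (elems G)) (+-cong (total F) (total G))
    }

  gf-map : ∀ {S f} h k → (∀ {l l′} → h l ≡ h l′ → l ≡ l′) → (∀ l → sum (h l) ≡ k ℕ.+ sum l) →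
           HasGF S f → HasGF (λ l → ∃ λ l′ → l ≡ h l′ × S l′) (X ^ k * f)
  gf-map {S} h k inj shift G = record
    { elems    = map h (elems G)
    ; unique   = Uniqueₚ.map⁺ inj (unique G)
    ; sound    = λ p → let (l′ , l′∈ , eq) = ∈-map⁻ h p in l′ , eq , sound G l′∈
    ; complete = λ { (l′ , refl , s) b → ∈-map⁺ h (complete G s (ℕₚ.≤-trans (ℕₚ.m≤n+m (sum l′) k) (subst (_≤ M) (shift l′) b))) }
    ; total    = ≈-trans (weigh-map h k shift (elems G)) (*-congˡ (total G))
    }

  gf-cons : ∀ {S f} x → HasGF S f → HasGF (λ l → ∃ λ l′ → l ≡ x ∷ l′ × S l′) (X ^ x * f)
  gf-cons x = gf-map (x ∷_) x Listₚ.∷-injectiveʳ (λ _ → refl)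

  gf-∑ : ∀ K {S : ℕ → List ℕ → Set} {f} → (∀ {m n l} → S m l → S n l → m ≡ n) →
         (∀ n → n < K → HasGF (S n) (f n)) → HasGF (λ l → ∃ λ n → n < K × S n l) (∑ K f)
  gf-∑ zero    _   _ = gf-∅ (λ { (_ , () , _) })
  gf-∑ (suc K) {S} dis G = gf-⇔
    (λ { (inj₁ (n , n<K , s)) → n , ℕₚ.m≤n⇒m≤1+n n<K , s ; (inj₂ s) → K , ℕₚ.≤-refl , s })
    (λ { (n , n<sK , s) _ → split n n<sK s (ℕₚ.m≤n⇒m<n∨m≡n (ℕ.s≤s⁻¹ n<sK)) })
    (gf-⊎ (λ { (n , n<K , s) s′ → ℕₚ.<-irrefl (dis s s′) n<K })
      (gf-∑ K dis (λ n n<K → G n (ℕₚ.m≤n⇒m≤1+n n<K))) (G K ℕₚ.≤-refl))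
    where
    split : ∀ n {l} → n < suc K → S n l → n < K ⊎ n ≡ K → (∃ λ n → n < K × S n l) ⊎ S K l
    split n _ s (inj₁ n<K)  = inj₁ (n , n<K , s)
    split n _ s (inj₂ refl) = inj₂ s

  -- The number being partitioned is the truncation degree itself, so only the top coefficient is
  -- read off, and S has to match P only on lists of sum M.
  count-coeff : ∀ {S f} P → HasGF S f →
    (∀ {l} → Desc M l → sum l ≡ M → T (P l) → S l) →
    (∀ {l} → S l → sum l ≡ M → (∃ λ B → Desc B l) × T (P l)) →
    + countPartitions P M ≡ f M
  count-coeff P G to from = ≡.trans (cong +_ same) (≡.trans (≡.sym (weigh-coeff M (elems G))) (at (total G) M ℕₚ.≤-refl))
    where
    good? : (l : List ℕ) → _
    good? l = T? (isPartitionOf M l ∧ P l)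
    same : countPartitions P M ≡ length (filter (λ l → sum l ℕ.≟ M) (elems G))
    same = unique-length-≡ (Uniqueₚ.filter⁺ good? (candidates-unique M)) (Uniqueₚ.filter⁺ (λ l → sum l ℕ.≟ M) (unique G)) ⊆₁ ⊆₂
      where
      ⊆₁ : ∀ {l} → l ∈ filter good? (candidates M) → l ∈ filter (λ l → sum l ℕ.≟ M) (elems G)
      ⊆₁ {l} p with ∈-filter⁻ good? {xs = candidates M} p
      ... | _ , t with Equivalence.to T-∧ t
      ... | tp , tP with partition⇒Desc M l tp
      ... | d , s = ∈-filter⁺ (λ l → sum l ℕ.≟ M) (complete G (to d s tP) (ℕₚ.≤-reflexive s)) s
      ⊆₂ : ∀ {l} → l ∈ filter (λ l → sum l ℕ.≟ M) (elems G) → l ∈ filter good? (candidates M)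
      ⊆₂ {l} p with ∈-filter⁻ (λ l → sum l ℕ.≟ M) {xs = elems G} p
      ... | l∈ , s with from (sound G l∈) s
      ... | (B , d) , tP with subst (λ n → T (isPartitionOf n l)) s (Desc⇒partition l d)
      ... | tp = ∈-filter⁺ good? (Desc-candidates (proj₁ (partition⇒Desc M l tp)) s) (Equivalence.from T-∧ (tp , tP))

-- Partitions with a gap condition

hit : ℕ → ℕ → ℕ
hit v x = if x ≡ᵇ v then 1 else 0

hit-self : ∀ v → hit v v ≡ 1
hit-self zero    = refl
hit-self (suc v) = hit-self v

hit-≢ : ∀ v x → x ≢ v → hit v x ≡ 0
hit-≢ zero    zero    p = ⊥-elim (p refl)
hit-≢ zero    (suc x) p = refl
hit-≢ (suc v) zero    p = refl
hit-≢ (suc v) (suc x) p = hit-≢ v x (p ∘ cong suc)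

count : ℕ → List ℕ → ℕ
count v []      = 0
count v (x ∷ l) = hit v x ℕ.+ count v l

onesCount≡ : ∀ l → onesCount l ≡ count 1 l
onesCount≡ []      = refl
onesCount≡ (x ∷ l) = cong (hit 1 x ℕ.+_) (onesCount≡ l)

count-++ : ∀ v l l′ → count v (l ++ l′) ≡ count v l ℕ.+ count v l′
count-++ v []      l′ = refl
count-++ v (x ∷ l) l′ = ≡.trans (cong (hit v x ℕ.+_) (count-++ v l l′)) (≡.sym (ℕₚ.+-assoc (hit v x) (count v l) (count v l′)))

count-replicate : ∀ v c → count v (replicate c v) ≡ c
count-replicate v zero    = refl
count-replicate v (suc c) = cong₂ ℕ._+_ (hit-self v) (count-replicate v c)

count-replicate-≢ : ∀ v {x} c → x ≢ v → count v (replicate c x) ≡ 0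
count-replicate-≢ v zero    p = refl
count-replicate-≢ v (suc c) p = cong₂ ℕ._+_ (hit-≢ v _ p) (count-replicate-≢ v c p)

count-absent : ∀ {v l} → All (_≢ v) l → count v l ≡ 0
count-absent         []       = refl
count-absent {v} (p ∷ ps) = cong₂ ℕ._+_ (hit-≢ v _ p) (count-absent ps)

Desc-bounded : ∀ {B l} → Desc B l → All (_≤ B) l
Desc-bounded []           = []
Desc-bounded (cons _ p d) = p ∷ All.map (λ r → ℕₚ.≤-trans r p) (Desc-bounded d)

sum-bounds : ∀ {N l} → All (N <_) l → sum l ≤ N → l ≡ []
sum-bounds []           _ = refl
sum-bounds {N} {x ∷ l} (p ∷ ps) s = ⊥-elim (ℕₚ.<-irrefl refl (ℕₚ.≤-trans p (ℕₚ.≤-trans (ℕₚ.m≤m+n x (sum l)) s)))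

sum-replicate : ∀ c x → sum (replicate c x) ≡ x ℕ.* c
sum-replicate zero    x = ≡.sym (ℕₚ.*-zeroʳ x)
sum-replicate (suc c) x = ≡.trans (cong (x ℕ.+_) (sum-replicate c x)) (≡.sym (ℕₚ.*-suc x c))

split-least : ∀ {N B l} → Desc B l → All (N <_) l → ∃₂ λ μ c → l ≡ μ ++ replicate c (suc N) × All (suc N <_) μ
split-least [] [] = [] , 0 , refl , []
split-least {N} (cons {x = x} _ _ d) (p ∷ ps) with ℕₚ.m≤n⇒m<n∨m≡n p
... | inj₁ sN<x with split-least d ps
...   | μ , c , refl , above = x ∷ μ , c , refl , sN<x ∷ above
split-least {N} (cons {x = x} _ _ d) (p ∷ ps) | inj₂ refl = [] , _ , cong (suc N ∷_) (constant d ps) , []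
  where
  constant : ∀ {l} → Desc (suc N) l → All (N <_) l → l ≡ replicate (length l) (suc N)
  constant [] _ = refl
  constant (cons _ r d) (p ∷ ps) with ℕₚ.≤-antisym r p
  ... | refl = cong (suc N ∷_) (constant d ps)

Desc-++⁻ˡ : ∀ {B} l {l′} → Desc B (l ++ l′) → Desc B l
Desc-++⁻ˡ []      d              = []
Desc-++⁻ˡ (x ∷ l) (cons p r d) = cons p r (Desc-++⁻ˡ l d)

Desc-replicate : ∀ {B N} → suc N ≤ B → ∀ c → Desc B (replicate c (suc N))
Desc-replicate p zero    = []
Desc-replicate p (suc c) = cons (s≤s z≤n) p (Desc-replicate ℕₚ.≤-refl c)

Desc-++-replicate : ∀ {B N μ} → Desc B μ → All (suc N <_) μ → ∀ c → Desc (B ℕ.⊔ suc N) (μ ++ replicate c (suc N))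
Desc-++-replicate {B} {N} [] _ c = Desc-replicate (ℕₚ.m≤n⊔m B (suc N)) c
Desc-++-replicate {B} {N} (cons p r d) (s ∷ ss) c = cons p (ℕₚ.≤-trans r (ℕₚ.m≤m⊔n B (suc N)))
  (Desc-mono (ℕₚ.≤-reflexive (ℕₚ.m≥n⇒m⊔n≡m (ℕₚ.<⇒≤ s))) (Desc-++-replicate d ss c))

-- The gap condition in terms of multiplicities. In this form the effect of removing all parts N + 1
-- is visible.
Sparse : ℕ → List ℕ → Set
Sparse r l = ∀ v → count v l ℕ.+ count (suc v) l < r

atLeast : ℕ → List ℕ → ℕ
atLeast t []      = 0
atLeast t (x ∷ l) = (if t ≤ᵇ x then 1 else 0) ℕ.+ atLeast t l

hits≤ : ∀ v x → hit v x ℕ.+ hit (suc v) x ≤ (if v ≤ᵇ x then 1 else 0)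
hits≤ zero    zero          = ℕₚ.≤-refl
hits≤ zero    (suc zero)    = ℕₚ.≤-refl
hits≤ zero    (suc (suc x)) = z≤n
hits≤ (suc v) zero          = z≤n
hits≤ (suc v) (suc x)       = ℕₚ.≤-trans (hits≤ v x) (ℕₚ.≤-reflexive (cong (if_then 1 else 0) (≤ᵇ-suc v x)))
  where
  ≤ᵇ-suc : ∀ v x → (v ≤ᵇ x) ≡ (suc v ≤ᵇ suc x)
  ≤ᵇ-suc zero    x = refl
  ≤ᵇ-suc (suc v) x = refl

counts≤atLeast : ∀ v l → count v l ℕ.+ count (suc v) l ≤ atLeast v l
counts≤atLeast v []      = z≤n
counts≤atLeast v (x ∷ l) = ℕₚ.≤-trans (ℕₚ.≤-reflexive (interchange (hit v x) (count v l) (hit (suc v) x) (count (suc v) l)))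
  (ℕₚ.+-mono-≤ (hits≤ v x) (counts≤atLeast v l))
  where
  interchange : ∀ a b c d → (a ℕ.+ b) ℕ.+ (c ℕ.+ d) ≡ (a ℕ.+ c) ℕ.+ (b ℕ.+ d)
  interchange = ℕ-solve

atLeast-zero : ∀ {t B l} → B < t → Desc B l → atLeast t l ≡ 0
atLeast-zero B<t [] = refl
atLeast-zero {t} {B} B<t (cons {x = x} _ r d) with t ≤ᵇ x in eq
... | true  = ⊥-elim (ℕₚ.<-irrefl refl (ℕₚ.≤-trans B<t (ℕₚ.≤-trans (ℕₚ.≤ᵇ⇒≤ t x (Equivalence.from T-≡ eq)) r)))
... | false = atLeast-zero (ℕₚ.≤-<-trans r B<t) d

part-atLeast : ∀ {t B l} k → Desc B l → suc k ≤ atLeast t l → suc k ≤ length l × t ≤ part l (suc k)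
part-atLeast {t} {B} {x ∷ l} k (cons _ r d) p with t ≤ᵇ x in eq
... | false = ⊥-elim (ℕₚ.<⇒≱ p (ℕₚ.≤-trans (ℕₚ.≤-reflexive (atLeast-zero x<t d)) z≤n))
  where
  x<t : x < t
  x<t = ℕₚ.≰⇒> (λ t≤x → subst T eq (ℕₚ.≤⇒≤ᵇ t≤x))
part-atLeast {t} {B} {x ∷ l} zero    (cons _ r d) p | true = s≤s z≤n , ℕₚ.≤ᵇ⇒≤ t x (Equivalence.from T-≡ eq)
part-atLeast {t} {B} {x ∷ l} (suc k) (cons _ r d) (s≤s p) | true with part-atLeast k d p
... | a , b = s≤s a , b

-- Here r is one less than in `gapCond`, and j counts from 0: the index j + r - 1 becomes
-- `suc j + r`.
Gap : ℕ → List ℕ → Set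
Gap r l = ∀ j → suc j ℕ.+ r ≤ length l → part l (suc j ℕ.+ r) ℕ.+ 2 ≤ part l (suc j)

-- If more than r parts equal v or v + 1, then the part at position r + 1 is at least v, so the gap
-- makes the largest part at least v + 2. It is not among those counted, and the claim passes to the
-- tail.
Gap⇒Sparse : ∀ {r B l} → Desc B l → Gap r l → Sparse (suc r) l
Gap⇒Sparse []                     g v = s≤s z≤n
Gap⇒Sparse {r} {B} {x ∷ l} (cons p b d) g v with ℕₚ.≤-<-connex (suc r) (count v (x ∷ l) ℕ.+ count (suc v) (x ∷ l))
... | inj₂ small = small
... | inj₁ large with part-atLeast {v} r (cons {B} p b d) (ℕₚ.≤-trans large (counts≤atLeast v (x ∷ l)))
...   | len , v≤part = unchanged (Gap⇒Sparse d (λ j le → g (suc j) (s≤s le)) v)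
  where
  v+2≤x : v ℕ.+ 2 ≤ x
  v+2≤x = ℕₚ.≤-trans (ℕₚ.+-monoˡ-≤ 2 v≤part) (g 0 len)
  x≢v : x ≢ v
  x≢v refl = ℕₚ.<-irrefl refl (ℕₚ.≤-trans (ℕₚ.≤-trans (ℕₚ.n≤1+n (suc v)) (ℕₚ.≤-reflexive (ℕₚ.+-comm 2 v))) v+2≤x)
  x≢sv : x ≢ suc v
  x≢sv refl = ℕₚ.<-irrefl refl (ℕₚ.≤-trans (ℕₚ.≤-reflexive (ℕₚ.+-comm 2 v)) v+2≤x)
  unchanged : count v l ℕ.+ count (suc v) l < suc r → count v (x ∷ l) ℕ.+ count (suc v) (x ∷ l) < suc r
  unchanged q rewrite hit-≢ v x x≢v | hit-≢ (suc v) x x≢sv = q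

part-bound : ∀ {B l} k → Desc B l → part l k ≤ B
part-bound k             []           = z≤n
part-bound zero          (cons _ r d) = z≤n
part-bound (suc zero)    (cons _ r d) = r
part-bound (suc (suc k)) (cons _ r d) = ℕₚ.≤-trans (part-bound (suc k) d) r

-- Used with y = λ_{r+1}: if the gap after the first part fails, the first r + 1 parts all lie in
-- {y, y + 1}, against sparseness.
window : ∀ {y B l} k → B ≤ suc y → Desc B l → k ≤ length l → (0 < k → y ≤ part l k) → k ≤ count y l ℕ.+ count (suc y) l
window zero    _ _ _ _ = z≤n
window {y} {B} {x ∷ l} (suc k) B≤ (cons p r d) (s≤s len) y≤ =
  ℕₚ.≤-trans (s≤s (window k (ℕₚ.≤-trans r B≤) d len (λ { (s≤s _) → y≤ (s≤s z≤n) }))) bump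
  where
  y≤x : y ≤ x
  y≤x = ℕₚ.≤-trans (y≤ (s≤s z≤n)) (part-bound (suc k) (cons p ℕₚ.≤-refl d))
  bump : suc (count y l ℕ.+ count (suc y) l) ≤ count y (x ∷ l) ℕ.+ count (suc y) (x ∷ l)
  bump with ℕₚ.m≤n⇒m<n∨m≡n (ℕₚ.≤-trans r B≤)
  ... | inj₂ refl rewrite hit-self y = ℕₚ.≤-trans (ℕₚ.≤-reflexive (≡.sym (ℕₚ.+-suc (count y l) (count (suc y) l))))
                                         (ℕₚ.+-monoˡ-≤ _ (ℕₚ.m≤n+m (count y l) (hit y (suc y))))
  ... | inj₁ (s≤s x≤y) with ℕₚ.≤-antisym x≤y y≤x
  ...   | refl rewrite hit-self x = s≤s (ℕₚ.+-monoʳ-≤ (count x l) (ℕₚ.m≤n+m (count (suc x) l) (hit (suc x) x)))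

Sparse-tail : ∀ {r x l} → Sparse r (x ∷ l) → Sparse r l
Sparse-tail {x = x} {l} s v = ℕₚ.≤-<-trans (ℕₚ.+-mono-≤ (ℕₚ.m≤n+m (count v l) (hit v x)) (ℕₚ.m≤n+m (count (suc v) l) (hit (suc v) x))) (s v)

Sparse⇒Gap : ∀ {r B l} → Desc B l → Sparse (suc r) l → Gap r l
Sparse⇒Gap {r} {B} {x ∷ l} (cons p b d) s (suc j) (s≤s le) = Sparse⇒Gap d (Sparse-tail {suc r} {x} {l} s) j le
Sparse⇒Gap {r} {B} {x ∷ l} (cons p b d) s zero    le with ℕₚ.≤-<-connex (part (x ∷ l) (suc r) ℕ.+ 2) x
... | inj₁ ok  = ok
... | inj₂ bad = ⊥-elim (ℕₚ.<⇒≱ (s y) (window {y} (suc r) x≤sy (cons p ℕₚ.≤-refl d) le (λ _ → ℕₚ.≤-refl)))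
  where
  y : ℕ
  y = part (x ∷ l) (suc r)
  x≤sy : x ≤ suc y
  x≤sy = ℕ.s≤s⁻¹ (ℕₚ.≤-trans bad (ℕₚ.≤-reflexive (ℕₚ.+-comm y 2)))

allᵇ : (ℕ → Bool) → List ℕ → Bool
allᵇ c []       = true
allᵇ c (j ∷ js) = c j ∧ allᵇ c js

-- Identifies a function by its recursion equations alone, as needed for the local function of
-- `gapCond`.
allᵇ-unique : ∀ (g : List ℕ → Bool) c → g [] ≡ true → (∀ j js → g (j ∷ js) ≡ (c j ∧ g js)) → ∀ xs → g xs ≡ allᵇ c xs
allᵇ-unique g c base step []       = base
allᵇ-unique g c base step (j ∷ js) = ≡.trans (step j js) (cong (c j ∧_) (allᵇ-unique g c base step js))

gapAt : ℕ → List ℕ → ℕ → Bool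
gapAt r l j = if (j ℕ.+ r ∸ 1) ≤ᵇ length l then (part l (j ℕ.+ r ∸ 1) ℕ.+ 2 ≤ᵇ part l j) else true

gapCond≡ : ∀ r l → gapCond r l ≡ allᵇ (gapAt r l) (range1 (length l))
gapCond≡ r l = unfolded
  where
  -- The local function of gapCond has no name here; unification recovers it.
  go : List ℕ → Bool
  go = _
  unfolded : gapCond r l ≡ allᵇ (gapAt r l) (range1 (length l))
  unfolded with range1 (length l)
  ... | xs = allᵇ-unique go (gapAt r l) refl (λ _ _ → refl) xs

allᵇ⇒ : ∀ c xs → T (allᵇ c xs) → ∀ {x} → x ∈ xs → T (c x)
allᵇ⇒ c (x ∷ xs) t (here refl) = proj₁ (Equivalence.to T-∧ t)
allᵇ⇒ c (x ∷ xs) t (there p)   = allᵇ⇒ c xs (proj₂ (Equivalence.to T-∧ t)) p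

allᵇ⇐ : ∀ c xs → (∀ {x} → x ∈ xs → T (c x)) → T (allᵇ c xs)
allᵇ⇐ c []       p = _
allᵇ⇐ c (x ∷ xs) p = Equivalence.from T-∧ (p (here refl) , allᵇ⇐ c xs (p ∘ there))

gapAt⇒ : ∀ r l j → T (gapAt (suc r) l (suc j)) → suc j ℕ.+ r ≤ length l → part l (suc j ℕ.+ r) ℕ.+ 2 ≤ part l (suc j)
gapAt⇒ r l j t le rewrite ℕₚ.+-suc j r with suc (j ℕ.+ r) ≤ᵇ length l in eq
... | true  = ℕₚ.≤ᵇ⇒≤ _ _ t
... | false = ⊥-elim (subst T eq (ℕₚ.≤⇒≤ᵇ le))

gapAt⇐ : ∀ r l j → (suc j ℕ.+ r ≤ length l → part l (suc j ℕ.+ r) ℕ.+ 2 ≤ part l (suc j)) → T (gapAt (suc r) l (suc j))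
gapAt⇐ r l j g rewrite ℕₚ.+-suc j r with suc (j ℕ.+ r) ≤ᵇ length l in eq
... | true  = ℕₚ.≤⇒≤ᵇ (g (ℕₚ.≤ᵇ⇒≤ _ _ (Equivalence.from T-≡ eq)))
... | false = _

gapCond⇒Gap : ∀ r l → T (gapCond (suc r) l) → Gap r l
gapCond⇒Gap r l t j le = gapAt⇒ r l j
  (allᵇ⇒ _ _ (subst T (gapCond≡ (suc r) l) t) (range1-∈ (s≤s z≤n) (ℕₚ.≤-trans (ℕₚ.m≤m+n (suc j) r) le))) le

Gap⇒gapCond : ∀ r l → Gap r l → T (gapCond (suc r) l)
Gap⇒gapCond r l g = subst T (≡.sym (gapCond≡ (suc r) l)) (allᵇ⇐ _ _ at-each)
  where
  at-each : ∀ {x} → x ∈ range1 (length l) → T (gapAt (suc r) l x)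
  at-each {zero}  p = ⊥-elim (ℕₚ.<-irrefl refl (proj₁ (range1-bounds {length l} p)))
  at-each {suc j} _ = gapAt⇐ r l j (g j)

module GordonPartitions (M r : ℕ) where
  open Sums M
  open GeneratingFunctions M
  open Gordon M X X-nil
  open import Relation.Binary.Reasoning.Setoid setoid

  record Gordon≥ (N i : ℕ) (l : List ℕ) : Set where
    constructor gordon
    field
      {bound} : ℕ
      desc    : Desc bound l
      above   : All (N <_) l
      few     : count (suc N) l < i
      sparse  : Sparse r l

  absent : ∀ {N v l} → v ≤ N → All (N <_) l → count v l ≡ 0
  absent v≤N a = count-absent (All.map (λ { p refl → ℕₚ.<⇒≱ p v≤N }) a)

  module _ (N i p : ℕ) (r≡ : suc i ℕ.+ p ≡ r) where

    pad : List ℕ → List ℕ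
    pad μ = μ ++ replicate i (suc N)

    private
      forward : ∀ {l} → Gordon≥ N i l ⊎ (∃ λ μ → l ≡ pad μ × Gordon≥ (suc N) (suc p) μ) → Gordon≥ N (suc i) l
      forward (inj₁ (gordon d a f s)) = gordon d a (ℕₚ.m≤n⇒m≤1+n f) s
      forward (inj₂ (μ , refl , gordon d a f s)) = gordon
        (Desc-++-replicate d a i)
        (Allₚ.++⁺ (All.map (ℕₚ.<-trans ℕₚ.≤-refl) a) (Allₚ.replicate⁺ i ℕₚ.≤-refl))
        (s≤s (ℕₚ.≤-reflexive count-N))
        sparse′
        where
        count-N : count (suc N) (pad μ) ≡ i
        count-N = ≡.trans (count-++ (suc N) μ (replicate i (suc N))) (cong₂ ℕ._+_ (absent ℕₚ.≤-refl a) (count-replicate (suc N) i))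
        count-≢ : ∀ v → suc N ≢ v → count v (pad μ) ≡ count v μ
        count-≢ v ne = ≡.trans (count-++ v μ (replicate i (suc N))) (≡.trans (cong (count v μ ℕ.+_) (count-replicate-≢ v i ne)) (ℕₚ.+-identityʳ _))
        sparse′ : Sparse r (pad μ)
        -- Only the pairs containing N + 1 change. For v = N + 1 there are at most i + p < r parts;
        -- for v = N there is no part N, and i < r.
        sparse′ v with suc N ℕ.≟ v | N ℕ.≟ v
        ... | yes refl | _ rewrite count-N | count-≢ (suc (suc N)) (λ ()) =
              ℕₚ.≤-trans (s≤s (ℕₚ.+-monoʳ-≤ i (ℕ.s≤s⁻¹ f))) (ℕₚ.≤-reflexive r≡)
        ... | no ne | yes refl rewrite count-N | count-≢ N ne | absent {suc N} {N} (ℕₚ.n≤1+n N) a =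
              ℕₚ.≤-trans (ℕₚ.m≤m+n (suc i) p) (ℕₚ.≤-reflexive r≡)
        ... | no ne | no ne′ rewrite count-≢ v ne | count-≢ (suc v) (ne′ ∘ ℕₚ.suc-injective) = s v

      backward : ∀ {l} → Gordon≥ N (suc i) l → Gordon≥ N i l ⊎ (∃ λ μ → l ≡ pad μ × Gordon≥ (suc N) (suc p) μ)
      backward (gordon d a f s) with ℕₚ.m≤n⇒m<n∨m≡n (ℕ.s≤s⁻¹ f)
      ... | inj₁ f′ = inj₁ (gordon d a f′ s)
      ... | inj₂ eq with split-least d a
      ...   | μ , c , refl , a′ with ≡.trans (≡.sym (≡.trans (count-++ (suc N) μ (replicate c (suc N)))
                                        (cong₂ ℕ._+_ (absent ℕₚ.≤-refl a′) (count-replicate (suc N) c)))) eq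
      ...     | refl = inj₂ (μ , refl , gordon (Desc-++⁻ˡ μ d) a′ few′ sparse′)
        where
        count-≤ : ∀ v → count v μ ≤ count v (pad μ)
        count-≤ v = ℕₚ.≤-trans (ℕₚ.m≤m+n (count v μ) _) (ℕₚ.≤-reflexive (≡.sym (count-++ v μ (replicate i (suc N)))))
        sparse′ : Sparse r μ
        sparse′ v = ℕₚ.≤-<-trans (ℕₚ.+-mono-≤ (count-≤ v) (count-≤ (suc v))) (s v)
        few′ : count (suc (suc N)) μ < suc p
        -- Beside exactly i parts N + 1, sparseness leaves room for at most p parts N + 2. This is
        -- the origin of the new index p + 1.
        few′ = ℕₚ.+-cancelˡ-< i _ _ (ℕₚ.≤-<-trans (ℕₚ.+-mono-≤ (ℕₚ.≤-reflexive (≡.sym eq)) (count-≤ (suc (suc N))))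
                 (ℕₚ.<-≤-trans (s (suc N)) (ℕₚ.≤-reflexive (≡.trans (≡.sym r≡) (≡.sym (ℕₚ.+-suc i p))))))

      disjoint : ∀ {l} → Gordon≥ N i l → (∃ λ μ → l ≡ pad μ × Gordon≥ (suc N) (suc p) μ) → ⊥
      disjoint (gordon _ _ f _) (μ , refl , gordon _ _ _ _) =
        ℕₚ.<⇒≱ f (ℕₚ.≤-trans (ℕₚ.≤-trans (ℕₚ.≤-reflexive (≡.sym (count-replicate (suc N) i))) (ℕₚ.m≤n+m _ (count (suc N) μ)))
                  (ℕₚ.≤-reflexive (≡.sym (count-++ (suc N) μ (replicate i (suc N))))))

    gordon-step : ∀ {f g} → HasGF (Gordon≥ N i) f → HasGF (Gordon≥ (suc N) (suc p)) g →
                  HasGF (Gordon≥ N (suc i)) (f + X ^ (suc N ℕ.* i) * g)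
    gordon-step F G = gf-⇔ forward (λ s _ → backward s) (gf-⊎ disjoint F (gf-map pad (suc N ℕ.* i) (Listₚ.++-cancelʳ (replicate i (suc N)) _ _) sums G))
      where
      sums : ∀ μ → sum (pad μ) ≡ suc N ℕ.* i ℕ.+ sum μ
      sums μ = ≡.trans (sum-++ μ (replicate i (suc N))) (≡.trans (cong (sum μ ℕ.+_) (sum-replicate i (suc N))) (ℕₚ.+-comm (sum μ) _))

  -- The recursion is lexicographic in d = M - N and i: one term lowers i, while the other exchanges
  -- i and p but raises N.
  gordon-gf : ∀ d N → N ℕ.+ d ≡ M → ∀ i p → i ℕ.+ p ≡ r → HasGF (Gordon≥ N i) (P M * S i p N)
  gordon-gf d N eq zero p r≡ = gf-≈ (≈-sym (*-zero _ (S-zero p N))) (gf-∅ (λ { (gordon _ _ () _) }))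
  gordon-gf zero N eq (suc i) p r≡ rewrite ≡.trans (≡.sym (ℕₚ.+-identityʳ N)) eq =
    gf-≈ (≈-sym (≈-trans (*-congˡ (S-limit i p)) (≈-trans (*-comm _ _) (Q*P M))))
      (gf-⇔ (λ { refl → gordon {bound = 0} [] [] (s≤s z≤n) (λ _ → ℕₚ.≤-trans (s≤s z≤n) (ℕₚ.≤-reflexive r≡)) })
            (λ { (gordon _ a _ _) s≤M → sum-bounds a s≤M }) gf-[])
  gordon-gf (suc d) N eq (suc i) p r≡ = gf-≈ (begin
      P M * S i (suc p) N + X ^ (suc N ℕ.* i) * (P M * S (suc p) i (suc N))
        ≈⟨ solve 4 (λ p a x b → p :* a :+ x :* (p :* b) := p :* (a :+ x :* b)) ≈-refl (P M) (S i (suc p) N) (X ^ (suc N ℕ.* i)) (S (suc p) i (suc N)) ⟩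
      P M * (S i (suc p) N + X ^ (suc N ℕ.* i) * S (suc p) i (suc N))
        ≈⟨ *-congˡ (≈-sym (S-step i p N)) ⟩
      P M * S (suc i) p N ∎)
    (gordon-step N i p r≡
      (gordon-gf (suc d) N eq i (suc p) (≡.trans (ℕₚ.+-suc i p) r≡))
      (gordon-gf d (suc N) (≡.trans (≡.sym (ℕₚ.+-suc N d)) eq) (suc p) i (≡.trans (cong suc (ℕₚ.+-comm p i)) r≡)))

T-coeff : ∀ M i p → + T-count (suc i ℕ.+ p) (suc i) M ≡ GeneratingFunctions.gordonSeries M (suc i) p M
T-coeff M i p = count-coeff (T-cond r (suc i)) (gf-≈ (*-congˡ (S-theta (suc i) p)) (gordon-gf M 0 refl (suc i) p refl)) to from
  where
  r : ℕ
  r = suc i ℕ.+ p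
  open Sums M
  open GeneratingFunctions M
  open Bailey M X X-nil
  open Gordon M X X-nil
  open GordonPartitions M r
  positive : ∀ {B l} → Desc B l → All (0 <_) l
  positive []           = []
  positive (cons p _ d) = p ∷ positive d
  to : ∀ {l} → Desc M l → sum l ≡ M → T (T-cond r (suc i) l) → Gordon≥ 0 (suc i) l
  to {l} d _ t with Equivalence.to (T-∧ {gapCond r l}) t
  ... | g , f = gordon d (positive d) (subst (_< suc i) (onesCount≡ l) (ℕₚ.<ᵇ⇒< (onesCount l) (suc i) f)) (Gap⇒Sparse d (gapCond⇒Gap _ l g))
  from : ∀ {l} → Gordon≥ 0 (suc i) l → sum l ≡ M → (∃ λ B → Desc B l) × T (T-cond r (suc i) l)
  from {l} (gordon d _ f s) _ = (_ , d) , Equivalence.from (T-∧ {gapCond r l})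
    (Gap⇒gapCond _ l (Sparse⇒Gap d s) , ℕₚ.<⇒<ᵇ (subst (_< suc i) (≡.sym (onesCount≡ l)) f))

-- Partitions without parts congruent to 0, i or -i

excluded : ℕ → ℕ → ℕ → Bool
excluded r i x = (x % m ≡ᵇ 0) ∨ (x % m ≡ᵇ i % m) ∨ ((x ℕ.+ i) % m ≡ᵇ 0)
  where
  m = suc (r ℕ.+ r)

E-cond≡ : ∀ r i l → E-cond r i l ≡ allᵇ (not ∘ excluded r i) l
E-cond≡ r i []      = refl
E-cond≡ r i (x ∷ l) = cong (not (excluded r i x) ∧_) (E-cond≡ r i l)

≡ᵇ-≢ : ∀ {a b} → a ≢ b → (a ≡ᵇ b) ≡ false
≡ᵇ-≢ {zero}  {zero}  p = ⊥-elim (p refl)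
≡ᵇ-≢ {zero}  {suc b} p = refl
≡ᵇ-≢ {suc a} {zero}  p = refl
≡ᵇ-≢ {suc a} {suc b} p = ≡ᵇ-≢ (p ∘ cong suc)

≡ᵇ-refl : ∀ a → (a ≡ᵇ a) ≡ true
≡ᵇ-refl a = Equivalence.to T-≡ (ℕₚ.≡⇒≡ᵇ a a refl)

module ExcludedParts (M : ℕ) (bad : ℕ → Bool) where
  open Sums M
  open GeneratingFunctions M
  open import Relation.Binary.Reasoning.Setoid setoid

  Avoiding : ℕ → List ℕ → Set
  Avoiding B l = Desc B l × All (λ x → T (not (bad x))) l

  avoidingGF : ℕ → Series
  avoidingGF zero    = 1#
  avoidingGF (suc B) = if bad (suc B) then avoidingGF B else geo (suc B) * avoidingGF B

  excludedProduct : ℕ → Series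
  excludedProduct zero    = 1#
  excludedProduct (suc B) = if bad (suc B) then (1# - X ^ suc B) * excludedProduct B else excludedProduct B

  avoiding*Q : ∀ B → avoidingGF B * Q B ≈ excludedProduct B
  avoiding*Q zero    = *-identityˡ 1#
  avoiding*Q (suc B) with bad (suc B)
  ... | true  = ≈-trans (solve 3 (λ a b c → a :* (b :* c) := b :* (a :* c)) ≈-refl (avoidingGF B) (1# - X ^ suc B) (Q B)) (*-congˡ (avoiding*Q B))
  ... | false = begin
    (geo (suc B) * avoidingGF B) * ((1# - X ^ suc B) * Q B)
      ≈⟨ solve 4 (λ a b c d → (a :* b) :* (c :* d) := (c :* a) :* (b :* d)) ≈-refl (geo (suc B)) (avoidingGF B) (1# - X ^ suc B) (Q B) ⟩
    ((1# - X ^ suc B) * geo (suc B)) * (avoidingGF B * Q B)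
      ≈⟨ ≈-trans (*-cong (geo-inverse B) (avoiding*Q B)) (*-identityˡ _) ⟩
    excludedProduct B ∎

  avoidingGF≈ : ∀ B → avoidingGF B ≈ P B * excludedProduct B
  avoidingGF≈ B = begin
    avoidingGF B               ≈⟨ ≈-sym (≈-trans (*-congˡ (Q*P B)) (*-identityʳ _)) ⟩
    avoidingGF B * (Q B * P B) ≈⟨ solve 3 (λ a b c → a :* (b :* c) := c :* (a :* b)) ≈-refl (avoidingGF B) (Q B) (P B) ⟩
    P B * (avoidingGF B * Q B) ≈⟨ *-congˡ (avoiding*Q B) ⟩
    P B * excludedProduct B    ∎

  count≤length : ∀ v l → count v l ≤ length l
  count≤length v []      = z≤n
  count≤length v (x ∷ l) = ℕₚ.+-mono-≤ (hit≤1 x) (count≤length v l)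
    where
    hit≤1 : ∀ x → hit v x ≤ 1
    hit≤1 x with x ≡ᵇ v
    ... | true  = ℕₚ.≤-refl
    ... | false = z≤n

  module _ (B : ℕ) (good : T (not (bad (suc B)))) {f} (F : HasGF (Avoiding B) f) where

    bounded-gf : ∀ c → HasGF (λ l → Avoiding (suc B) l × count (suc B) l < c) (∑ c (λ j → X ^ (suc B ℕ.* j)) * f)
    bounded-gf zero    = gf-≈ (≈-sym (zeroˡ f)) (gf-∅ (λ ()))
    bounded-gf (suc c) = gf-≈ sums (gf-⇔ forward (λ s _ → backward s) (gf-⊎ disjoint F (gf-cons (suc B) (bounded-gf c))))
      where
      Rest : List ℕ → Set
      Rest l = ∃ λ l′ → l ≡ suc B ∷ l′ × (Avoiding (suc B) l′ × count (suc B) l′ < c)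
      sums : f + X ^ suc B * (∑ c (λ j → X ^ (suc B ℕ.* j)) * f) ≈ ∑ (suc c) (λ j → X ^ (suc B ℕ.* j)) * f
      sums = begin
        f + X ^ suc B * (∑ c (λ j → X ^ (suc B ℕ.* j)) * f)
          ≈⟨ solve 3 (λ f x s → f :+ x :* (s :* f) := (con 1ℤ :+ x :* s) :* f) ≈-refl f (X ^ suc B) _ ⟩
        (1# + X ^ suc B * ∑ c (λ j → X ^ (suc B ℕ.* j))) * f
          ≈⟨ *-congʳ (+-cong (q^≡ (≡.sym (ℕₚ.*-zeroʳ (suc B)))) (≈-trans (≈-sym (∑-*ˡ c _ _))
               (∑-cong c (λ j → ≈-trans (≈-sym (q^+ (suc B) (suc B ℕ.* j))) (q^≡ (≡.sym (ℕₚ.*-suc (suc B) j))))))) ⟩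
        (X ^ (suc B ℕ.* 0) + ∑ c (λ j → X ^ (suc B ℕ.* suc j))) * f
          ≈⟨ *-congʳ (≈-sym (∑-head c (λ j → X ^ (suc B ℕ.* j)))) ⟩
        ∑ (suc c) (λ j → X ^ (suc B ℕ.* j)) * f ∎
      absent : ∀ {l} → Desc B l → count (suc B) l ≡ 0
      absent d = count-absent (All.map (λ { p refl → ℕₚ.<-irrefl refl p }) (Desc-bounded d))
      forward : ∀ {l} → Avoiding B l ⊎ Rest l → Avoiding (suc B) l × count (suc B) l < suc c
      forward (inj₁ (d , a)) = (Desc-mono (ℕₚ.n≤1+n B) d , a) , s≤s (ℕₚ.≤-trans (ℕₚ.≤-reflexive (absent d)) z≤n)
      forward (inj₂ (l , refl , ((d , a) , p))) = (cons (s≤s z≤n) ℕₚ.≤-refl d , good ∷ a) ,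
        ℕₚ.≤-trans (s≤s (ℕₚ.≤-reflexive (cong (ℕ._+ count (suc B) l) (hit-self (suc B))))) (s≤s p)
      backward : ∀ {l} → Avoiding (suc B) l × count (suc B) l < suc c → Avoiding B l ⊎ Rest l
      backward {[]} _ = inj₁ ([] , [])
      backward {x ∷ l} ((cons p r d , g ∷ a) , q) with ℕₚ.m≤n⇒m<n∨m≡n r
      ... | inj₁ (s≤s x≤B) = inj₁ (cons p x≤B d , g ∷ a)
      ... | inj₂ refl = inj₂ (l , refl , (d , a) , ℕ.s≤s⁻¹ (ℕₚ.≤-trans (s≤s (ℕₚ.≤-reflexive (cong (ℕ._+ count (suc B) l) (≡.sym (hit-self (suc B)))))) q))
      disjoint : ∀ {l} → Avoiding B l → Rest l → ⊥
      disjoint (cons _ r _ , _) (_ , refl , _) = ℕₚ.<-irrefl refl r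

  avoiding-gf : ∀ B → HasGF (Avoiding B) (avoidingGF B)
  avoiding-gf zero = gf-⇔ (λ { refl → [] , [] }) (λ { ([] , _) _ → refl ; (cons p r _ , _) _ → ⊥-elim (ℕₚ.<-irrefl refl (ℕₚ.≤-trans p r)) }) gf-[]
  avoiding-gf (suc B) with bad (suc B) in eq
  ... | true  = gf-⇔ (λ { (d , a) → Desc-mono (ℕₚ.n≤1+n B) d , a }) (λ s _ → shrink s) (avoiding-gf B)
    where
    shrink : ∀ {l} → Avoiding (suc B) l → Avoiding B l
    shrink ([] , a) = [] , a
    shrink (cons p r d , g ∷ a) with ℕₚ.m≤n⇒m<n∨m≡n r
    ... | inj₁ (s≤s x≤B) = cons p x≤B d , g ∷ a
    ... | inj₂ refl = ⊥-elim (subst (T ∘ not) eq g)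
  -- A partition of at most M has at most M parts, so the multiplicity bound `suc M` loses nothing
  -- in the relevant degrees and makes the factor equal to `geo`.
  ... | false = gf-⇔ proj₁ (λ { {l} (d , a) s≤M → (d , a) , s≤s (ℕₚ.≤-trans (count≤length (suc B) l) (ℕₚ.≤-trans (Desc-length d) s≤M)) })
                  (bounded-gf B (subst (T ∘ not) (≡.sym eq) _) (avoiding-gf B) (suc M))

  product-good : ∀ B g → (∀ j → j < g → bad (suc (B ℕ.+ j)) ≡ false) → excludedProduct (B ℕ.+ g) ≈ excludedProduct B
  product-good B zero    p = reflexive (cong excludedProduct (ℕₚ.+-identityʳ B))
  product-good B (suc g) p rewrite ℕₚ.+-suc B g | p g ℕₚ.≤-refl = product-good B g (λ j j<g → p j (ℕₚ.m≤n⇒m≤1+n j<g))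

  product-run : ∀ B g {E} → E ≡ suc (B ℕ.+ g) → (∀ j → j < g → bad (suc (B ℕ.+ j)) ≡ false) → bad E ≡ true →
                excludedProduct E ≈ (1# - X ^ E) * excludedProduct B
  product-run B g refl p b rewrite b = *-congˡ (product-good B g p)

module _ (i′ p : ℕ) where
  private
    i r m : ℕ
    i = suc i′
    r = i ℕ.+ p
    m = suc (r ℕ.+ r)

    bad : ℕ → Bool
    bad = excluded r i

    i<m : i < m
    i<m = s≤s (ℕₚ.≤-trans (ℕₚ.m≤m+n i p) (ℕₚ.m≤m+n r r))

    residue : ∀ o L → o < m → (o ℕ.+ L ℕ.* m) % m ≡ o
    residue o L o<m = ≡.trans ([m+kn]%n≡m%n o L m) (m<n⇒m%n≡m o<m)

    multiple : ∀ L → (L ℕ.* m) % m ≡ 0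
    multiple L = m*n%n≡0 L m

    m≡ : ∀ i p → suc ((i ℕ.+ p) ℕ.+ (i ℕ.+ p)) ≡ i ℕ.+ suc (i ℕ.+ (p ℕ.+ p))
    m≡ = ℕ-solve

    -- o and o′ are the residues of x and x + i.
    not-bad : ∀ {x} o o′ L L′ → x ≡ o ℕ.+ L ℕ.* m → x ℕ.+ i ≡ o′ ℕ.+ L′ ℕ.* m → o < m → o′ < m →
              o ≢ 0 → o ≢ i → o′ ≢ 0 → bad x ≡ false
    not-bad {x} o o′ L L′ e e′ o<m o′<m a b c
      rewrite ≡.trans (cong (_% m) e) (residue o L o<m) | ≡.trans (cong (_% m) e′) (residue o′ L′ o′<m)
            | m<n⇒m%n≡m i<m | ≡ᵇ-≢ a | ≡ᵇ-≢ b | ≡ᵇ-≢ c = refl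

    bad-i : ∀ L → bad (i ℕ.+ L ℕ.* m) ≡ true
    bad-i L rewrite residue i L i<m | m<n⇒m%n≡m i<m | ≡ᵇ-refl i = refl

    bad-0 : ∀ L → bad (L ℕ.* m) ≡ true
    bad-0 L rewrite multiple L = refl

    bad--i : ∀ {x} L → x ℕ.+ i ≡ L ℕ.* m → bad x ≡ true
    bad--i {x} L e rewrite cong (_% m) e | multiple L = ≡.trans (cong ((x % m ≡ᵇ 0) ∨_) (∨-zeroʳ _)) (∨-zeroʳ _)

    small : ∀ {j} → j < i′ → suc j ℕ.+ i < m
    small {j} j<i′ = ℕₚ.≤-trans (s≤s (ℕₚ.+-monoˡ-≤ i j<i′))
      (s≤s (ℕₚ.+-mono-≤ (ℕₚ.≤-trans (ℕₚ.n≤1+n i′) (ℕₚ.m≤m+n i p)) (ℕₚ.m≤m+n i p)))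

    low-good : ∀ L j → j < i′ → bad (suc (L ℕ.* m ℕ.+ j)) ≡ false
    low-good L j j<i′ = not-bad (suc j) (suc j ℕ.+ i) L L (e₁ (L ℕ.* m) j) (e₂ (L ℕ.* m) j i)
      (ℕₚ.<-trans (s≤s j<i′) i<m) (small j<i′) (λ ()) (λ { refl → ℕₚ.<-irrefl refl j<i′ }) (λ ())
      where
      e₁ : ∀ a j → suc (a ℕ.+ j) ≡ suc j ℕ.+ a
      e₁ = ℕ-solve
      e₂ : ∀ a j i → suc (a ℕ.+ j) ℕ.+ i ≡ suc j ℕ.+ i ℕ.+ a
      e₂ = ℕ-solve

    mid-good : ∀ L j → j < p ℕ.+ p → bad (suc (i ℕ.+ L ℕ.* m ℕ.+ j)) ≡ false
    mid-good L j j<2p = not-bad (suc (i ℕ.+ j)) (suc (i ℕ.+ j) ℕ.+ i) L L (e₁ i (L ℕ.* m) j) (e₂ i (L ℕ.* m) j)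
      (ℕₚ.≤-<-trans (ℕₚ.m≤m+n (suc (i ℕ.+ j)) i) bound) bound (λ ()) (λ e → ℕₚ.<-irrefl (≡.sym e) (s≤s (ℕₚ.m≤m+n i j))) (λ ())
      where
      e₁ : ∀ i a j → suc (i ℕ.+ a ℕ.+ j) ≡ suc (i ℕ.+ j) ℕ.+ a
      e₁ = ℕ-solve
      e₂ : ∀ i a j → suc (i ℕ.+ a ℕ.+ j) ℕ.+ i ≡ suc (i ℕ.+ j) ℕ.+ i ℕ.+ a
      e₂ = ℕ-solve
      e₃ : ∀ i j → suc (suc (i ℕ.+ j) ℕ.+ i) ≡ suc (i ℕ.+ i ℕ.+ suc j)
      e₃ = ℕ-solve
      e₄ : ∀ i p → suc (i ℕ.+ i ℕ.+ (p ℕ.+ p)) ≡ suc ((i ℕ.+ p) ℕ.+ (i ℕ.+ p))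
      e₄ = ℕ-solve
      bound : suc (i ℕ.+ j) ℕ.+ i < m
      bound = ℕₚ.≤-trans (ℕₚ.≤-reflexive (e₃ i j)) (ℕₚ.≤-trans (s≤s (ℕₚ.+-monoʳ-≤ (i ℕ.+ i) j<2p)) (ℕₚ.≤-reflexive (e₄ i p)))

    -- The residue of -i. It exceeds i, so the three excluded classes are distinct and each gives
    -- one factor per period.
    y₀ : ℕ
    y₀ = suc (i ℕ.+ (p ℕ.+ p))

    high-good : ∀ L j → j < i′ → bad (suc (y₀ ℕ.+ L ℕ.* m ℕ.+ j)) ≡ false
    high-good L j j<i′ = not-bad (suc (y₀ ℕ.+ j)) (suc j) L (suc L) (e₁ y₀ (L ℕ.* m) j)
      (≡.trans (e₂ y₀ (L ℕ.* m) j i) (cong (λ k → suc j ℕ.+ (k ℕ.+ L ℕ.* m)) (≡.trans (ℕₚ.+-comm y₀ i) (≡.sym (m≡ i p)))))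
      (ℕₚ.≤-trans (s≤s (ℕₚ.≤-reflexive (≡.sym (ℕₚ.+-suc y₀ j)))) (ℕₚ.≤-trans (s≤s (ℕₚ.+-monoʳ-≤ y₀ j<i′)) (ℕₚ.≤-reflexive (≡.trans (≡.sym (ℕₚ.+-suc y₀ i′)) (≡.trans (ℕₚ.+-comm y₀ i) (≡.sym (m≡ i p)))))))
      (ℕₚ.<-trans (s≤s j<i′) i<m) (λ ()) (λ e → ℕₚ.<-irrefl (≡.sym e) (s≤s (ℕₚ.≤-trans (ℕₚ.m≤n⇒m≤1+n (ℕₚ.m≤m+n i (p ℕ.+ p))) (ℕₚ.m≤m+n y₀ j)))) (λ ())
      where
      e₁ : ∀ y a j → suc (y ℕ.+ a ℕ.+ j) ≡ suc (y ℕ.+ j) ℕ.+ a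
      e₁ = ℕ-solve
      e₂ : ∀ y a j i → suc (y ℕ.+ a ℕ.+ j) ℕ.+ i ≡ suc j ℕ.+ ((y ℕ.+ i) ℕ.+ a)
      e₂ = ℕ-solve

  module _ (M : ℕ) where
    open Sums M
    open GeneratingFunctions M hiding (Q; P)
    open GeneratingFunctions M using () renaming (P to Pₓ)
    open Bailey M X X-nil using (Θ)
    open ExcludedParts M bad
    open import Relation.Binary.Reasoning.Setoid setoid
    private
      z y : Series
      z = X ^ i
      y = X ^ y₀

      zy : z * y ≈ X ^ m
      zy = ≈-trans (≈-sym (q^+ i y₀)) (q^≡ (≡.sym (m≡ i p)))

      pow-nil : ∀ k {n} → M < n → (X ^ suc k) ^ n ≈ 0#
      pow-nil k {n} M<n = ≈-trans (^-assocʳ X (suc k) n) (X-nil (ℕₚ.≤-trans M<n (ℕₚ.m≤m+n n (k ℕ.* n))))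

      w-nil : ∀ {n} → M < n → (z * y) ^ n ≈ 0#
      w-nil {n} M<n = ≈-trans (^-congˡ n zy) (pow-nil (r ℕ.+ r) M<n)

    open TripleProduct M z y w-nil (pow-nil (i ℕ.+ (p ℕ.+ p))) using (w; θ; product; factor; triple-product)
    open Base w w-nil using (Q)

    private
      w^ : ∀ n → w ^ n ≈ X ^ (n ℕ.* m)
      w^ n = ≈-trans (^-congˡ n zy) (≈-trans (^-assocʳ X m n) (q^≡ (ℕₚ.*-comm m n)))

    -- The cut is made just after a number congruent to i. The next period then adds 1 - y w^L, 1 -
    -- w^(L+1) and 1 - z w^(L+1): `factor L` and one factor of `Q`.
    excluded≈product : ∀ L → excludedProduct (i ℕ.+ L ℕ.* m) ≈ Q L * product L
    excluded≈product zero = begin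
      excludedProduct (i ℕ.+ 0)       ≈⟨ product-run 0 i′ (ℕₚ.+-identityʳ i) (low-good 0) (bad-i 0) ⟩
      (1# - X ^ (i ℕ.+ 0)) * 1#       ≈⟨ *-congʳ (+-congˡ (-‿cong (q^≡ (ℕₚ.+-identityʳ i)))) ⟩
      (1# - z) * 1#                   ≈⟨ *-comm _ _ ⟩
      1# * (1# - z)                   ∎
    excluded≈product (suc L) = begin
      excludedProduct (i ℕ.+ suc L ℕ.* m)
        ≈⟨ product-run (suc L ℕ.* m) i′ (≡.trans (ℕₚ.+-comm i (suc L ℕ.* m)) (ℕₚ.+-suc (suc L ℕ.* m) i′)) (low-good (suc L)) (bad-i (suc L)) ⟩
      (1# - X ^ (i ℕ.+ suc L ℕ.* m)) * excludedProduct (suc L ℕ.* m)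
        ≈⟨ *-congˡ (product-run (y₀ ℕ.+ L ℕ.* m) i′ e₁ (high-good L) (bad-0 (suc L))) ⟩
      (1# - X ^ (i ℕ.+ suc L ℕ.* m)) * ((1# - X ^ (suc L ℕ.* m)) * excludedProduct (y₀ ℕ.+ L ℕ.* m))
        ≈⟨ *-congˡ (*-congˡ (product-run (i ℕ.+ L ℕ.* m) (p ℕ.+ p) (e₂ i p (L ℕ.* m)) (mid-good L) (bad--i {y₀ ℕ.+ L ℕ.* m} (suc L) e₃))) ⟩
      (1# - X ^ (i ℕ.+ suc L ℕ.* m)) * ((1# - X ^ (suc L ℕ.* m)) * ((1# - X ^ (y₀ ℕ.+ L ℕ.* m)) * excludedProduct (i ℕ.+ L ℕ.* m)))
        ≈⟨ *-cong (+-congˡ (-‿cong (≈-trans (q^+ i (suc L ℕ.* m)) (*-congˡ (≈-sym (w^ (suc L)))))))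
             (*-cong (+-congˡ (-‿cong (≈-sym (w^ (suc L)))))
               (*-cong (+-congˡ (-‿cong (≈-trans (q^+ y₀ (L ℕ.* m)) (*-congˡ (≈-sym (w^ L)))))) (excluded≈product L))) ⟩
      (1# - z * w ^ suc L) * ((1# - w ^ suc L) * ((1# - y * w ^ L) * (Q L * product L)))
        ≈⟨ solve 5 (λ a b c d e → a :* (b :* (c :* (d :* e))) := (b :* d) :* ((a :* c) :* e)) ≈-refl (1# - z * w ^ suc L) (1# - w ^ suc L) (1# - y * w ^ L) (Q L) (product L) ⟩
      ((1# - w ^ suc L) * Q L) * (((1# - z * w ^ suc L) * (1# - y * w ^ L)) * product L) ∎
      where
      ei : ∀ y i a → i ℕ.+ y ℕ.+ a ≡ y ℕ.+ a ℕ.+ i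
      ei = ℕ-solve
      e₃ : y₀ ℕ.+ L ℕ.* m ℕ.+ i ≡ suc L ℕ.* m
      e₃ = ≡.trans (≡.sym (ei y₀ i (L ℕ.* m))) (cong (ℕ._+ L ℕ.* m) (≡.sym (m≡ i p)))
      e₁ : suc L ℕ.* m ≡ suc (y₀ ℕ.+ L ℕ.* m ℕ.+ i′)
      e₁ = ≡.trans (≡.sym e₃) (ℕₚ.+-suc (y₀ ℕ.+ L ℕ.* m) i′)
      e₂ : ∀ i p a → suc (i ℕ.+ (p ℕ.+ p)) ℕ.+ a ≡ suc (i ℕ.+ a ℕ.+ (p ℕ.+ p))
      e₂ = ℕ-solve

    -- The exponents agree because 2 tri n = n (n + 1) and tri n + tri₋ n = n^2.
    θ≈Θ : ∀ n → θ n ≈ Θ i p n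
    θ≈Θ n = begin
      sgn n * (y ^ tri n * (z ^ tri₋ n - z ^ tri (suc n)))
        ≈⟨ *-congˡ (*-cong (^-assocʳ X y₀ (tri n)) (+-cong (^-assocʳ X i (tri₋ n))
             (-‿cong (≈-trans (^-assocʳ X i (tri (suc n))) (≈-trans (q^≡ (≡.trans (cong (λ t → i ℕ.* (suc n ℕ.+ t)) (tri-tri₋ n)) (e₁ i n (tri₋ n)))) (q^+ (i ℕ.* tri₋ n) (i ℕ.* suc (n ℕ.+ n)))))))) ⟩
      sgn n * (X ^ (y₀ ℕ.* tri n) * (A - A * D))
        ≈⟨ solve 4 (λ s b a d → s :* (b :* (a :- a :* d)) := (b :* a) :* (s :* (con 1ℤ :- d))) ≈-refl (sgn n) (X ^ (y₀ ℕ.* tri n)) A D ⟩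
      (X ^ (y₀ ℕ.* tri n) * A) * (sgn n * (1# - D))
        ≈⟨ *-congʳ (≈-trans (≈-sym (q^+ (y₀ ℕ.* tri n) (i ℕ.* tri₋ n))) (≈-trans (q^≡ expo) (q^+ (p ℕ.* (n ℕ.* (n ℕ.+ 1))) (tri n ℕ.+ i ℕ.* (n ℕ.* n))))) ⟩
      (X ^ (p ℕ.* (n ℕ.* (n ℕ.+ 1))) * X ^ (tri n ℕ.+ i ℕ.* (n ℕ.* n))) * (sgn n * (1# - D))
        ≈⟨ solve 4 (λ b a s d → (b :* a) :* (s :* d) := b :* (s :* (a :* d))) ≈-refl (X ^ (p ℕ.* (n ℕ.* (n ℕ.+ 1)))) (X ^ (tri n ℕ.+ i ℕ.* (n ℕ.* n))) (sgn n) (1# - D) ⟩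
      Θ i p n ∎
      where
      A D : Series
      A = X ^ (i ℕ.* tri₋ n)
      D = X ^ (i ℕ.* suc (n ℕ.+ n))
      e₁ : ∀ i n a → i ℕ.* (suc n ℕ.+ (n ℕ.+ a)) ≡ i ℕ.* a ℕ.+ i ℕ.* suc (n ℕ.+ n)
      e₁ = ℕ-solve
      e₂ : ∀ i p t a → suc (i ℕ.+ (p ℕ.+ p)) ℕ.* t ℕ.+ i ℕ.* a ≡ p ℕ.* (t ℕ.+ t) ℕ.+ (t ℕ.+ i ℕ.* (t ℕ.+ a))
      e₂ = ℕ-solve
      e₃ : ∀ n a → (n ℕ.+ a) ℕ.+ (n ℕ.+ a) ≡ n ℕ.+ ((n ℕ.+ a) ℕ.+ a)
      e₃ = ℕ-solve
      e₄ : ∀ n → n ℕ.* (n ℕ.+ 1) ≡ n ℕ.+ n ℕ.* n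
      e₄ = ℕ-solve
      square : tri n ℕ.+ tri₋ n ≡ n ℕ.* n
      square = ℕₚ.+-cancelˡ-≡ n _ _ (≡.trans (cong (λ t → n ℕ.+ (t ℕ.+ tri₋ n)) (tri-tri₋ n)) (≡.trans (≡.sym (e₃ n (tri₋ n)))
                 (≡.trans (≡.sym (cong₂ ℕ._+_ (tri-tri₋ n) (tri-tri₋ n))) (≡.trans (double-tri n) (e₄ n)))))
      expo : y₀ ℕ.* tri n ℕ.+ i ℕ.* tri₋ n ≡ p ℕ.* (n ℕ.* (n ℕ.+ 1)) ℕ.+ (tri n ℕ.+ i ℕ.* (n ℕ.* n))
      expo = ≡.trans (e₂ i p (tri n) (tri₋ n)) (cong₂ ℕ._+_ (cong (p ℕ.*_) (double-tri n)) (cong (λ k → tri n ℕ.+ i ℕ.* k) square))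

    E-coeff : + E-count r i M ≡ gordonSeries i p M
    E-coeff = count-coeff (E-cond r i) (gf-≈ value (avoiding-gf B)) to from
      where
      B : ℕ
      -- The cut-off has the form required by `excluded≈product`, with the number of periods at
      -- which the triple product is stable.
      B = i ℕ.+ (M ℕ.+ M) ℕ.* m
      M≤B : M ≤ B
      M≤B = ℕₚ.≤-trans (ℕₚ.≤-trans (ℕₚ.m≤m+n M M) (ℕₚ.m≤m*n (M ℕ.+ M) m)) (ℕₚ.m≤n+m _ i)
      value : avoidingGF B ≈ Pₓ M * ∑ (suc M) (Θ i p)
      value = begin
        avoidingGF B                              ≈⟨ avoidingGF≈ B ⟩
        Pₓ B * excludedProduct B                  ≈⟨ *-cong (P-stable M≤B) (excluded≈product (M ℕ.+ M)) ⟩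
        Pₓ M * (Q (M ℕ.+ M) * product (M ℕ.+ M)) ≈⟨ *-congˡ (≈-trans triple-product (∑-cong (suc M) θ≈Θ)) ⟩
        Pₓ M * ∑ (suc M) (Θ i p) ∎
      to : ∀ {l} → Desc M l → sum l ≡ M → T (E-cond r i l) → Avoiding B l
      to {l} d _ t = Desc-mono M≤B d , All.tabulate (allᵇ⇒ (not ∘ bad) l (subst T (E-cond≡ r i l) t))
      from : ∀ {l} → Avoiding B l → sum l ≡ M → (∃ λ B → Desc B l) × T (E-cond r i l)
      from {l} (d , a) _ = (B , d) , subst T (≡.sym (E-cond≡ r i l)) (allᵇ⇐ (not ∘ bad) l (All.lookup a))

-- Partitions covered by blocks

-- The word is read from the largest part on. A block of n parts at level a has parts at least n +
-- a: its diagram contains an n by n square for a = 0, an n by n + 1 rectangle for a = 1. Blocks may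
-- be empty.
Cover : List ℕ → List ℕ → Set
Cover []      l = l ≡ []
Cover (a ∷ w) l = ∃₂ λ α β → l ≡ α ++ β × All (length α ℕ.+ a ≤_) α × Cover w β

Cover-[] : ∀ w → Cover w []
Cover-[] []      = refl
Cover-[] (a ∷ w) = [] , [] , refl , [] , Cover-[] w

-- The first non-empty block gets shorter, which weakens its condition. `widen` needs this when the
-- first block takes over a part from the rest.
Cover-tail : ∀ w {x l} → Cover w (x ∷ l) → Cover w l
Cover-tail (a ∷ w) ([]    , β , refl , _      , c) = [] , _ , refl , [] , Cover-tail w c
Cover-tail (a ∷ w) (x ∷ α , β , refl , _ ∷ ps , c) = α , β , refl , All.map (ℕₚ.≤-trans (ℕₚ.n≤1+n _)) ps , c

take-++ : ∀ n (xs ys : List ℕ) → take n (xs ++ ys) ≡ take n xs ++ take (n ∸ length xs) ys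
take-++ n       []       ys = cong (_++ take n ys) (≡.sym (Listₚ.take-[] n))
take-++ zero    (x ∷ xs) ys = refl
take-++ (suc n) (x ∷ xs) ys = cong (x ∷_) (take-++ n xs ys)

Cover-take : ∀ w n {l} → Cover w l → Cover w (take n l)
Cover-take []      n refl = Listₚ.take-[] n
Cover-take (a ∷ w) n (α , β , refl , ps , c) = take n α , take (n ∸ length α) β , take-++ n α β ,
  All.map (ℕₚ.≤-trans (ℕₚ.+-monoˡ-≤ a (ℕₚ.≤-trans (ℕₚ.≤-reflexive (Listₚ.length-take n α)) (ℕₚ.m⊓n≤n n (length α))))) (Allₚ.take⁺ n ps) ,
  Cover-take w (n ∸ length α) c

Cover-∷ʳ⇒ : ∀ w {a l} → Cover (w ++ a ∷ []) l → ∃₂ λ γ δ → l ≡ γ ++ δ × Cover w γ × All (length δ ℕ.+ a ≤_) δ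
Cover-∷ʳ⇒ []      (α , _ , refl , ps , refl) = [] , α , Listₚ.++-identityʳ α , refl , ps
Cover-∷ʳ⇒ (b ∷ w) (α , β , refl , ps , c) with Cover-∷ʳ⇒ w c
... | γ , δ , refl , c′ , qs = α ++ γ , δ , ≡.sym (Listₚ.++-assoc α γ δ) , (α , γ , refl , ps , c′) , qs

Cover-∷ʳ⇐ : ∀ w {a} γ δ → Cover w γ → All (length δ ℕ.+ a ≤_) δ → Cover (w ++ a ∷ []) (γ ++ δ)
Cover-∷ʳ⇐ []      γ δ refl qs = δ , [] , ≡.sym (Listₚ.++-identityʳ δ) , qs , refl
Cover-∷ʳ⇐ (b ∷ w) γ δ (α , β , refl , ps , c) qs = α , β ++ δ , Listₚ.++-assoc α β δ , ps , Cover-∷ʳ⇐ w β δ c qs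

-- A part 1 in a block of n parts forces n + a ≤ 1, so n = 1 and a = 0. Over all blocks this bounds
-- the ones by the i - 1 zeros of `word`, as `C-cond` asks.
ones-block : ∀ a α → All (length α ℕ.+ a ≤_) α → count 1 α ≤ hit 0 a
ones-block a       []          _ = z≤n
ones-block zero    (x ∷ [])    _ with x ≡ᵇ 1
... | true  = ℕₚ.≤-refl
... | false = z≤n
ones-block zero    (x ∷ y ∷ α) ps = ℕₚ.≤-trans (ℕₚ.≤-reflexive (count-absent {1} (All.map (λ { (s≤s ()) refl }) ps))) z≤n
ones-block (suc a) (x ∷ α)     ps = ℕₚ.≤-reflexive (count-absent {1} (All.map (λ { {y} p refl → ℕₚ.<⇒≱ (s≤s z≤n) (ℕ.s≤s⁻¹ (ℕₚ.≤-trans (s≤s (ℕₚ.m≤n+m (suc a) (length α))) p)) }) ps))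

Cover-ones : ∀ w {l} → Cover w l → count 1 l ≤ count 0 w
Cover-ones []      refl = z≤n
Cover-ones (a ∷ w) (α , β , refl , ps , c) = ℕₚ.≤-trans (ℕₚ.≤-reflexive (count-++ 1 α β)) (ℕₚ.+-mono-≤ (ones-block a α ps) (Cover-ones w c))

Desc-++⁻ʳ : ∀ {B} l {l′} → Desc B (l ++ l′) → Desc B l′
Desc-++⁻ʳ []      d            = d
Desc-++⁻ʳ (x ∷ l) (cons p r d) = Desc-mono r (Desc-++⁻ʳ l d)

Desc-above : ∀ {B} α {x β} → Desc B (α ++ x ∷ β) → All (x ≤_) α
Desc-above []      d            = []
Desc-above (y ∷ α) (cons p r d) = below α d ∷ Desc-above α d
  where
  below : ∀ {B} α {x β} → Desc B (α ++ x ∷ β) → x ≤ B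
  below []      (cons _ r _) = r
  below (z ∷ α) (cons _ r d) = ℕₚ.≤-trans (below α d) r

-- A maximal first block makes the block lengths, hence the decomposition, unique.
widen : ∀ {B} w a α β → Desc B (α ++ β) → All (length α ℕ.+ a ≤_) α → Cover w β →
        ∃₂ λ α′ β′ → α ++ β ≡ α′ ++ β′ × All (length α′ ℕ.+ a ≤_) α′ × Desc (length α′ ℕ.+ a) β′ × Cover w β′
widen w a α []      d ps c = α , [] , refl , ps , [] , c
widen w a α (x ∷ β) d ps c with ℕₚ.≤-<-connex x (length α ℕ.+ a)
... | inj₁ x≤ with Desc-++⁻ʳ α d
...   | cons p r d′ = α , x ∷ β , refl , ps , cons p x≤ d′ , c
widen {B} w a α (x ∷ β) d ps c | inj₂ x> with widen {B} w a (α ++ x ∷ []) β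
    (subst (Desc B) (≡.sym (Listₚ.++-assoc α (x ∷ []) β)) d)
    (subst (λ k → All (k ℕ.+ a ≤_) (α ++ x ∷ [])) (≡.sym (≡.trans (Listₚ.length-++ α) (ℕₚ.+-comm (length α) 1)))
      (Allₚ.++⁺ (All.map (ℕₚ.≤-trans x>) (Desc-above α d)) (x> ∷ [])))
    (Cover-tail w c)
... | α′ , β′ , e , rest = α′ , β′ , ≡.trans (≡.sym (Listₚ.++-assoc α (x ∷ []) β)) e , rest

-- N parts between lo and lo + w, followed by a list in S. The excesses over lo form a partition in
-- an N by w box, which is what the Gaussian binomial counts.
data Box (lo : ℕ) (S : List ℕ → Set) : ℕ → ℕ → List ℕ → Set where
  done : ∀ {w l} → S l → Box lo S w 0 l
  put  : ∀ {w e N x l} → x ≡ lo ℕ.+ e → e ≤ w → Box lo S e N l → Box lo S w (suc N) (x ∷ l)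

Block : ℕ → (ℕ → List ℕ → Set) → ℕ → List ℕ → Set
Block c S b l = ∃ λ N → N < suc b × Box (N ℕ.+ c) (S N) (b ∸ N) N l

-- Where the shorter box ends, S allows parts at most lo, while the longer box still demands a part
-- at least lo′ > lo.
Box-disjoint : ∀ {lo lo′ S S′ w w′ N N′ l} → (∀ {x l} → S (x ∷ l) → x ≤ lo) → lo < lo′ → N < N′ →
               Box lo S w N l → Box lo′ S′ w′ N′ l → ⊥
Box-disjoint h lo< (s≤s _) (done s) (put {e = e} refl _ _) = ℕₚ.<⇒≱ lo< (ℕₚ.≤-trans (ℕₚ.m≤m+n _ e) (h s))
Box-disjoint h lo< (s≤s N<) (put _ _ b) (put _ _ b′) = Box-disjoint h lo< N< b b′

Block-unique : ∀ {c} {S : ℕ → List ℕ → Set} {b m n l} → (∀ N {x l} → S N (x ∷ l) → x ≤ N ℕ.+ c) →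
               Box (m ℕ.+ c) (S m) (b ∸ m) m l → Box (n ℕ.+ c) (S n) (b ∸ n) n l → m ≡ n
Block-unique {c} {_} {_} {m} {n} h p q with ℕₚ.<-cmp m n
... | tri< m<n _ _ = ⊥-elim (Box-disjoint (h m) (ℕₚ.+-monoˡ-< c m<n) m<n p q)
... | tri≈ _ e _   = e
... | tri> _ _ n<m = ⊥-elim (Box-disjoint (h n) (ℕₚ.+-monoˡ-< c n<m) n<m q p)

Box-Desc : ∀ {lo S w N l} → 1 ≤ lo → (∀ {l} → S l → Desc lo l) → Box lo S w N l → Desc (lo ℕ.+ w) l
Box-Desc {lo} 1≤lo h (done s)       = Desc-mono (ℕₚ.m≤m+n lo _) (h s)
Box-Desc {lo} 1≤lo h (put refl e≤w b) = cons (ℕₚ.≤-trans 1≤lo (ℕₚ.m≤m+n lo _)) (ℕₚ.+-monoʳ-≤ lo e≤w) (Box-Desc 1≤lo h b)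

Box-split : ∀ {lo S w N l} → Box lo S w N l → ∃₂ λ α β → l ≡ α ++ β × length α ≡ N × All (lo ≤_) α × S β
Box-split (done s) = [] , _ , refl , refl , [] , s
Box-split {lo} (put {x = x} refl _ b) with Box-split b
... | α , β , refl , refl , ps , s = x ∷ α , β , refl , refl , ℕₚ.m≤m+n lo _ ∷ ps , s

Box-join : ∀ {lo S} α {β w} → Desc (lo ℕ.+ w) (α ++ β) → All (lo ≤_) α → S β → Box lo S w (length α) (α ++ β)
Box-join []      d ps s = done s
Box-join {lo} (x ∷ α) {β} (cons p r d) (q ∷ ps) s = put (≡.sym (ℕₚ.m+[n∸m]≡n q))
  (ℕₚ.+-cancelˡ-≤ lo _ _ (ℕₚ.≤-trans (ℕₚ.≤-reflexive (ℕₚ.m+[n∸m]≡n q)) r))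
  (Box-join α (subst (λ k → Desc k (α ++ β)) (≡.sym (ℕₚ.m+[n∸m]≡n q)) d) ps s)

bound-split : ∀ {N b} c → N ≤ b → (N ℕ.+ c) ℕ.+ (b ∸ N) ≡ b ℕ.+ c
bound-split {N} {b} c N≤b = ≡.trans (e N c (b ∸ N)) (cong (ℕ._+ c) (ℕₚ.m+[n∸m]≡n N≤b))
  where
  e : ∀ N c d → (N ℕ.+ c) ℕ.+ d ≡ (N ℕ.+ d) ℕ.+ c
  e = ℕ-solve

Block⇒ : ∀ {c S w b l} → (∀ N {l} → S N l → Desc (N ℕ.+ c) l × Cover w l) → Block c S b l → Desc (b ℕ.+ c) l × Cover (c ∷ w) l
-- N = 0 is separate: the lower bound N + c may then be 0, whereas `Box-Desc` needs a positive one.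
Block⇒ {c} {S} {w} {b} h (zero , _ , done s) with h 0 s
... | d , cov = Desc-mono (ℕₚ.m≤n+m c b) d , [] , _ , refl , [] , cov
Block⇒ {c} {S} {w} {b} {l} h (suc N , N<sb , box) = subst (λ k → Desc k l) (bound-split c (ℕ.s≤s⁻¹ N<sb)) (Box-Desc (s≤s z≤n) (proj₁ ∘ h (suc N)) box) , covered (Box-split box)
  where
  covered : (∃₂ λ α β → l ≡ α ++ β × length α ≡ suc N × All (suc N ℕ.+ c ≤_) α × S (suc N) β) → Cover (c ∷ w) l
  covered (α , β , e , len , ps , s) = α , β , e , subst (λ k → All (k ℕ.+ c ≤_) α) (≡.sym len) ps , proj₂ (h (suc N) s)

-- N is the length of the widened first block. Its maximality bounds the remaining parts by N + c,
-- which is the bound that the next block requires.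
Block⇐ : ∀ {c S w b l} → (∀ N {l} → Desc (N ℕ.+ c) l → Cover w l → S N l) → Desc (b ℕ.+ c) l → Cover (c ∷ w) l → Block c S b l
Block⇐ {c} {S} {w} {b} h d (α , β , refl , ps , cov) with widen w c α β d ps cov
... | α′ , β′ , e , ps′ , d′ , cov′ rewrite e = length α′ , s≤s (short α′ ps′ d) ,
      Box-join α′ (subst (λ k → Desc k (α′ ++ β′)) (≡.sym (bound-split c (short α′ ps′ d))) d) ps′ (h _ d′ cov′)
  where
  short : ∀ α {β} → All (length α ℕ.+ c ≤_) α → Desc (b ℕ.+ c) (α ++ β) → length α ≤ b
  short []      _        _            = z≤n
  short (x ∷ α) (p ∷ ps) (cons _ r _) = ℕₚ.+-cancelʳ-≤ c _ _ (ℕₚ.≤-trans p r)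

Squares : ℕ → ℕ → List ℕ → Set
Squares zero    B l = l ≡ []
Squares (suc k) B l = Block 0 (Squares k) B l

Rectangles : ℕ → ℕ → ℕ → List ℕ → Set
Rectangles k zero    b = Squares k (suc b)
Rectangles k (suc p) b = Block 1 (Rectangles k p) b

-- Read from its end: an entry 0 for each ℓ < i (a block of p_{i,ℓ} parts), then an entry 1 for each
-- i ≤ ℓ < r (a block of p_{i,ℓ} - 1 parts), where k = i - 1 and p = r - i.
word : ℕ → ℕ → List ℕ
word k p = replicate p 1 ++ replicate k 0

Squares⇒ : ∀ k N {l} → Squares k N l → Desc (N ℕ.+ 0) l × Cover (replicate k 0) l
Squares⇒ zero    N refl = [] , refl
Squares⇒ (suc k) N s    = Block⇒ (Squares⇒ k) s

Squares⇐ : ∀ k N {l} → Desc (N ℕ.+ 0) l → Cover (replicate k 0) l → Squares k N l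
Squares⇐ zero    N d c = c
Squares⇐ (suc k) N d c = Block⇐ (Squares⇐ k) d c

Rectangles⇒ : ∀ k p N {l} → Rectangles k p N l → Desc (N ℕ.+ 1) l × Cover (word k p) l
Rectangles⇒ k zero    N {l} s with Squares⇒ k (suc N) s
... | d , c = subst (λ n → Desc n l) (≡.trans (ℕₚ.+-identityʳ (suc N)) (ℕₚ.+-comm 1 N)) d , c
Rectangles⇒ k (suc p) N s = Block⇒ (Rectangles⇒ k p) s

Rectangles⇐ : ∀ k p N {l} → Desc (N ℕ.+ 1) l → Cover (word k p) l → Rectangles k p N l
Rectangles⇐ k zero    N {l} d c = Squares⇐ k (suc N) (subst (λ n → Desc n l) (≡.sym (≡.trans (ℕₚ.+-identityʳ (suc N)) (ℕₚ.+-comm 1 N))) d) c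
Rectangles⇐ k (suc p) N d c = Block⇐ (Rectangles⇐ k p) d c

module CoverGF (M : ℕ) where
  open Sums M
  open GeneratingFunctions M
  open Bailey M X X-nil
  open import Relation.Binary.Reasoning.Setoid setoid

  -- By the first part: either its excess is at most w, or it is lo + w + 1 and is removed. This is
  -- Pascal's rule.
  box-gf : ∀ lo {S f} → HasGF S f → ∀ w N → HasGF (Box lo S w N) (X ^ (lo ℕ.* N) * (bin (w ℕ.+ N) N * f))
  box-gf lo {S} {f} F w zero = gf-≈
    (≈-sym (≈-trans (*-cong (q^≡ (ℕₚ.*-zeroʳ lo)) (*-congʳ (bin-zero (w ℕ.+ 0)))) (≈-trans (*-identityˡ _) (*-identityˡ _))))
    (gf-⇔ done (λ { (done s) _ → s }) F)
  box-gf lo {S} {f} F zero (suc N) = gf-≈ (begin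
      X ^ (lo ℕ.+ 0) * (X ^ (lo ℕ.* N) * (bin N N * f))
        ≈⟨ *-cong (q^≡ (ℕₚ.+-identityʳ lo)) (*-congˡ (*-congʳ (≈-trans (bin-self N) (≈-sym (bin-self (suc N)))))) ⟩
      X ^ lo * (X ^ (lo ℕ.* N) * (bin (suc N) (suc N) * f))
        ≈⟨ ≈-trans (≈-sym (*-assoc _ _ _)) (*-congʳ (≈-trans (≈-sym (q^+ lo (lo ℕ.* N))) (q^≡ (≡.sym (ℕₚ.*-suc lo N))))) ⟩
      X ^ (lo ℕ.* suc N) * (bin (suc N) (suc N) * f) ∎)
    (gf-⇔ (λ { (_ , refl , b) → put refl z≤n b }) (λ { (put refl z≤n b) _ → _ , refl , b }) (gf-cons (lo ℕ.+ 0) (box-gf lo F zero N)))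
  box-gf lo {S} {f} F (suc w) (suc N) = gf-≈ (begin
      X ^ (lo ℕ.* suc N) * (bin (w ℕ.+ suc N) (suc N) * f) + X ^ (lo ℕ.+ suc w) * (X ^ (lo ℕ.* N) * (bin (suc w ℕ.+ N) N * f))
        ≈⟨ +-congˡ (begin
             X ^ (lo ℕ.+ suc w) * (X ^ (lo ℕ.* N) * (bin (suc w ℕ.+ N) N * f))
               ≈⟨ *-cong (q^+ lo (suc w)) (*-congˡ (*-congʳ (reflexive (cong (λ k → bin k N) (≡.sym (ℕₚ.+-suc w N)))))) ⟩
             (X ^ lo * X ^ suc w) * (X ^ (lo ℕ.* N) * (bin (w ℕ.+ suc N) N * f))
               ≈⟨ solve 5 (λ a b c d f → (a :* b) :* (c :* (d :* f)) := (a :* c) :* ((b :* d) :* f)) ≈-refl (X ^ lo) (X ^ suc w) (X ^ (lo ℕ.* N)) (bin (w ℕ.+ suc N) N) f ⟩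
             (X ^ lo * X ^ (lo ℕ.* N)) * ((X ^ suc w * bin (w ℕ.+ suc N) N) * f)
               ≈⟨ *-cong (≈-trans (≈-sym (q^+ lo (lo ℕ.* N))) (q^≡ (≡.sym (ℕₚ.*-suc lo N)))) (*-congʳ (*-congʳ (q^≡ (≡.sym gap)))) ⟩
             X ^ (lo ℕ.* suc N) * ((X ^ ((w ℕ.+ suc N) ∸ N) * bin (w ℕ.+ suc N) N) * f) ∎) ⟩
      X ^ (lo ℕ.* suc N) * (bin (w ℕ.+ suc N) (suc N) * f) + X ^ (lo ℕ.* suc N) * ((X ^ ((w ℕ.+ suc N) ∸ N) * bin (w ℕ.+ suc N) N) * f)
        ≈⟨ solve 4 (λ e a b f → e :* (a :* f) :+ e :* (b :* f) := e :* ((a :+ b) :* f)) ≈-refl (X ^ (lo ℕ.* suc N)) (bin (w ℕ.+ suc N) (suc N)) _ f ⟩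
      X ^ (lo ℕ.* suc N) * ((bin (w ℕ.+ suc N) (suc N) + X ^ ((w ℕ.+ suc N) ∸ N) * bin (w ℕ.+ suc N) N) * f)
        ≈⟨ *-congˡ (*-congʳ (≈-sym (pascal (w ℕ.+ suc N) N))) ⟩
      X ^ (lo ℕ.* suc N) * (bin (suc w ℕ.+ suc N) (suc N) * f) ∎)
    (gf-⇔ forward (λ b _ → backward b) (gf-⊎ disjoint (box-gf lo F w (suc N)) (gf-cons (lo ℕ.+ suc w) (box-gf lo F (suc w) N))))
    where
    gap : (w ℕ.+ suc N) ∸ N ≡ suc w
    gap = ≡.trans (cong (_∸ N) (ℕₚ.+-suc w N)) (ℕₚ.m+n∸n≡m (suc w) N)
    Top : List ℕ → Set
    Top l = ∃ λ l′ → l ≡ lo ℕ.+ suc w ∷ l′ × Box lo S (suc w) N l′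
    forward : ∀ {l} → Box lo S w (suc N) l ⊎ Top l → Box lo S (suc w) (suc N) l
    forward (inj₁ (put e e≤w b))  = put e (ℕₚ.m≤n⇒m≤1+n e≤w) b
    forward (inj₂ (_ , refl , b)) = put refl ℕₚ.≤-refl b
    backward : ∀ {l} → Box lo S (suc w) (suc N) l → Box lo S w (suc N) l ⊎ Top l
    backward (put e e≤sw b) with ℕₚ.m≤n⇒m<n∨m≡n e≤sw
    ... | inj₁ (s≤s e≤w) = inj₁ (put e e≤w b)
    ... | inj₂ refl      = inj₂ (_ , cong (_∷ _) e , b)
    disjoint : ∀ {l} → Box lo S w (suc N) l → Top l → ⊥
    disjoint (put e e≤w _) (_ , refl , _) = ℕₚ.<⇒≱ (s≤s e≤w) (ℕₚ.≤-reflexive (ℕₚ.+-cancelˡ-≡ lo _ _ e))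

  block-gf : ∀ c {S g} b → (∀ N {l} → S N l → Desc (N ℕ.+ c) l) → (∀ N → HasGF (S N) (g N)) → HasGF (Block c S b) (D c g b)
  block-gf c {S} {g} b h G = gf-∑ (suc b) (λ {m} {n} → Block-unique {c} {S} {b} {m} {n} heads) (λ N N<sb → gf-≈
      (*-cong (q^≡ (ℕₚ.*-comm (N ℕ.+ c) N)) (*-congʳ (reflexive (cong (λ k → bin k N) (ℕₚ.m∸n+n≡m (ℕ.s≤s⁻¹ N<sb))))))
      (box-gf (N ℕ.+ c) (G N) (b ∸ N) N))
    where
    heads : ∀ N {x l} → S N (x ∷ l) → x ≤ N ℕ.+ c
    heads N s with h N s
    ... | cons _ r _ = r

  squares-gf : ∀ k N → HasGF (Squares k N) (squares k N)
  squares-gf zero    N = gf-[]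
  squares-gf (suc k) N = block-gf 0 N (λ N s → proj₁ (Squares⇒ k N s)) (squares-gf k)

  rectangles-gf : ∀ k p N → HasGF (Rectangles k p N) (rectangles k p N)
  rectangles-gf k zero    N = squares-gf k (suc N)
  rectangles-gf k (suc p) N = block-gf 1 N (λ N s → proj₁ (Rectangles⇒ k p N s)) (rectangles-gf k p)

-- Since covers are inherited by prefixes, cutting off the longest possible last block is optimal.

part-0 : ∀ l → part l 0 ≡ 0
part-0 []      = refl
part-0 (x ∷ l) = refl

partAt≡ : ∀ l a b → partAt l a b ≡ part l (a ∸ b)
partAt≡ l a b with a ≤ᵇ b in eq
... | true  = ≡.sym (≡.trans (cong (part l) (ℕₚ.m≤n⇒m∸n≡0 (ℕₚ.≤ᵇ⇒≤ a b (Equivalence.from T-≡ eq)))) (part-0 l))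
... | false = refl

take-last : ∀ l m → suc m ≤ length l → take (suc m) l ≡ take m l ++ part l (suc m) ∷ []
take-last (x ∷ l) zero    _       = refl
take-last (x ∷ l) (suc m) (s≤s p) = cong (x ∷_) (take-last l m p)

part-positive : ∀ {B} l m → Desc B l → suc m ≤ length l → 1 ≤ part l (suc m)
part-positive (x ∷ l) zero    (cons p _ _) _       = p
part-positive (x ∷ l) (suc m) (cons _ _ d) (s≤s q) = part-positive l m d q

take-above : ∀ {B} l m → Desc B l → suc m ≤ length l → All (part l (suc m) ≤_) (take (suc m) l)
take-above (x ∷ l) zero    _            _       = ℕₚ.≤-refl ∷ []
take-above (x ∷ l) (suc m) (cons _ _ d) (s≤s q) = part-bound (suc m) d ∷ take-above l m d q

last-∈ : ∀ {x : ℕ} γ δ t → γ ++ δ ≡ t ++ x ∷ [] → δ ≢ [] → x ∈ δ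
last-∈ {x} γ δ t e δ≢ with initLast δ
... | []       = ⊥-elim (δ≢ refl)
... | δ′ ∷ʳ′ y = ∈-++⁺ʳ δ′ (here (≡.sym (Listₚ.∷ʳ-injectiveʳ (γ ++ δ′) t (≡.trans (Listₚ.++-assoc γ δ′ (y ∷ [])) e))))

take-within : ∀ {n m} (l : List ℕ) → n ≤ m → take n (take m l) ≡ take n l
take-within {n} {m} l n≤m = ≡.trans (Listₚ.take-take n m l) (cong (λ k → take k l) (ℕₚ.m≤n⇒m⊓n≡m n≤m))

module _ {B} (l : List ℕ) (d : Desc B l) (w : List ℕ) (a m : ℕ) (m<s : suc m ≤ length l) where
  private
    x n : ℕ
    x = part l (suc m)
    n = suc m ∸ (x ∸ a)
    len : length (take (suc m) l) ≡ suc m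
    len = ≡.trans (Listₚ.length-take (suc m) l) (ℕₚ.m≤n⇒m⊓n≡m m<s)

  -- A non-empty last block contains the smallest part x, so it has at most x ∸ a members; the first
  -- n parts therefore lie within what the other blocks cover.
  greedy⇒ : Cover (w ++ a ∷ []) (take (suc m) l) → Cover w (take n l)
  greedy⇒ c with Cover-∷ʳ⇒ w c
  ... | γ , δ , e , c′ , ps = subst (Cover w) prefix (Cover-take w n c′)
    where
    short : ∀ δ → take (suc m) l ≡ γ ++ δ → All (length δ ℕ.+ a ≤_) δ → length δ ≤ x ∸ a
    short []        _ _  = z≤n
    short δ@(_ ∷ _) e ps = ℕₚ.≤-trans (ℕₚ.≤-reflexive (≡.sym (ℕₚ.m+n∸n≡m (length δ) a)))
      (ℕₚ.∸-monoˡ-≤ a (All.lookup ps (last-∈ γ δ (take m l) (≡.trans (≡.sym e) (take-last l m m<s)) (λ ()))))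
    n≤γ : n ≤ length γ
    n≤γ = ℕₚ.≤-trans (ℕₚ.∸-monoʳ-≤ (suc m) (short δ e ps)) (ℕₚ.≤-reflexive
      (≡.trans (cong (_∸ length δ) (≡.trans (≡.sym len) (≡.trans (cong length e) (Listₚ.length-++ γ)))) (ℕₚ.m+n∸n≡m (length γ) (length δ))))
    prefix : take n γ ≡ take n l
    prefix = ≡.trans (≡.sym (≡.trans (take-++ n γ δ) (≡.trans (cong (λ k → take n γ ++ take k δ) (ℕₚ.m≤n⇒m∸n≡0 n≤γ)) (Listₚ.++-identityʳ _))))
               (≡.trans (cong (take n) (≡.sym e)) (take-within l (ℕₚ.m∸n≤m (suc m) (x ∸ a))))

  -- The parts cut off number at most x ∸ a and are at least x, so they form a block, empty when x ≤
  -- a.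
  greedy⇐ : Cover w (take n l) → Cover (w ++ a ∷ []) (take (suc m) l)
  greedy⇐ c = subst (Cover (w ++ a ∷ [])) (Listₚ.take++drop≡id n (take (suc m) l))
    (Cover-∷ʳ⇐ w (take n (take (suc m) l)) δ (subst (Cover w) (≡.sym (take-within l (ℕₚ.m∸n≤m (suc m) (x ∸ a)))) c)
      (fits δ δ-short (Allₚ.drop⁺ n (take-above l m d m<s))))
    where
    δ : List ℕ
    δ = drop n (take (suc m) l)
    δ-short : length δ ≤ x ∸ a
    δ-short = ℕₚ.≤-trans (ℕₚ.≤-reflexive (≡.trans (Listₚ.length-drop n (take (suc m) l)) (cong (_∸ n) len)))
                (ℕₚ.m≤n+o⇒m∸n≤o (suc m) n (ℕₚ.≤-trans (ℕₚ.m≤n+m∸n (suc m) (x ∸ a)) (ℕₚ.≤-reflexive (ℕₚ.+-comm (x ∸ a) n))))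
    fits : ∀ δ → length δ ≤ x ∸ a → All (x ≤_) δ → All (length δ ℕ.+ a ≤_) δ
    fits []      _ _  = []
    fits (y ∷ δ) s ps = All.map (ℕₚ.≤-trans (ℕₚ.≤-trans (ℕₚ.+-monoˡ-≤ a s) (ℕₚ.≤-reflexive (ℕₚ.m∸n+n≡m (ℕₚ.<⇒≤ a<x))))) ps
      where
      a<x : a < x
      a<x = ℕₚ.m∸n≢0⇒n<m (λ e → ℕₚ.<⇒≱ (s≤s z≤n) (subst (suc (length δ) ≤_) e s))

-- The numbers p_{i,ℓ} as steps of the greedy algorithm

nonzeros : List ℕ → ℕ
nonzeros ps = length (filter (λ p → T? (not (p ≡ᵇ 0))) ps)

stopped-nonzeros : ∀ l i ℓ k σ → nonzeros (pSeq l i ℓ k σ true) ≡ 0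
stopped-nonzeros l i ℓ zero    σ = refl
stopped-nonzeros l i ℓ (suc k) σ = stopped-nonzeros l i (suc ℓ) k σ

replicate-∷ʳ : ∀ k (a : ℕ) → replicate (suc k) a ≡ replicate k a ++ a ∷ []
replicate-∷ʳ zero    a = refl
replicate-∷ʳ (suc k) a = cong (a ∷_) (replicate-∷ʳ k a)

module Greedy {B} (l : List ℕ) (d : Desc B l) (i p : ℕ) where
  private
    s : ℕ
    s = length l

  -- What `C-cond` asks of the last k numbers `ps` when all earlier ones are nonzero and have sum σ.
  Success : ℕ → ℕ → List ℕ → Set
  Success σ k ps = nonzeros ps < k ⊎ (nonzeros ps ≡ k × s ℕ.+ p ≤ σ ℕ.+ sum ps)

  next⇒ : ∀ {σ k x ps} → 1 ≤ x → Success σ (suc k) (x ∷ ps) → Success (σ ℕ.+ x) k ps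
  next⇒         (s≤s _) (inj₁ (s≤s lt))           = inj₁ lt
  next⇒ {σ} {x = x} {ps} (s≤s _) (inj₂ (e , le)) = inj₂ (ℕₚ.suc-injective e , ℕₚ.≤-trans le (ℕₚ.≤-reflexive (≡.sym (ℕₚ.+-assoc σ x (sum ps)))))

  next⇐ : ∀ {σ k x ps} → 1 ≤ x → Success (σ ℕ.+ x) k ps → Success σ (suc k) (x ∷ ps)
  next⇐         (s≤s _) (inj₁ lt)                = inj₁ (s≤s lt)
  next⇐ {σ} {x = x} {ps} (s≤s _) (inj₂ (e , le)) = inj₂ (cong suc e , ℕₚ.≤-trans le (ℕₚ.≤-reflexive (ℕₚ.+-assoc σ x (sum ps))))

  _⟷_ : Set → Set → Set
  A ⟷ A′ = (A → A′) × (A′ → A)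

  -- Here m parts are still uncovered. For m = 0 the next number is 0, which means success, and
  -- every word covers the empty list. Otherwise x is positive and x ∸ a parts are cut off. `rest`
  -- takes the stop flag as argument, so that the test x = 0 is decided in one place.
  step : ∀ {W w a σ k x m} (rest : Bool → List ℕ) → W ≡ w ++ a ∷ [] → x ≡ part l m → m ≤ s →
         nonzeros (rest true) ≡ 0 →
         (1 ≤ x → Success (σ ℕ.+ x) k (rest false) ⟷ Cover w (take (m ∸ (x ∸ a)) l)) →
         Success σ (suc k) (x ∷ rest (x ≡ᵇ 0)) ⟷ Cover W (take m l)
  step {w = w} {a} {m = zero} rest refl x≡ m≤s zeros ih rewrite ≡.trans x≡ (part-0 l) =
    (λ _ → Cover-[] (w ++ a ∷ [])) , (λ _ → inj₁ (s≤s (ℕₚ.≤-trans (ℕₚ.≤-reflexive zeros) z≤n)))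
  step {_} {w} {a} {σ} {k} {x} {suc m} rest refl x≡ m≤s zeros ih = by (x ≡ᵇ 0) refl
    where
    1≤x : 1 ≤ x
    1≤x = ℕₚ.≤-trans (part-positive l m d m≤s) (ℕₚ.≤-reflexive (≡.sym x≡))
    same : take (suc m ∸ (x ∸ a)) l ≡ take (suc m ∸ (part l (suc m) ∸ a)) l
    same = cong (λ y → take (suc m ∸ (y ∸ a)) l) x≡
    by : ∀ b → (x ≡ᵇ 0) ≡ b → Success σ (suc k) (x ∷ rest b) ⟷ Cover (w ++ a ∷ []) (take (suc m) l)
    by true  e = ⊥-elim (ℕₚ.<⇒≱ 1≤x (ℕₚ.≤-reflexive (ℕₚ.≡ᵇ⇒≡ x 0 (Equivalence.from T-≡ e))))
    by false e = (λ t → greedy⇐ l d w a m m≤s (subst (Cover w) same (proj₁ (ih 1≤x) (next⇒ 1≤x t))))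
               , (λ c → next⇐ 1≤x (proj₂ (ih 1≤x) (subst (Cover w) (≡.sym same) (greedy⇒ l d w a m m≤s c))))

  -- From ℓ = i on, a value x stands for x - 1 parts, so (s + ℓ) ∸ (i + σ) parts are left. At the
  -- end ℓ = r, and none is left exactly when s + (r - i) ≤ σ: the inequality of `C-cond`.
  rectangle-phase : ∀ k ℓ σ → i ≤ ℓ → ℓ ℕ.+ k ≡ i ℕ.+ p → (s ℕ.+ ℓ) ∸ (i ℕ.+ σ) ≤ s →
    Success σ k (pSeq l i ℓ k σ false) ⟷ Cover (replicate k 1) (take ((s ℕ.+ ℓ) ∸ (i ℕ.+ σ)) l)
  rectangle-phase zero ℓ σ i≤ℓ ℓ≡ m≤s = to , from
    where
    reach : s ℕ.+ ℓ ≡ i ℕ.+ (s ℕ.+ p)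
    reach = ≡.trans (cong (s ℕ.+_) (≡.trans (≡.sym (ℕₚ.+-identityʳ ℓ)) ℓ≡)) (e s i p)
      where
      e : ∀ s i p → s ℕ.+ (i ℕ.+ p) ≡ i ℕ.+ (s ℕ.+ p)
      e = ℕ-solve
    to : Success σ 0 [] → take ((s ℕ.+ ℓ) ∸ (i ℕ.+ σ)) l ≡ []
    to (inj₂ (_ , le)) = cong (λ m → take m l) (ℕₚ.m≤n⇒m∸n≡0 (ℕₚ.≤-trans (ℕₚ.≤-reflexive reach)
      (ℕₚ.+-monoʳ-≤ i (ℕₚ.≤-trans le (ℕₚ.≤-reflexive (ℕₚ.+-identityʳ σ))))))
    from : take ((s ℕ.+ ℓ) ∸ (i ℕ.+ σ)) l ≡ [] → Success σ 0 []
    from e = inj₂ (refl , ℕₚ.≤-trans (ℕₚ.+-cancelˡ-≤ i _ _ (ℕₚ.≤-trans (ℕₚ.≤-reflexive (≡.sym reach)) (ℕₚ.m∸n≡0⇒m≤n none))) (ℕₚ.≤-reflexive (≡.sym (ℕₚ.+-identityʳ σ))))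
      where
      none : (s ℕ.+ ℓ) ∸ (i ℕ.+ σ) ≡ 0
      none = ≡.trans (≡.sym (≡.trans (Listₚ.length-take _ l) (ℕₚ.m≤n⇒m⊓n≡m m≤s))) (cong length e)
  rectangle-phase (suc k) ℓ σ i≤ℓ ℓ≡ m≤s =
    step {w = replicate k 1} {a = 1} (pSeq l i (suc ℓ) k (σ ℕ.+ x)) (replicate-∷ʳ k 1) x≡ m≤s (stopped-nonzeros l i (suc ℓ) k (σ ℕ.+ x))
      (λ 1≤x → subst (λ m → Success (σ ℕ.+ x) k (pSeq l i (suc ℓ) k (σ ℕ.+ x) false) ⟷ Cover (replicate k 1) (take m l)) (shrink 1≤x)
        (rectangle-phase k (suc ℓ) (σ ℕ.+ x) (ℕₚ.m≤n⇒m≤1+n i≤ℓ) (≡.trans (≡.sym (ℕₚ.+-suc ℓ k)) ℓ≡)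
          (ℕₚ.≤-trans (ℕₚ.≤-reflexive (shrink 1≤x)) (ℕₚ.≤-trans (ℕₚ.m∸n≤m _ (x ∸ 1)) m≤s))))
    where
    x : ℕ
    x = if ℓ ≤ᵇ i then partAt l s σ else partAt l (s ℕ.+ ℓ) (i ℕ.+ σ)
    x≡ : x ≡ part l ((s ℕ.+ ℓ) ∸ (i ℕ.+ σ))
    x≡ with ℓ ≤ᵇ i in eq
    ... | false = partAt≡ l (s ℕ.+ ℓ) (i ℕ.+ σ)
    -- Only ℓ = i is possible here, where both clauses for p_{i,ℓ} name the same index.
    ... | true  = ≡.trans (partAt≡ l s σ) (cong (part l) (≡.sym (≡.trans (cong (λ j → (s ℕ.+ j) ∸ (i ℕ.+ σ)) (ℕₚ.≤-antisym (ℕₚ.≤ᵇ⇒≤ ℓ i (Equivalence.from T-≡ eq)) i≤ℓ))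
                    (≡.trans (cong (_∸ (i ℕ.+ σ)) (ℕₚ.+-comm s i)) (ℕₚ.[m+n]∸[m+o]≡n∸o i s σ)))))
    shrink : 1 ≤ x → (s ℕ.+ suc ℓ) ∸ (i ℕ.+ (σ ℕ.+ x)) ≡ ((s ℕ.+ ℓ) ∸ (i ℕ.+ σ)) ∸ (x ∸ 1)
    shrink 1≤x = ≡.trans (cong₂ _∸_ (ℕₚ.+-suc s ℓ) (≡.trans (cong (λ y → i ℕ.+ (σ ℕ.+ y)) (≡.sym (ℕₚ.m+[n∸m]≡n 1≤x))) (e i σ (x ∸ 1))))
                   (≡.sym (ℕₚ.∸-+-assoc (s ℕ.+ ℓ) (i ℕ.+ σ) (x ∸ 1)))
      where
      e : ∀ i σ y → i ℕ.+ (σ ℕ.+ suc y) ≡ suc (i ℕ.+ σ ℕ.+ y)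
      e = ℕ-solve

  -- For ℓ < i a value x stands for x parts, so s ∸ σ are left. The phase ends at ℓ = i, where this
  -- agrees with the index of `rectangle-phase`.
  square-phase : ∀ k ℓ σ → ℓ ℕ.+ k ≡ i →
    Success σ (k ℕ.+ p) (pSeq l i ℓ (k ℕ.+ p) σ false) ⟷ Cover (word k p) (take (s ∸ σ) l)
  square-phase zero ℓ σ ℓ≡ =
    ≡.subst₂ (λ w m → Success σ p (pSeq l i ℓ p σ false) ⟷ Cover w (take m l)) (≡.sym (Listₚ.++-identityʳ (replicate p 1))) m≡
      (rectangle-phase p ℓ σ (ℕₚ.≤-reflexive (≡.sym ℓ≡′)) (cong (ℕ._+ p) ℓ≡′) (ℕₚ.≤-trans (ℕₚ.≤-reflexive m≡) (ℕₚ.m∸n≤m s σ)))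
    where
    ℓ≡′ : ℓ ≡ i
    ℓ≡′ = ≡.trans (≡.sym (ℕₚ.+-identityʳ ℓ)) ℓ≡
    m≡ : (s ℕ.+ ℓ) ∸ (i ℕ.+ σ) ≡ s ∸ σ
    m≡ = ≡.trans (cong (λ j → (s ℕ.+ j) ∸ (i ℕ.+ σ)) ℓ≡′) (≡.trans (cong (_∸ (i ℕ.+ σ)) (ℕₚ.+-comm s i)) (ℕₚ.[m+n]∸[m+o]≡n∸o i s σ))
  square-phase (suc k) ℓ σ ℓ≡ =
    step {w = word k p} {a = 0} (pSeq l i (suc ℓ) (k ℕ.+ p) (σ ℕ.+ x))
      (≡.trans (cong (replicate p 1 ++_) (replicate-∷ʳ k 0)) (≡.sym (Listₚ.++-assoc (replicate p 1) (replicate k 0) (0 ∷ [])))) x≡ (ℕₚ.m∸n≤m s σ) (stopped-nonzeros l i (suc ℓ) (k ℕ.+ p) (σ ℕ.+ x))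
      (λ _ → subst (λ m → Success (σ ℕ.+ x) (k ℕ.+ p) (pSeq l i (suc ℓ) (k ℕ.+ p) (σ ℕ.+ x) false) ⟷ Cover (word k p) (take m l)) (≡.sym (ℕₚ.∸-+-assoc s σ x))
        (square-phase k (suc ℓ) (σ ℕ.+ x) (≡.trans (≡.sym (ℕₚ.+-suc ℓ k)) ℓ≡)))
    where
    x : ℕ
    x = if ℓ ≤ᵇ i then partAt l s σ else partAt l (s ℕ.+ ℓ) (i ℕ.+ σ)
    x≡ : x ≡ part l (s ∸ σ)
    x≡ with ℓ ≤ᵇ i in eq
    ... | true  = partAt≡ l s σ
    ... | false = ⊥-elim (subst T eq (ℕₚ.≤⇒≤ᵇ (ℕₚ.≤-trans (ℕₚ.m≤m+n ℓ (suc k)) (ℕₚ.≤-reflexive ℓ≡))))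

module _ (k p : ℕ) where
  private
    i r : ℕ
    i = suc k
    r = i ℕ.+ p

    r∸i : r ∸ i ≡ p
    r∸i = ℕₚ.m+n∸m≡n i p

  C⇒Cover : ∀ {B} l → Desc B l → T (C-cond r i l) → Cover (word k p) l
  C⇒Cover l d t = subst (Cover (word k p)) (Listₚ.take-all (length l) l ℕₚ.≤-refl) (proj₁ (square-phase k 1 0 refl) success)
    where
    open Greedy l d i p
    success : Success 0 (k ℕ.+ p) (ps r i l)
    success with Equivalence.to (T-∨ {N r i l <ᵇ r ∸ 1}) (proj₂ (Equivalence.to (T-∧ {atMostOnes i l}) t))
    ... | inj₁ lt = inj₁ (ℕₚ.<ᵇ⇒< (N r i l) (r ∸ 1) lt)
    ... | inj₂ b with Equivalence.to (T-∧ {N r i l ≡ᵇ r ∸ 1}) b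
    ...   | e , le = inj₂ (ℕₚ.≡ᵇ⇒≡ (N r i l) (r ∸ 1) e , subst (λ j → length l ℕ.+ j ≤ sum (ps r i l)) r∸i (ℕₚ.≤ᵇ⇒≤ _ _ le))

  Cover⇒C : ∀ {B} l → Desc B l → Cover (word k p) l → T (C-cond r i l)
  Cover⇒C l d c = Equivalence.from (T-∧ {atMostOnes i l}) (ones , Equivalence.from (T-∨ {N r i l <ᵇ r ∸ 1})
      (covered (proj₂ (square-phase k 1 0 refl) (subst (Cover (word k p)) (≡.sym (Listₚ.take-all (length l) l ℕₚ.≤-refl)) c))))
    where
    open Greedy l d i p
    ones : T (atMostOnes i l)
    ones = ℕₚ.<⇒<ᵇ (s≤s (ℕₚ.≤-trans (ℕₚ.≤-reflexive (onesCount≡ l)) (ℕₚ.≤-trans (Cover-ones (word k p) c)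
      (ℕₚ.≤-reflexive (≡.trans (count-++ 0 (replicate p 1) (replicate k 0)) (cong₂ ℕ._+_ (count-replicate-≢ 0 p (λ ())) (count-replicate 0 k)))))))
    covered : Success 0 (k ℕ.+ p) (ps r i l) → T (N r i l <ᵇ r ∸ 1) ⊎ T ((N r i l ≡ᵇ r ∸ 1) ∧ (length l ℕ.+ (r ∸ i) ≤ᵇ sum (ps r i l)))
    covered (inj₁ lt)       = inj₁ (ℕₚ.<⇒<ᵇ lt)
    covered (inj₂ (e , le)) = inj₂ (Equivalence.from (T-∧ {N r i l ≡ᵇ r ∸ 1})
      (ℕₚ.≡⇒≡ᵇ (N r i l) (r ∸ 1) e , ℕₚ.≤⇒≤ᵇ (subst (λ j → length l ℕ.+ j ≤ sum (ps r i l)) (≡.sym r∸i) le)))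

  C-coeff : ∀ M → + C-count r i M ≡ GeneratingFunctions.gordonSeries M i p M
  C-coeff M = count-coeff (C-cond r i) (gf-≈ (rectangles-limit k p) (rectangles-gf k p (M ℕ.+ M))) to from
    where
    open Sums M
    open GeneratingFunctions M
    open Bailey M X X-nil
    open CoverGF M
    to : ∀ {l} → Desc M l → sum l ≡ M → T (C-cond r i l) → Rectangles k p (M ℕ.+ M) l
    to {l} d _ t = Rectangles⇐ k p (M ℕ.+ M) (Desc-mono (ℕₚ.≤-trans (ℕₚ.m≤m+n M M) (ℕₚ.m≤m+n (M ℕ.+ M) 1)) d) (C⇒Cover l d t)
    from : ∀ {l} → Rectangles k p (M ℕ.+ M) l → sum l ≡ M → (∃ λ B → Desc B l) × T (C-cond r i l)
    from {l} s _ with Rectangles⇒ k p (M ℕ.+ M) s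
    ... | d , c = (_ , d) , Cover⇒C l d c

theorem1p4 : (r i : ℕ) → 2 ≤ r → 1 ≤ i → i ≤ r → (n : ℕ) →
    (C-count r i n ≡ T-count r i n) × (T-count r i n ≡ E-count r i n)
theorem1p4 r (suc k) _ _ i≤r n with ℕₚ.m≤n⇒∃[o]m+o≡n i≤r
... | p , refl =
  ℤₚ.+-injective (≡.trans (C-coeff k p n) (≡.sym (T-coeff n k p))) ,
  ℤₚ.+-injective (≡.trans (T-coeff n k p) (≡.sym (E-coeff k p n)))
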